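{- There is a deterministic algorithm $\mathcal{A}$ with the following guarantee. Given as input a randomized $q$-query algorithm $R:\{0,1\}^n\times\{0,1\}^m\to[0,1]$ with description length $N$ and an error parameter $\varepsilon\in(0,\frac12)$, the algorithm $\mathcal{A}$ runs in time $\mathrm{poly}(N)\cdot 2^{O(q/\varepsilon)}$ and returns a deterministic $O(q/\varepsilon)$-query algorithm $D:\{0,1\}^n\to[0,1]$ satisfying $$\mathop{\mathbb{E}}_{x}\Big[\big(D(x)-\mathop{\mathbb{E}}_{r}[R(x,r)]\big)^2\Big]\le\varepsilon,$$ where $x\sim\{0,1\}^n$ and $r\sim\{0,1\}^m$ are uniformly random.
   Context: Query algorithms are represented as binary decision trees. An $n$-variable randomized decision tree (RDT) is a binary tree with two types of internal nodes: decision nodes, which branch on the value of one of the boolean variables $x_1,\dots,x_n$, and stochastic nodes, which branch on the outcome of an independent $\mathrm{Bernoulli}(\frac12)$ random bit. Leaves are labelled by values in $[0,1]$. Its query complexity is the maximum number of decision nodes on any root-to-leaf path, and its randomness complexity is the maximum number $m$ of stochastic nodes on any root-to-leaf path. The RDT computes a function $R:\{0,1\}^n\times\{0,1\}^m\to[0,1]$, where $R(x,r)$ is the label of the leaf reached on input $x$ when the stochastic nodes encountered branch according to the bits of $r$. A randomized $q$-query algorithm is an RDT of query complexity at most $q$. A deterministic decision tree (DDT), or deterministic query algorithm, is an RDT with no stochastic nodes; it computes a function $D:\{0,1\}^n\to[0,1]$. The description length is the length of the description of the tree. Constants in $O(\cdot)$ and $\mathrm{poly}(\cdot)$ are absolu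te.
   Formalization: The leaf labels in [0,1] and the error parameter ε in (0,1/2) are taken to be rational numbers, given to the algorithm as binary numerators and denominators. -}

module Defs where

open import Data.Bool.Base using (Bool; true; false; if_then_else_)
open import Data.Fin.Base using (Fin; toℕ)
open import Data.Integer.Base using (+_; ∣_∣)
open import Data.Nat.Base using (ℕ; zero; suc; _⊔_; _^_)
import Data.Nat.Base as ℕ
open import Data.Nat.DivMod using (_/_; _%_)
open import Data.Nat.Logarithm using (⌊log₂_⌋)
open import Data.Nat.Properties using (m^n≢0; m≤m⊔n; m≤n⊔m)
open import Data.Product.Base using (Σ; _,_)
open import Data.Rational.Unnormalised.Base as ℚᵘ
  using (ℚᵘ; 0ℚᵘ; 1ℚᵘ; ↥_; ↧ₙ_)
open import Data.Vec.Base using (Vec; []; _∷_; lookup; truncate)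

------------------------------------------------------------------------
-- Decision trees

-- Labels are rational because trees are inputs and outputs of an algorithm
-- and must have a finite description.
record [0,1] : Set where
  constructor label
  field
    value : ℚᵘ
    0≤    : 0ℚᵘ ℚᵘ.≤ value
    ≤1    : value ℚᵘ.≤ 1ℚᵘ

open [0,1] public

-- In `decide i T₀ T₁` the subtree T₀ is followed when xᵢ = 0.
data RDT (n : ℕ) : Set where
  leaf   : [0,1] → RDT n
  decide : Fin n → RDT n → RDT n → RDT n
  flip   : RDT n → RDT n → RDT n

queries : ∀ {n} → RDT n → ℕ
queries (leaf _)         = 0
queries (decide _ T₀ T₁) = suc (queries T₀ ⊔ queries T₁)
queries (flip T₀ T₁)     = queries T₀ ⊔ queries T₁

randomness : ∀ {n} → RDT n → ℕ
randomness (leaf _)         = 0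
randomness (decide _ T₀ T₁) = randomness T₀ ⊔ randomness T₁
randomness (flip T₀ T₁)     = suc (randomness T₀ ⊔ randomness T₁)

-- The j-th stochastic node met on a path consumes the j-th bit of r.
run : ∀ {n} (T : RDT n) → Vec Bool n → Vec Bool (randomness T) → [0,1]
run (leaf p) x r = p
run (decide i T₀ T₁) x r =
  if lookup x i then run T₁ x (truncate (m≤n⊔m _ _) r)
                else run T₀ x (truncate (m≤m⊔n _ _) r)
run (flip T₀ T₁) x (b ∷ r) =
  if b then run T₁ x (truncate (m≤n⊔m _ _) r)
       else run T₀ x (truncate (m≤m⊔n _ _) r)

data Deterministic {n : ℕ} : RDT n → Set where
  leaf   : ∀ p → Deterministic (leaf p)
  decide : ∀ i {T₀ T₁} → Deterministic T₀ → Deterministic T₁ →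
           Deterministic (decide i T₀ T₁)

DDT : ℕ → Set
DDT n = Σ (RDT n) Deterministic

runᴰ : ∀ {n} → DDT n → Vec Bool n → [0,1]
runᴰ (_ , leaf p) x = p
runᴰ (_ , decide i d₀ d₁) x =
  if lookup x i then runᴰ (_ , d₁) x else runᴰ (_ , d₀) x

------------------------------------------------------------------------
-- Expectation over the uniform distribution on {0,1}ᵏ

∑ : ∀ {k} → (Vec Bool k → ℚᵘ) → ℚᵘ
∑ {zero}  f = f []
∑ {suc k} f = ∑ (λ x → f (false ∷ x)) ℚᵘ.+ ∑ (λ x → f (true ∷ x))

𝔼 : ∀ {k} → (Vec Bool k → ℚᵘ) → ℚᵘ
𝔼 {k} f = ((+ 1) ℚᵘ./ (2 ^ k)) {{m^n≢0 2 k}} ℚᵘ.* ∑ f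

_² : ℚᵘ → ℚᵘ
p ² = p ℚᵘ.* p

------------------------------------------------------------------------
-- Model of computation: a first-order call-by-value functional language on
-- binary trees (pure first-order Lisp with the single atom nil; Jones,
-- "Computability and Complexity").  With trees held as pointers each step
-- is O(1) on a pointer machine, so its running times agree up to a
-- polynomial with those of Turing machines.

infixr 5 _∙_

data Data : Set where
  nil : Data
  _∙_ : Data → Data → Data

size : Data → ℕ
size nil     = 1
size (d ∙ e) = suc (size d ℕ.+ size e)

-- Expressions with n variables, over k functions of the given arities.
data Exp {k : ℕ} (arity : Fin k → ℕ) (n : ℕ) : Set where
  var   : Fin n → Exp arity n
  nil   : Exp arity n
  _∙_   : Exp arity n → Exp arity n → Exp arity n
  let′  : Exp arity n → Exp arity (1 ℕ.+ n) → Exp arity n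
  -- The second branch binds the left (0) and right (1) subtree.
  case  : Exp arity n → Exp arity n → Exp arity (2 ℕ.+ n) → Exp arity n
  call  : (f : Fin k) → Vec (Exp arity n) (arity f) → Exp arity n

record Program (inputs : ℕ) : Set where
  field
    {count} : ℕ
    arity   : Fin count → ℕ
    body    : (f : Fin count) → Exp arity (arity f)
    main    : Exp arity inputs

-- `ρ ⊢ e ⇓ v ∣ t`: in environment ρ, e evaluates to v in t steps.
module Semantics {k : ℕ} {arity : Fin k → ℕ}
                 (body : (f : Fin k) → Exp arity (arity f)) where

  infix 4 _⊢_⇓_∣_ _⊢_⇓*_∣_

  mutual
    data _⊢_⇓_∣_ {n : ℕ} (ρ : Vec Data n) : Exp arity n → Data → ℕ → Set where
      var : ∀ i → ρ ⊢ var i ⇓ lookup ρ i ∣ 1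
      nil : ρ ⊢ nil ⇓ nil ∣ 1
      _∙_ : ∀ {e₁ e₂ v₁ v₂ s t} →
            ρ ⊢ e₁ ⇓ v₁ ∣ s → ρ ⊢ e₂ ⇓ v₂ ∣ t →
            ρ ⊢ e₁ ∙ e₂ ⇓ v₁ ∙ v₂ ∣ suc (s ℕ.+ t)
      let′ : ∀ {e₁ e₂ v w s t} →
             ρ ⊢ e₁ ⇓ v ∣ s → (v ∷ ρ) ⊢ e₂ ⇓ w ∣ t →
             ρ ⊢ let′ e₁ e₂ ⇓ w ∣ suc (s ℕ.+ t)
      case-nil : ∀ {e e₁ e₂ w s t} →
                 ρ ⊢ e ⇓ nil ∣ s → ρ ⊢ e₁ ⇓ w ∣ t →
                 ρ ⊢ case e e₁ e₂ ⇓ w ∣ suc (s ℕ.+ t)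
      case-∙ : ∀ {e e₁ e₂ u v w s t} →
               ρ ⊢ e ⇓ u ∙ v ∣ s → (u ∷ v ∷ ρ) ⊢ e₂ ⇓ w ∣ t →
               ρ ⊢ case e e₁ e₂ ⇓ w ∣ suc (s ℕ.+ t)
      call : ∀ {f es vs w s t} →
             ρ ⊢ es ⇓* vs ∣ s → vs ⊢ body f ⇓ w ∣ t →
             ρ ⊢ call f es ⇓ w ∣ suc (s ℕ.+ t)

    data _⊢_⇓*_∣_ {n : ℕ} (ρ : Vec Data n) :
                  ∀ {m} → Vec (Exp arity n) m → Vec Data m → ℕ → Set where
      []  : ρ ⊢ [] ⇓* [] ∣ 0
      _∷_ : ∀ {m e v s t} {es : Vec (Exp arity n) m} {vs} →
            ρ ⊢ e ⇓ v ∣ s → ρ ⊢ es ⇓* vs ∣ t →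
            ρ ⊢ e ∷ es ⇓* v ∷ vs ∣ (s ℕ.+ t)

-- The running time includes writing out the result in full.  Without this,
-- sharing would let t steps produce a tree with 2ᵗ nodes.
data _on_returns_inTime_ {m} (P : Program m) (ins : Vec Data m) (out : Data) :
                         ℕ → Set where
  halts : ∀ {t} →
          Semantics._⊢_⇓_∣_ (Program.body P) ins (Program.main P) out t →
          P on ins returns out inTime (t ℕ.+ size out)

------------------------------------------------------------------------
-- Descriptions

bit : ℕ → Data
bit zero    = nil
bit (suc _) = nil ∙ nil

digit : ℕ → ℕ → Data
digit i a = bit (((a / (2 ^ i)) {{m^n≢0 2 i}}) % 2)

length₂ : ℕ → ℕ
length₂ a = suc ⌊log₂ a ⌋

-- The k low-order binary digits of a, most significant first.
digits : ℕ → ℕ → Data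
digits zero    a = nil
digits (suc k) a = digit k a ∙ digits k a

-- The same for a and b, written one above the other.
digits² : ℕ → ℕ → ℕ → Data
digits² zero    a b = nil
digits² (suc k) a b = (digit k a ∙ digit k b) ∙ digits² k a b

⌜_⌝ᴺ : ℕ → Data
⌜ a ⌝ᴺ = digits (length₂ a) a

-- For rationals in [0,1], whose numerator has no more digits than the
-- denominator.  Aligned rows with the leading digits first let a program
-- approximate a number after reading only a prefix of its description; this
-- matters for ε, since the allowed time does not depend on how long the
-- description of ε is.
⌜_⌝ℚ : ℚᵘ → Data
⌜ p ⌝ℚ = digits² (length₂ (↧ₙ p)) ∣ ↥ p ∣ (↧ₙ p)

⌜_⌝ : ∀ {n} → RDT n → Data
⌜ leaf p ⌝         = nil ∙ ⌜ value p ⌝ℚ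
⌜ flip T₀ T₁ ⌝     = (nil ∙ nil) ∙ ⌜ T₀ ⌝ ∙ ⌜ T₁ ⌝
⌜ decide i T₀ T₁ ⌝ = (nil ∙ nil ∙ nil) ∙ ⌜ toℕ i ⌝ᴺ ∙ ⌜ T₀ ⌝ ∙ ⌜ T₁ ⌝

descriptionLength : ∀ {n} → RDT n → ℕ
descriptionLength T = size ⌜ T ⌝

------------------------------------------------------------------------

-- For ε > 0: e ≤ C · (q / ε).
_≤[_·_/_] : ℕ → ℕ → ℕ → ℚᵘ → Set
e ≤[ C · q / ε ] = ((+ e) ℚᵘ./ 1) ℚᵘ.* ε ℚᵘ.≤ (+ (C ℕ.* q)) ℚᵘ./ 1

module Submission where

-- Let f x be the expectation of R(x,r) over r.  The tree D is obtained by
-- letting R split the cube again and again.  A round replaces every leaf of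
-- the tree built so far, at which some restriction R' of R has to be
-- estimated, by a deterministic tree T obtained from R' by fixing the outcome
-- of each of its stochastic nodes; below T the restrictions of R' are to be
-- estimated.  Among all outcomes the round takes those that minimise the
-- expected variance of f at the new leaves.  After the last round every leaf
-- is labelled by the mean of the restriction that has arrived there, so that
-- the squared error of D is the expected variance at its leaves (`spread`).
--
-- A round is a dynamic programme and needs no enumeration of outcomes: the
-- variance at a leaf is a constant minus the square of the mean, so the round
-- maximises the expected square of the mean, taking averages at decision
-- nodes and maxima at stochastic nodes (`select`, `select-spread`).
--
-- One round turns variance V into at most (1 - 2 l) V + l * l, for each l
-- (`select-progress`).  Indeed the best outcome is at least as good as a
-- random one, and the mean is the best estimate at a leaf, hence at least as
-- good as c + l (v - c), where v is the label of that leaf in R' and c is the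
-- mean of R' (`select-distance`).  A random outcome of R' has expected label
-- f x on input x and all labels are in [0,1], which bounds the error of these
-- estimates (`distance-self`).  The bound is affine in V, so it survives
-- averaging over the leaves, and with l = 1 / (k + 2) it propagates the
-- estimate `spread ≤ 1 / (k + 1)` after k rounds (`refineTimes-spread`).
-- A number K of rounds between 1 / ε and 4 / ε is read off from the leading
-- zeros of ε (`rounds-spec`), and D makes at most K q queries.  If R makes no
-- queries at all, its mean is already the exact answer, and ε is not looked at.
--
-- All averages are computed as if decision nodes branched by fair coins.  This
-- is correct if no path queries a variable twice; therefore repeated queries
-- are removed first (`readOnce`).
--
-- Every quantity occurring in the computation is an exact fraction with
-- binary numerator and denominator.  The denominator of a mean has at most as
-- many digits as the tree (`average-fits`), that of a score polynomially many
-- (`select-fits`), and the tree under construction has depth at most K q.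
-- Hence all costs are bounded by a polynomial in M = N * 2 ^ (K q), which is
-- of the form poly(N) * 2 ^ O(q / ε) (`totalTime-poly`, `totalTime≤`).  For the
-- running time it suffices to count function calls, since the number of steps
-- between two calls is bounded by the size of the program (`time-bound`).

open import Defs

-- The algorithm on trees

module Trees where

  open import Data.Bool.Base using (Bool; true; false; if_then_else_)
  open import Data.Fin.Base using (Fin)
  open import Data.Fin.Properties using (_≟_)
  open import Data.Integer.Base as ℤ using (+_; -[1+_]; ∣_∣; +≤+)
  import Data.Integer.Properties as ℤ
  open import Data.Nat.Base using (ℕ; zero; suc; pred; _+_; _*_; _<ᵇ_; _≤_; z≤n)
  open import Data.Nat.Properties 
    using (+-mono-≤; *-mono-≤; *-monoˡ-≤; ≤-trans; ≤-reflexive; +-identityʳ; *-comm)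
  open import Data.Product.Base using (_×_; _,_; proj₁; proj₂)
  open import Data.Rational.Unnormalised.Base as ℚᵘ using (ℚᵘ; mkℚᵘ; ↥_; *≤*)
  open import Relation.Binary.PropositionalEquality using (sym; trans; cong; subst₂)
  open import Relation.Nullary.Decidable.Core using (does)

  -- The fraction num / (1 + den-1), not necessarily in lowest terms.  Arithmetic
  -- on fractions is defined so that it can be mirrored literally by binary
  -- arithmetic on numerators and denominators.
  record Fraction : Set where
    constructor _/suc_
    field
      num     : ℕ
      den-1   : ℕ

  open Fraction public

  ⟦_⟧ : Fraction → ℚᵘ
  ⟦ a /suc b ⟧ = mkℚᵘ (+ a) b

  -- Labels are nonnegative, so taking the absolute value loses nothing.
  fraction : [0,1] → Fraction
  fraction p = ∣ ↥ value p ∣ /suc ℚᵘ.denominator-1 (value p)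

  -- The average of two fractions.
  midpoint : Fraction → Fraction → Fraction
  midpoint (a /suc b) (c /suc d) = (a * suc d + c * suc b) /suc pred (2 * (suc b * suc d))

  square : Fraction → Fraction
  square (a /suc b) = (a * a) /suc pred (suc b * suc b)

  -- The test whether the first fraction is smaller than the second.
  less : Fraction → Fraction → Bool
  less (a /suc b) (c /suc d) = a * suc d <ᵇ c * suc b

  -- The restriction of a tree to the inputs with xᵢ = b; the result does not
  -- query xᵢ.
  fix : ∀ {n} → Fin n → Bool → RDT n → RDT n
  fix i b (leaf p)     = leaf p
  fix i b (flip T₀ T₁) = flip (fix i b T₀) (fix i b T₁)
  fix i b (decide j T₀ T₁) =
    if does (i ≟ j) then (if b then fix i b T₁ else fix i b T₀)
                    else decide j (fix i b T₀) (fix i b T₁)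

  -- The same tree without repeated queries of a variable along a path.
  readOnce : ∀ {n} → RDT n → RDT n
  readOnce (leaf p)         = leaf p
  readOnce (flip T₀ T₁)     = flip (readOnce T₀) (readOnce T₁)
  readOnce (decide i T₀ T₁) = decide i (fix i false (readOnce T₀)) (fix i true (readOnce T₁))

  -- Whether a decision node occurs.
  queries? : ∀ {n} → RDT n → Bool
  queries? (leaf p)         = false
  queries? (flip T₀ T₁)     = if queries? T₀ then true else queries? T₁
  queries? (decide i T₀ T₁) = true

  -- The mean label when both kinds of inner nodes branch by fair coins.  For
  -- trees without repeated queries this is the mean over inputs and coins.
  average : ∀ {n} → RDT n → Fraction
  average (leaf p)         = fraction p
  average (flip T₀ T₁)     = midpoint (average T₀) (average T₁)
  average (decide i T₀ T₁) = midpoint (average T₀) (average T₁)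

  -- A deterministic tree under construction: at the leaf `rest R` the function
  -- computed by R remains to be estimated.
  data Partial (n : ℕ) : Set where
    rest   : RDT n → Partial n
    decide : Fin n → Partial n → Partial n → Partial n

  -- The first of two scored trees, unless the second has a larger score.
  prefer : ∀ {n} → Fraction × Partial n → Fraction × Partial n → Fraction × Partial n
  prefer x y = if less (proj₁ x) (proj₁ y) then y else x

  -- `select T R` fixes the outcomes of the stochastic nodes of T so as to
  -- maximise the expected square of the mean of R at the leaves reached, where R
  -- is restricted along the path; it returns this maximum and the resulting tree.
  select : ∀ {n} → RDT n → RDT n → Fraction × Partial n
  select (leaf p)     R = square (average R) , rest R
  select (flip T₀ T₁) R = prefer (select T₀ R) (select T₁ R)
  select (decide i T₀ T₁) R =
    let (s₀ , P₀) = select T₀ (fix i false R)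
        (s₁ , P₁) = select T₁ (fix i true R)
    in midpoint s₀ s₁ , decide i P₀ P₁

  -- One round: every leaf R is split by the best outcome of R itself.
  refineAll : ∀ {n} → Partial n → Partial n
  refineAll (rest R)         = proj₂ (select R R)
  refineAll (decide i P₀ P₁) = decide i (refineAll P₀) (refineAll P₁)

  refineTimes : ∀ {n} → ℕ → Partial n → Partial n
  refineTimes zero    P = P
  refineTimes (suc k) P = refineAll (refineTimes k P)

  -- Fractions in the unit interval

  -- The fraction is at most 1.
  Proper : Fraction → Set
  Proper f = num f ≤ suc (den-1 f)

  fraction-proper : ∀ p → Proper (fraction p)
  fraction-proper (label (mkℚᵘ (+ a) d) _ (*≤* le)) =
    ℤ.drop‿+≤+ (subst₂ ℤ._≤_ (ℤ.*-identityʳ (+ a)) (ℤ.*-identityˡ (+ suc d)) le)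
  fraction-proper (label (mkℚᵘ -[1+ a ] d) (*≤* ()) _)

  midpoint-proper : ∀ {f g} → Proper f → Proper g → Proper (midpoint f g)
  midpoint-proper {a /suc b} {c /suc d} p q =
    ≤-trans (+-mono-≤ (*-monoˡ-≤ (suc d) p) (*-monoˡ-≤ (suc b) q))
      (≤-reflexive (cong (λ z → suc b * suc d + z) (trans (*-comm (suc d) (suc b)) (sym (+-identityʳ _)))))

  square-proper : ∀ {f} → Proper f → Proper (square f)
  square-proper p = *-mono-≤ p p

  average-proper : ∀ {n} (T : RDT n) → Proper (average T)
  average-proper (leaf p)         = fraction-proper p
  average-proper (flip T₀ T₁)     = midpoint-proper {average T₀} {average T₁} (average-proper T₀)
    (average-proper T₁)
  average-proper (decide i T₀ T₁) = midpoint-proper {average T₀} {average T₁} (average-proper T₀)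
    (average-proper T₁)

  toLabel : ∀ f → Proper f → [0,1]
  toLabel (a /suc b) p = label (mkℚᵘ (+ a) b)
    (*≤* (subst₂ ℤ._≤_ (sym (ℤ.*-zeroˡ (+ suc b))) (sym (ℤ.*-identityʳ (+ a))) (+≤+ z≤n)))
    (*≤* (subst₂ ℤ._≤_ (sym (ℤ.*-identityʳ (+ a))) (sym (ℤ.*-identityˡ (+ suc b))) (+≤+ p)))

  -- The tree whose leaves `rest R` have been labelled by the mean of R.
  complete : ∀ {n} → Partial n → RDT n
  complete (rest R)         = leaf (toLabel (average R) (average-proper R))
  complete (decide i P₀ P₁) = decide i (complete P₀) (complete P₁)

  complete-deterministic : ∀ {n} (P : Partial n) → Deterministic (complete P)
  complete-deterministic (rest R)         = leaf _
  complete-deterministic (decide i P₀ P₁) = decide i (complete-deterministic P₀) (complete-deterministic P₁)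

-- The error of the algorithm

module Analysis where

  open Trees
  open import Data.Bool.Base as Bool using (Bool; true; false; if_then_else_)
  open import Data.Fin.Base using (Fin; zero; suc)
  open import Data.Fin.Properties using (_≟_)
  open import Data.Integer.Base as ℤ using (+_)
  import Data.Integer.Properties as ℤ
  open import Data.Nat.Base as ℕ using (ℕ; zero; suc)
  import Data.Nat.Properties as ℕ
  open import Data.Nat.Tactic.RingSolver using (solve-∀)
  open import Data.Product.Base using (_×_; _,_; proj₁; proj₂)
  open import Data.Rational.Unnormalised.Base as ℚᵘ
    using (ℚᵘ; mkℚᵘ; 0ℚᵘ; 1ℚᵘ; ½; _+_; _*_; _-_; -_; _≃_; _≤_; *≡*; *≤*)
  open import Data.Rational.Unnormalised.Properties as ℚᵘ
  open import Data.Rational.Unnormalised.Solver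
  open import Data.Unit.Base using (⊤; tt)
  open import Data.Vec.Base using (Vec; []; _∷_; lookup; truncate; _[_]≔_)
  open import Data.Vec.Properties using (lookup∘update; lookup∘update′; []≔-lookup)
  open import Function.Base using (_∘_)
  open import Relation.Binary.PropositionalEquality as ≡ using (_≡_; _≢_; refl; cong; cong₂; subst; subst₂)
  open import Relation.Nullary.Decidable.Core using (does; yes; no)
  open import Relation.Nullary.Negation.Core using (contradiction)
  open +-*-Solver using (solve; _:=_; _:+_; _:*_; _:-_; :-_; con)

  -- The midpoint.  The laws needed about ½ are stated for `mid`.
  mid : ℚᵘ → ℚᵘ → ℚᵘ
  mid p q = ½ * (p + q)

  mid-cong : ∀ {p p′ q q′} → p ≃ p′ → q ≃ q′ → mid p q ≃ mid p′ q′
  mid-cong a b = *-congˡ {½} (+-cong a b)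

  mid-mono : ∀ {p p′ q q′} → p ≤ p′ → q ≤ q′ → mid p q ≤ mid p′ q′
  mid-mono a b = *-monoʳ-≤-nonNeg ½ (+-mono-≤ a b)

  mid-same : ∀ p → mid p p ≃ p
  mid-same p = ≃-trans (solve 2 (λ h p → h :* (p :+ p) := (h :+ h) :* p) ≃-refl ½ p)
    (≃-trans (*-congʳ {p} {½ + ½} {1ℚᵘ} (*≡* refl)) (*-identityˡ p))

  mid-+ : ∀ a b c d → mid (a + b) (c + d) ≃ mid a c + mid b d
  mid-+ = solve 4 (λ a b c d → con ½ :* ((a :+ b) :+ (c :+ d)) := con ½ :* (a :+ c) :+ con ½ :* (b :+ d)) ≃-refl

  mid-* : ∀ a p q → mid (a * p) (a * q) ≃ a * mid p q
  mid-* = solve 3 (λ a p q → con ½ :* (a :* p :+ a :* q) := a :* (con ½ :* (p :+ q))) ≃-refl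

  mid-swap : ∀ a b c d → mid (mid a b) (mid c d) ≃ mid (mid a c) (mid b d)
  mid-swap = solve 4 (λ a b c d → con ½ :* (con ½ :* (a :+ b) :+ con ½ :* (c :+ d)) := con ½ :* (con ½ :* (a :+ c) :+ con ½ :* (b :+ d))) ≃-refl

  -- The expectation over uniform bits, by recursion on their number rather than
  -- by a final division.
  E : ∀ {k} → (Vec Bool k → ℚᵘ) → ℚᵘ
  E {zero}  f = f []
  E {suc k} f = mid (E (f ∘ (false ∷_))) (E (f ∘ (true ∷_)))

  private
    half-/ : ∀ m .{{_ : ℕ.NonZero m}} .{{_ : ℕ.NonZero (2 ℕ.* m)}} → (+ 1 ℚᵘ./ (2 ℕ.* m)) ≃ ½ * (+ 1 ℚᵘ./ m)
    half-/ (suc m) = *≡* refl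

  𝔼≃E : ∀ {k} (f : Vec Bool k → ℚᵘ) → 𝔼 f ≃ E f
  𝔼≃E {zero}  f = *-identityˡ (f [])
  𝔼≃E {suc k} f = begin
    𝔼 f                                          ≈⟨ *-congʳ {F + T}
      (half-/ (2 ℕ.^ k) {{ℕ.m^n≢0 2 k}} {{ℕ.m^n≢0 2 (suc k)}}) ⟩
    ½ * w * (F + T)                              ≈⟨ solve 3 (λ w a b → con ½ :* w :* (a :+ b) := con ½ :* (w :* a :+ w :* b)) ≃-refl w F T ⟩
    mid (w * F) (w * T)                          ≈⟨ mid-cong (𝔼≃E (f ∘ (false ∷_))) (𝔼≃E (f ∘ (true ∷_))) ⟩
    E f                                          ∎
    where
    open ≃-Reasoning
    w F T : ℚᵘ
    w = (+ 1 ℚᵘ./ (2 ℕ.^ k)) {{ℕ.m^n≢0 2 k}}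
    F = ∑ (λ x → f (false ∷ x))
    T = ∑ (λ x → f (true ∷ x))

  E-cong : ∀ {k} {f g : Vec Bool k → ℚᵘ} → (∀ x → f x ≃ g x) → E f ≃ E g
  E-cong {zero}  h = h []
  E-cong {suc k} h = mid-cong (E-cong (λ x → h (false ∷ x))) (E-cong (λ x → h (true ∷ x)))

  E-mono : ∀ {k} {f g : Vec Bool k → ℚᵘ} → (∀ x → f x ≤ g x) → E f ≤ E g
  E-mono {zero}  h = h []
  E-mono {suc k} h = mid-mono (E-mono (λ x → h (false ∷ x))) (E-mono (λ x → h (true ∷ x)))

  E-const : ∀ {k} c → E {k} (λ _ → c) ≃ c
  E-const {zero}  c = ≃-refl
  E-const {suc k} c = ≃-trans (mid-cong (E-const {k} c) (E-const {k} c)) (mid-same c)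

  E-+ : ∀ {k} (f g : Vec Bool k → ℚᵘ) → E (λ x → f x + g x) ≃ E f + E g
  E-+ {zero}  f g = ≃-refl
  E-+ {suc k} f g = ≃-trans (mid-cong (E-+ (f ∘ (false ∷_)) (g ∘ (false ∷_)))
    (E-+ (f ∘ (true ∷_)) (g ∘ (true ∷_))))
    (mid-+ (E (f ∘ (false ∷_))) (E (g ∘ (false ∷_))) (E (f ∘ (true ∷_))) (E (g ∘ (true ∷_))))

  E-* : ∀ {k} c (f : Vec Bool k → ℚᵘ) → E (λ x → c * f x) ≃ c * E f
  E-* {zero}  c f = ≃-refl
  E-* {suc k} c f = ≃-trans (mid-cong (E-* c (f ∘ (false ∷_))) (E-* c (f ∘ (true ∷_))))
    (mid-* c (E (f ∘ (false ∷_))) (E (f ∘ (true ∷_))))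

  E-mid : ∀ {k} (f g : Vec Bool k → ℚᵘ) → E (λ x → mid (f x) (g x)) ≃ mid (E f) (E g)
  E-mid f g = ≃-trans (E-* ½ (λ x → f x + g x)) (*-congˡ {½} (E-+ f g))

  -- Conditioning on one bit.
  E-split : ∀ {k} (i : Fin k) (f : Vec Bool k → ℚᵘ) → E f ≃ mid (E (λ x → f (x [ i ]≔ false)))
    (E (λ x → f (x [ i ]≔ true)))
  E-split zero f = mid-cong (≃-sym (mid-same (E (f ∘ (false ∷_))))) (≃-sym (mid-same (E (f ∘ (true ∷_)))))
  E-split (suc i) f = ≃-trans (mid-cong (E-split i (f ∘ (false ∷_))) (E-split i (f ∘ (true ∷_))))
    (mid-swap (E (λ x → f (false ∷ (x [ i ]≔ false)))) (E (λ x → f (false ∷ (x [ i ]≔ true))))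
              (E (λ x → f (true ∷ (x [ i ]≔ false)))) (E (λ x → f (true ∷ (x [ i ]≔ true)))))

  E-truncate : ∀ {j k} (le : j ℕ.≤ k) (f : Vec Bool j → ℚᵘ) → E (λ x → f (truncate le x)) ≃ E f
  E-truncate {zero} {k} ℕ.z≤n f = E-const {k} (f [])
  E-truncate (ℕ.s≤s le) f = mid-cong (E-truncate le (f ∘ (false ∷_))) (E-truncate le (f ∘ (true ∷_)))

  -- The expectation of T(x,r) over r.
  eval : ∀ {n} → RDT n → Vec Bool n → ℚᵘ
  eval (leaf p)         x = value p
  eval (decide i T₀ T₁) x = if lookup x i then eval T₁ x else eval T₀ x
  eval (flip T₀ T₁)     x = mid (eval T₀ x) (eval T₁ x)

  eval-run : ∀ {n} (T : RDT n) x → E (λ r → value (run T x r)) ≃ eval T x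
  eval-run (leaf p) x = ≃-refl
  eval-run (decide i T₀ T₁) x with lookup x i
  ... | false = ≃-trans (E-truncate (ℕ.m≤m⊔n (randomness T₀) (randomness T₁)) (λ r → value (run T₀ x r)))
    (eval-run T₀ x)
  ... | true  = ≃-trans (E-truncate (ℕ.m≤n⊔m (randomness T₀) (randomness T₁)) (λ r → value (run T₁ x r)))
    (eval-run T₁ x)
  eval-run (flip T₀ T₁) x = mid-cong
    (≃-trans (E-truncate (ℕ.m≤m⊔n (randomness T₀) (randomness T₁)) (λ r → value (run T₀ x r))) (eval-run T₀ x))
    (≃-trans (E-truncate (ℕ.m≤n⊔m (randomness T₀) (randomness T₁)) (λ r → value (run T₁ x r))) (eval-run T₁ x))

  ⟦midpoint⟧ : ∀ f g → ⟦ midpoint f g ⟧ ≃ mid ⟦ f ⟧ ⟦ g ⟧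
  ⟦midpoint⟧ (a /suc b) (c /suc d) = *≡* (cong (ℤ._* + (2 ℕ.* (suc b ℕ.* suc d))) (begin
    + (a ℕ.* suc d ℕ.+ c ℕ.* suc b)                     ≡⟨ cong₂ ℤ._+_ (ℤ.pos-* a (suc d)) (ℤ.pos-* c (suc b)) ⟩
    + a ℤ.* + suc d ℤ.+ + c ℤ.* + suc b                 ≡⟨ ℤ.*-identityˡ _ ⟨
    + 1 ℤ.* (+ a ℤ.* + suc d ℤ.+ + c ℤ.* + suc b)       ∎))
    where open ≡.≡-Reasoning

  ⟦square⟧ : ∀ f → ⟦ square f ⟧ ≃ ⟦ f ⟧ * ⟦ f ⟧
  ⟦square⟧ (a /suc b) = *≡* (cong (ℤ._* + (suc b ℕ.* suc b)) (ℤ.pos-* a a))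

  ⟦fraction⟧ : ∀ p → ⟦ fraction p ⟧ ≃ value p
  ⟦fraction⟧ (label (mkℚᵘ (+ a) d) _ _) = ≃-refl
  ⟦fraction⟧ (label (mkℚᵘ (ℤ.-[1+ a ]) d) (*≤* ()) _)

  -- Trees without repeated queries

  -- The variable xᵢ is not queried.
  Fresh : ∀ {n} → Fin n → RDT n → Set
  Fresh i (leaf p)         = ⊤
  Fresh i (flip T₀ T₁)     = Fresh i T₀ × Fresh i T₁
  Fresh i (decide j T₀ T₁) = i ≢ j × Fresh i T₀ × Fresh i T₁

  -- No path queries a variable twice.
  ReadOnce : ∀ {n} → RDT n → Set
  ReadOnce (leaf p)         = ⊤
  ReadOnce (flip T₀ T₁)     = ReadOnce T₀ × ReadOnce T₁
  ReadOnce (decide i T₀ T₁) = (Fresh i T₀ × Fresh i T₁) × ReadOnce T₀ × ReadOnce T₁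

  fix-eval : ∀ {n} (i : Fin n) b T x → eval (fix i b T) x ≡ eval T (x [ i ]≔ b)
  fix-eval i b (leaf p)     x = refl
  fix-eval i b (flip T₀ T₁) x = cong₂ mid (fix-eval i b T₀ x) (fix-eval i b T₁ x)
  fix-eval i b (decide j T₀ T₁) x with i ≟ j
  fix-eval i false (decide j T₀ T₁) x | yes refl rewrite lookup∘update i x false = fix-eval i false T₀ x
  fix-eval i true  (decide j T₀ T₁) x | yes refl rewrite lookup∘update i x true  = fix-eval i true T₁ x
  fix-eval i b     (decide j T₀ T₁) x | no i≢j   rewrite lookup∘update′ {i = j} {j = i}
    (λ j≡i → i≢j (≡.sym j≡i)) x b with lookup x j
  ... | false = fix-eval i b T₀ x
  ... | true  = fix-eval i b T₁ x

  fix-fresh : ∀ {n} (i : Fin n) b T → Fresh i (fix i b T)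
  fix-fresh i b (leaf p)     = tt
  fix-fresh i b (flip T₀ T₁) = fix-fresh i b T₀ , fix-fresh i b T₁
  fix-fresh i b (decide j T₀ T₁) with i ≟ j
  fix-fresh i false (decide j T₀ T₁) | yes _  = fix-fresh i false T₀
  fix-fresh i true  (decide j T₀ T₁) | yes _  = fix-fresh i true T₁
  fix-fresh i b     (decide j T₀ T₁) | no i≢j = i≢j , fix-fresh i b T₀ , fix-fresh i b T₁

  fix-keeps-fresh : ∀ {n} (i j : Fin n) b T → Fresh j T → Fresh j (fix i b T)
  fix-keeps-fresh i j b (leaf p)     _         = tt
  fix-keeps-fresh i j b (flip T₀ T₁) (h₀ , h₁) = fix-keeps-fresh i j b T₀ h₀ , fix-keeps-fresh i j b T₁ h₁
  fix-keeps-fresh i j b (decide k T₀ T₁) (j≢k , h₀ , h₁) with does (i ≟ k)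
  fix-keeps-fresh i j false (decide k T₀ T₁) (j≢k , h₀ , h₁) | true  = fix-keeps-fresh i j false T₀ h₀
  fix-keeps-fresh i j true  (decide k T₀ T₁) (j≢k , h₀ , h₁) | true  = fix-keeps-fresh i j true T₁ h₁
  fix-keeps-fresh i j b     (decide k T₀ T₁) (j≢k , h₀ , h₁) | false =
    j≢k , fix-keeps-fresh i j b T₀ h₀ , fix-keeps-fresh i j b T₁ h₁

  fix-readOnce : ∀ {n} (i : Fin n) b T → ReadOnce T → ReadOnce (fix i b T)
  fix-readOnce i b (leaf p)     _         = tt
  fix-readOnce i b (flip T₀ T₁) (r₀ , r₁) = fix-readOnce i b T₀ r₀ , fix-readOnce i b T₁ r₁
  fix-readOnce i b (decide k T₀ T₁) ((h₀ , h₁) , r₀ , r₁) with does (i ≟ k)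
  fix-readOnce i false (decide k T₀ T₁) ((h₀ , h₁) , r₀ , r₁) | true  = fix-readOnce i false T₀ r₀
  fix-readOnce i true  (decide k T₀ T₁) ((h₀ , h₁) , r₀ , r₁) | true  = fix-readOnce i true T₁ r₁
  fix-readOnce i b     (decide k T₀ T₁) ((h₀ , h₁) , r₀ , r₁) | false =
    (fix-keeps-fresh i k b T₀ h₀ , fix-keeps-fresh i k b T₁ h₁) , fix-readOnce i b T₀ r₀ , fix-readOnce i b T₁
      r₁

  readOnce-correct : ∀ {n} (T : RDT n) → ReadOnce (readOnce T)
  readOnce-correct (leaf p)         = tt
  readOnce-correct (flip T₀ T₁)     = readOnce-correct T₀ , readOnce-correct T₁
  readOnce-correct (decide i T₀ T₁) =
    (fix-fresh i false (readOnce T₀) , fix-fresh i true (readOnce T₁)) ,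
    fix-readOnce i false (readOnce T₀) (readOnce-correct T₀) , fix-readOnce i true (readOnce T₁)
      (readOnce-correct T₁)

  readOnce-eval : ∀ {n} (T : RDT n) x → eval (readOnce T) x ≡ eval T x
  readOnce-eval (leaf p)         x = refl
  readOnce-eval (flip T₀ T₁)     x = cong₂ mid (readOnce-eval T₀ x) (readOnce-eval T₁ x)
  readOnce-eval (decide i T₀ T₁) x with lookup x i in q
  ... | false = ≡.trans (fix-eval i false (readOnce T₀) x)
    (≡.trans (cong (eval (readOnce T₀)) (≡.trans (cong (x [ i ]≔_) (≡.sym q)) ([]≔-lookup x i)))
      (readOnce-eval T₀ x))
  ... | true  = ≡.trans (fix-eval i true (readOnce T₁) x)
    (≡.trans (cong (eval (readOnce T₁)) (≡.trans (cong (x [ i ]≔_) (≡.sym q)) ([]≔-lookup x i)))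
      (readOnce-eval T₁ x))

  fresh-eval : ∀ {n} (i : Fin n) b T x → Fresh i T → eval T (x [ i ]≔ b) ≡ eval T x
  fresh-eval i b (leaf p)     x _         = refl
  fresh-eval i b (flip T₀ T₁) x (h₀ , h₁) = cong₂ mid (fresh-eval i b T₀ x h₀) (fresh-eval i b T₁ x h₁)
  fresh-eval i b (decide j T₀ T₁) x (i≢j , h₀ , h₁)
    rewrite lookup∘update′ {i = j} {j = i} (λ j≡i → i≢j (≡.sym j≡i)) x b with lookup x j
  ... | false = fresh-eval i b T₀ x h₀
  ... | true  = fresh-eval i b T₁ x h₁

  -- The expectation of a function that is given separately on the two halves of
  -- the cube determined by xᵢ.
  E-decide : ∀ {n} (i : Fin n) (f f₀ f₁ : Vec Bool n → ℚᵘ) →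
             (∀ x → f (x [ i ]≔ false) ≃ f₀ x) → (∀ x → f (x [ i ]≔ true) ≃ f₁ x) → E f ≃ mid (E f₀) (E f₁)
  E-decide i f f₀ f₁ h₀ h₁ = ≃-trans (E-split i f) (mid-cong (E-cong h₀) (E-cong h₁))

  if-update : ∀ {n} {A : Set} (i : Fin n) b (t e : A) x → (if lookup (x [ i ]≔ b) i then t else e) ≡
    (if b then t else e)
  if-update i b t e x = cong (if_then t else e) (lookup∘update i x b)

  average-eval : ∀ {n} (T : RDT n) → ReadOnce T → E (eval T) ≃ ⟦ average T ⟧
  average-eval {n} (leaf p) _ = ≃-trans (E-const {n} (value p)) (≃-sym (⟦fraction⟧ p))
  average-eval (flip T₀ T₁) (r₀ , r₁) = ≃-trans (E-mid (eval T₀) (eval T₁))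
    (≃-trans (mid-cong (average-eval T₀ r₀) (average-eval T₁ r₁))
      (≃-sym (⟦midpoint⟧ (average T₀) (average T₁))))
  average-eval (decide i T₀ T₁) ((h₀ , h₁) , r₀ , r₁) = ≃-trans
    (E-decide i (eval (decide i T₀ T₁)) (eval T₀) (eval T₁)
      (λ x → ≃-reflexive (≡.trans (if-update i false (eval T₁ (x [ i ]≔ false)) (eval T₀ (x [ i ]≔ false)) x)
        (fresh-eval i false T₀ x h₀)))
      (λ x → ≃-reflexive (≡.trans (if-update i true (eval T₁ (x [ i ]≔ true)) (eval T₀ (x [ i ]≔ true)) x)
        (fresh-eval i true T₁ x h₁))))
    (≃-trans (mid-cong (average-eval T₀ r₀) (average-eval T₁ r₁))
      (≃-sym (⟦midpoint⟧ (average T₀) (average T₁))))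

  -- Without decision nodes the value does not depend on the input, so that no
  -- freshness condition is needed.
  constant-eval : ∀ {n} (T : RDT n) → queries? T ≡ false → ∀ x → eval T x ≃ ⟦ average T ⟧
  constant-eval (leaf p)     _ x = ≃-sym (⟦fraction⟧ p)
  constant-eval (flip T₀ T₁) q x with queries? T₀ in q₀
  ... | false = ≃-trans (mid-cong (constant-eval T₀ q₀ x) (constant-eval T₁ q x))
    (≃-sym (⟦midpoint⟧ (average T₀) (average T₁)))

  -- Variance

  Var : ∀ {n} → (Vec Bool n → ℚᵘ) → ℚᵘ
  Var g = E (λ x → (g x - E g) ²)

  -- The second moment.
  E² : ∀ {n} → (Vec Bool n → ℚᵘ) → ℚᵘ
  E² g = E (λ x → g x * g x)

  E-square : ∀ {n} (g : Vec Bool n → ℚᵘ) a → E (λ x → (g x - a) ²) ≃ (E² g + (- (a + a)) * E g) + a * a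
  E-square {n} g a = begin
    E (λ x → (g x - a) ²)
      ≈⟨ E-cong (λ x → solve 2 (λ g a → (g :- a) :* (g :- a) := (g :* g :+ (:- (a :+ a)) :* g) :+ a :* a) ≃-refl (g x) a) ⟩
    E (λ x → (g x * g x + (- (a + a)) * g x) + a * a)    ≈⟨ E-+ (λ x → g x * g x + (- (a + a)) * g x)
      (λ _ → a * a) ⟩
    E (λ x → g x * g x + (- (a + a)) * g x) + E {n} (λ _ → a * a)
      ≈⟨ +-cong (≃-trans (E-+ (λ x → g x * g x) (λ x → (- (a + a)) * g x)) (+-congʳ (E² g) (E-* (- (a + a)) g)))
        (E-const {n} (a * a)) ⟩
    (E² g + (- (a + a)) * E g) + a * a                   ∎
    where open ≃-Reasoning

  Var-moments : ∀ {n} (g : Vec Bool n → ℚᵘ) → Var g ≃ E² g - E g * E g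
  Var-moments g = ≃-trans (E-square g (E g))
    (solve 2 (λ s m → (s :+ (:- (m :+ m)) :* m) :+ m :* m := s :- m :* m) ≃-refl (E² g) (E g))

  0≤-* : ∀ {p q} → 0ℚᵘ ≤ p → 0ℚᵘ ≤ q → 0ℚᵘ ≤ p * q
  0≤-* {p} {q} a b = nonNegative⁻¹ (p * q)
    {{nonNeg*nonNeg⇒nonNeg p {{ℚᵘ.nonNegative a}} q {{ℚᵘ.nonNegative b}}}}

  0≤square : ∀ p → 0ℚᵘ ≤ p * p
  0≤square p@(mkℚᵘ (+ a) d) = 0≤-* {p} {p} (nonNegative⁻¹ p) (nonNegative⁻¹ p)
  0≤square p@(mkℚᵘ (ℤ.-[1+ a ]) d) = ≤-trans (0≤-* {(- p)} {(- p)} (nonNegative⁻¹ (- p)) (nonNegative⁻¹ (- p)))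
    (≤-reflexive (solve 1 (λ p → (:- p) :* (:- p) := p :* p) ≃-refl p))

  -- The mean minimises the mean squared distance to a constant.
  Var≤ : ∀ {n} (g : Vec Bool n → ℚᵘ) a → Var g ≤ E (λ x → (g x - a) ²)
  Var≤ g a = begin
    Var g                                          ≃⟨ ≃-sym (+-identityʳ (Var g)) ⟩
    Var g + 0ℚᵘ                                    ≤⟨ +-monoʳ-≤ (Var g) (0≤square (E g - a)) ⟩
    Var g + (E g - a) * (E g - a)                  ≃⟨ +-congˡ _ (Var-moments g) ⟩
    (E² g - E g * E g) + (E g - a) * (E g - a)
      ≃⟨ solve 3 (λ s m a → (s :- m :* m) :+ (m :- a) :* (m :- a) := (s :+ (:- (a :+ a)) :* m) :+ a :* a) ≃-refl (E² g) (E g) a ⟩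
    (E² g + (- (a + a)) * E g) + a * a             ≃⟨ ≃-sym (E-square g a) ⟩
    E (λ x → (g x - a) ²)                          ∎
    where open ≤-Reasoning

  -- Progress in one round

  -- The expected variance of the functions at the leaves.
  spread : ∀ {n} → Partial n → ℚᵘ
  spread (rest R)         = Var (eval R)
  spread (decide i P₀ P₁) = mid (spread P₀) (spread P₁)

  -- The test `less` compares the represented rationals, by cross-multiplication.
  less-false : ∀ f g → less f g ≡ false → ⟦ g ⟧ ≤ ⟦ f ⟧
  less-false (a /suc b) (c /suc d) q = *≤* (subst₂ ℤ._≤_ (ℤ.pos-* c (suc b)) (ℤ.pos-* a (suc d))
    (ℤ.+≤+ (ℕ.≮⇒≥ λ lt → contradiction (ℕ.<⇒<ᵇ lt) (λ t → subst Bool.T q t))))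

  less-true : ∀ f g → less f g ≡ true → ⟦ f ⟧ ≤ ⟦ g ⟧
  less-true (a /suc b) (c /suc d) q = *≤* (subst₂ ℤ._≤_ (ℤ.pos-* a (suc d)) (ℤ.pos-* c (suc b))
    (ℤ.+≤+ (ℕ.<⇒≤ (ℕ.<ᵇ⇒< (a ℕ.* suc d) (c ℕ.* suc b) (subst Bool.T (≡.sym q) tt)))))

  sub-mono : ∀ e {p q} → p ≤ q → e - q ≤ e - p
  sub-mono e p≤q = +-monoʳ-≤ e (neg-mono-≤ p≤q)

  mid-sub : ∀ a b c d → mid (a - b) (c - d) ≃ mid a c - mid b d
  mid-sub a b c d = ≃-trans (mid-+ a (- b) c (- d))
    (+-congʳ (mid a c) (solve 3 (λ h b d → h :* ((:- b) :+ (:- d)) := :- (h :* (b :+ d))) ≃-refl ½ b d))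

  -- The score of a selected tree and its spread add up to the second moment, which
  -- does not depend on the selection.
  select-spread : ∀ {n} (T R : RDT n) → ReadOnce R → spread (proj₂ (select T R)) ≃ E² (eval R) - ⟦ proj₁
    (select T R) ⟧
  select-spread (leaf p) R r = ≃-trans (Var-moments (eval R)) (+-congʳ (E² (eval R)) (-‿cong
    (≃-trans (*-cong (average-eval R r) (average-eval R r)) (≃-sym (⟦square⟧ (average R))))))
  select-spread (flip T₀ T₁) R r with less (proj₁ (select T₀ R)) (proj₁ (select T₁ R))
  ... | false = select-spread T₀ R r
  ... | true  = select-spread T₁ R r
  select-spread (decide i T₀ T₁) R r = begin
    mid (spread (proj₂ (select T₀ R₀))) (spread (proj₂ (select T₁ R₁)))
      ≈⟨ mid-cong (select-spread T₀ R₀ (fix-readOnce i false R r))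
        (select-spread T₁ R₁ (fix-readOnce i true R r)) ⟩
    mid (E² (eval R₀) - s₀) (E² (eval R₁) - s₁)                ≈⟨ mid-sub (E² (eval R₀)) s₀ (E² (eval R₁)) s₁ ⟩
    mid (E² (eval R₀)) (E² (eval R₁)) - mid s₀ s₁
      ≈⟨ +-cong (≃-sym (E-decide i (λ x → eval R x * eval R x) (λ x → eval R₀ x * eval R₀ x)
        (λ x → eval R₁ x * eval R₁ x) (sq false) (sq true)))
                (-‿cong (≃-sym (⟦midpoint⟧ (proj₁ (select T₀ R₀)) (proj₁ (select T₁ R₁))))) ⟩
    E² (eval R) - ⟦ midpoint (proj₁ (select T₀ R₀)) (proj₁ (select T₁ R₁)) ⟧ ∎
    where
    open ≃-Reasoning
    R₀ = fix i false R
    R₁ = fix i true R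
    s₀ = ⟦ proj₁ (select T₀ R₀) ⟧
    s₁ = ⟦ proj₁ (select T₁ R₁) ⟧
    sq : ∀ b x → eval R (x [ i ]≔ b) * eval R (x [ i ]≔ b) ≃ eval (fix i b R) x * eval (fix i b R) x
    sq b x = ≃-reflexive (≡.sym (cong₂ _*_ (fix-eval i b R x) (fix-eval i b R x)))

  -- A maximum of scores is at least their average.
  select-flip : ∀ {n} (T₀ T₁ R : RDT n) → ReadOnce R →
    spread (proj₂ (select (flip T₀ T₁) R)) ≤ mid (spread (proj₂ (select T₀ R))) (spread (proj₂ (select T₁ R)))
  select-flip T₀ T₁ R r = ≤-trans (≤-reflexive (≃-sym (mid-same s))) (mid-mono (proj₁ below) (proj₂ below))
    where
    s = spread (proj₂ (select (flip T₀ T₁) R))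
    x₀ = select T₀ R
    x₁ = select T₁ R
    ordered : ∀ {f g} P Q → spread P ≃ E² (eval R) - ⟦ f ⟧ → spread Q ≃ E² (eval R) - ⟦ g ⟧ → ⟦ f ⟧ ≤ ⟦ g ⟧ →
      spread Q ≤ spread P
    ordered {f} {g} P Q p q f≤g = ≤-trans (≤-reflexive q)
      (≤-trans (sub-mono (E² (eval R)) f≤g) (≤-reflexive (≃-sym p)))
    below : s ≤ spread (proj₂ x₀) × s ≤ spread (proj₂ x₁)
    below with less (proj₁ x₀) (proj₁ x₁) in q
    ... | false = ≤-refl , ordered (proj₂ x₁) (proj₂ x₀) (select-spread T₁ R r) (select-spread T₀ R r)
      (less-false (proj₁ x₀) (proj₁ x₁) q)
    ... | true  = ordered (proj₂ x₀) (proj₂ x₁) (select-spread T₀ R r) (select-spread T₁ R r)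
      (less-true (proj₁ x₀) (proj₁ x₁) q) , ≤-refl

  -- The expectation over r of (g x - a(T(x,r)))², where the estimate of g x depends
  -- only on the label reached.
  distance : ∀ {n} → (ℚᵘ → ℚᵘ) → RDT n → (Vec Bool n → ℚᵘ) → Vec Bool n → ℚᵘ
  distance a (leaf p)         g x = (g x - a (value p)) ²
  distance a (flip T₀ T₁)     g x = mid (distance a T₀ g x) (distance a T₁ g x)
  distance a (decide i T₀ T₁) g x = if lookup x i then distance a T₁ g x else distance a T₀ g x

  distance-fresh : ∀ {n} a (i : Fin n) b T (g g′ : Vec Bool n → ℚᵘ) → Fresh i T → (∀ x → g′ x ≡ g (x [ i ]≔ b))
    →
                   ∀ x → distance a T g (x [ i ]≔ b) ≡ distance a T g′ x
  distance-fresh a i b (leaf p)     g g′ _ h x = cong (λ z → (z - a (value p)) ²) (≡.sym (h x))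
  distance-fresh a i b (flip T₀ T₁) g g′ (h₀ , h₁) h x =
    cong₂ mid (distance-fresh a i b T₀ g g′ h₀ h x) (distance-fresh a i b T₁ g g′ h₁ h x)
  distance-fresh a i b (decide j T₀ T₁) g g′ (i≢j , h₀ , h₁) h x
    rewrite lookup∘update′ {i = j} {j = i} (λ j≡i → i≢j (≡.sym j≡i)) x b with lookup x j
  ... | false = distance-fresh a i b T₀ g g′ h₀ h x
  ... | true  = distance-fresh a i b T₁ g g′ h₁ h x

  -- The selected outcome with the best labels is at least as good as a random
  -- outcome with its labels modified by a.
  select-distance : ∀ {n} a (T R : RDT n) → ReadOnce T → ReadOnce R →
                    spread (proj₂ (select T R)) ≤ E (distance a T (eval R))
  select-distance a (leaf p) R _ r = Var≤ (eval R) (a (value p))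
  select-distance a (flip T₀ T₁) R (t₀ , t₁) r = ≤-trans (select-flip T₀ T₁ R r)
    (≤-trans (mid-mono (select-distance a T₀ R t₀ r) (select-distance a T₁ R t₁ r))
      (≤-reflexive (≃-sym (E-mid (distance a T₀ (eval R)) (distance a T₁ (eval R))))))
  select-distance a (decide i T₀ T₁) R ((h₀ , h₁) , t₀ , t₁) r = ≤-trans
    (mid-mono (select-distance a T₀ R₀ t₀ (fix-readOnce i false R r))
      (select-distance a T₁ R₁ t₁ (fix-readOnce i true R r)))
    (≤-reflexive (≃-sym (E-decide i (distance a (decide i T₀ T₁) g) (distance a T₀ (eval R₀))
      (distance a T₁ (eval R₁))
      (λ x → ≃-reflexive (≡.trans (if-update i false (distance a T₁ g (x [ i ]≔ false))
        (distance a T₀ g (x [ i ]≔ false)) x)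
                                  (distance-fresh a i false T₀ g (eval R₀) h₀ (fix-eval i false R) x)))
      (λ x → ≃-reflexive (≡.trans (if-update i true (distance a T₁ g (x [ i ]≔ true))
        (distance a T₀ g (x [ i ]≔ true)) x)
                                  (distance-fresh a i true T₁ g (eval R₁) h₁ (fix-eval i true R) x))))))
    where
    g = eval R
    R₀ = fix i false R
    R₁ = fix i true R

  0≤-+ : ∀ {p q} → 0ℚᵘ ≤ p → 0ℚᵘ ≤ q → 0ℚᵘ ≤ p + q
  0≤-+ {p} {q} a b = ≤-trans (≤-reflexive (≃-sym (+-identityʳ 0ℚᵘ))) (+-mono-≤ a b)

  -- From 1 - (v - c)² = (1 - v + c) (v + 1 - c).
  square-difference≤1 : ∀ {v c} → 0ℚᵘ ≤ v → v ≤ 1ℚᵘ → 0ℚᵘ ≤ c → c ≤ 1ℚᵘ → (v - c) * (v - c) ≤ 1ℚᵘ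
  square-difference≤1 {v} {c} 0≤v v≤1 0≤c c≤1 = begin
    (v - c) * (v - c)                                              ≃⟨ ≃-sym (+-identityʳ _) ⟩
    (v - c) * (v - c) + 0ℚᵘ
      ≤⟨ +-monoʳ-≤ ((v - c) * (v - c)) (0≤-* (0≤-+ (p≤q⇒0≤q-p v≤1) 0≤c) (0≤-+ 0≤v (p≤q⇒0≤q-p c≤1))) ⟩
    (v - c) * (v - c) + ((1ℚᵘ - v) + c) * (v + (1ℚᵘ - c))
      ≃⟨ solve 2 (λ v c → (v :- c) :* (v :- c) :+ ((con 1ℚᵘ :- v) :+ c) :* (v :+ (con 1ℚᵘ :- c)) := con 1ℚᵘ) ≃-refl v c ⟩
    1ℚᵘ                                                            ∎
    where open ≤-Reasoning

  eval≥0 : ∀ {n} (T : RDT n) x → 0ℚᵘ ≤ eval T x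
  eval≥0 (leaf p) x = 0≤ p
  eval≥0 (flip T₀ T₁) x = ≤-trans (≤-reflexive (≃-sym (mid-same 0ℚᵘ))) (mid-mono (eval≥0 T₀ x) (eval≥0 T₁ x))
  eval≥0 (decide i T₀ T₁) x with lookup x i
  ... | false = eval≥0 T₀ x
  ... | true  = eval≥0 T₁ x

  eval≤1 : ∀ {n} (T : RDT n) x → eval T x ≤ 1ℚᵘ
  eval≤1 (leaf p) x = ≤1 p
  eval≤1 (flip T₀ T₁) x = ≤-trans (mid-mono (eval≤1 T₀ x) (eval≤1 T₁ x)) (≤-reflexive (mid-same 1ℚᵘ))
  eval≤1 (decide i T₀ T₁) x with lookup x i
  ... | false = eval≤1 T₀ x
  ... | true  = eval≤1 T₁ x

  module _ {n : ℕ} (R : RDT n) where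
    mean≥0 : 0ℚᵘ ≤ E (eval R)
    mean≥0 = ≤-trans (≤-reflexive (≃-sym (E-const {n} 0ℚᵘ))) (E-mono (eval≥0 R))

    mean≤1 : E (eval R) ≤ 1ℚᵘ
    mean≤1 = ≤-trans (E-mono (eval≤1 R)) (≤-reflexive (E-const {n} 1ℚᵘ))

    Var≤1 : Var (eval R) ≤ 1ℚᵘ
    Var≤1 = ≤-trans (E-mono (λ x → square-difference≤1 (eval≥0 R x) (eval≤1 R x) mean≥0 mean≤1))
      (≤-reflexive (E-const {n} 1ℚᵘ))

  module _ (c l : ℚᵘ) (0≤c : 0ℚᵘ ≤ c) (c≤1 : c ≤ 1ℚᵘ) where

    -- The estimate c + l (v - c) suggested by a label v.
    shrink : ℚᵘ → ℚᵘ
    shrink v = c + l * (v - c)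

    -- The bound (z - c)² - 2 l (z - c) (v - c) + l² on (z - shrink v)² is affine in v;
    -- hence it can be averaged over the outcomes of T.
    private
      constantTerm slope : ℚᵘ → ℚᵘ
      constantTerm z = ((z - c) * (z - c) + (l + l) * ((z - c) * c)) + l * l
      slope z = - ((l + l) * (z - c))

    distance≤ : ∀ {n} (T : RDT n) g x → distance shrink T g x ≤ constantTerm (g x) + slope (g x) * eval T x
    distance≤ (leaf p) g x = begin
      (z - shrink v) * (z - shrink v)
        ≃⟨ solve 4 (λ z v c l → (z :- (c :+ l :* (v :- c))) :* (z :- (c :+ l :* (v :- c))) :=
             ((z :- c) :* (z :- c) :+ (l :+ l) :* ((z :- c) :* (c :- v))) :+ (l :* l) :* ((v :- c) :* (v :- c)))
               ≃-refl z v c l ⟩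
      ((z - c) * (z - c) + (l + l) * ((z - c) * (c - v))) + (l * l) * ((v - c) * (v - c))
        ≤⟨ +-monoʳ-≤ ((z - c) * (z - c) + (l + l) * ((z - c) * (c - v)))
             (*-monoʳ-≤-nonNeg (l * l) {{ℚᵘ.nonNegative (0≤square l)}}
               (square-difference≤1 (0≤ p) (≤1 p) 0≤c c≤1)) ⟩
      ((z - c) * (z - c) + (l + l) * ((z - c) * (c - v))) + (l * l) * 1ℚᵘ
        ≃⟨ solve 4 (λ z v c l → ((z :- c) :* (z :- c) :+ (l :+ l) :* ((z :- c) :* (c :- v))) :+ (l :* l) :* con 1ℚᵘ :=
             (((z :- c) :* (z :- c) :+ (l :+ l) :* ((z :- c) :* c)) :+ l :* l) :+ (:- ((l :+ l) :* (z :- c))) :*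
               v) ≃-refl z v c l ⟩
      constantTerm z + slope z * v ∎
      where
      open ≤-Reasoning
      z = g x
      v = value p
    distance≤ (flip T₀ T₁) g x = ≤-trans (mid-mono (distance≤ T₀ g x) (distance≤ T₁ g x))
      (≤-reflexive (≃-trans (mid-+ A (B * eval T₀ x) A (B * eval T₁ x))
        (+-cong (mid-same A) (mid-* B (eval T₀ x) (eval T₁ x)))))
      where
      A = constantTerm (g x)
      B = slope (g x)
    distance≤ (decide i T₀ T₁) g x with lookup x i
    ... | false = distance≤ T₀ g x
    ... | true  = distance≤ T₁ g x

    distance-self : ∀ {n} (R : RDT n) x → distance shrink R (eval R) x ≤ (1ℚᵘ - (l + l)) * (eval R x - c) ² + l
      * l
    distance-self R x = ≤-trans (distance≤ R (eval R) x)
      (≤-reflexive (solve 3 (λ z c l → (((z :- c) :* (z :- c) :+ (l :+ l) :* ((z :- c) :* c)) :+ l :* l) :+ (:- ((l :+ l) :* (z :- c))) :* z :=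
         (con 1ℚᵘ :- (l :+ l)) :* ((z :- c) :* (z :- c)) :+ l :* l) ≃-refl (eval R x) c l))

  -- One round at a single leaf.
  select-progress : ∀ {n} l (R : RDT n) → ReadOnce R → spread (proj₂ (select R R)) ≤ (1ℚᵘ - (l + l)) * Var
    (eval R) + l * l
  select-progress {n} l R r = begin
    spread (proj₂ (select R R))                                   ≤⟨ select-distance (shrink c l 0≤c c≤1) R R r
      r ⟩
    E (distance (shrink c l 0≤c c≤1) R (eval R))                  ≤⟨ E-mono (distance-self c l 0≤c c≤1 R) ⟩
    E (λ x → (1ℚᵘ - (l + l)) * (eval R x - c) ² + l * l)          ≃⟨ E-+
      (λ x → (1ℚᵘ - (l + l)) * (eval R x - c) ²) (λ _ → l * l) ⟩
    E (λ x → (1ℚᵘ - (l + l)) * (eval R x - c) ²) + E {n} (λ _ → l * l)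
      ≃⟨ +-cong (E-* (1ℚᵘ - (l + l)) (λ x → (eval R x - c) ²)) (E-const {n} (l * l)) ⟩
    (1ℚᵘ - (l + l)) * Var (eval R) + l * l                        ∎
    where
    open ≤-Reasoning
    c = E (eval R)
    0≤c = mean≥0 R
    c≤1 = mean≤1 R

  -- All rounds

  -- The variable xᵢ is neither queried nor occurs in a tree at a leaf.
  FreshP : ∀ {n} → Fin n → Partial n → Set
  FreshP i (rest R)         = Fresh i R
  FreshP i (decide j P₀ P₁) = i ≢ j × FreshP i P₀ × FreshP i P₁

  -- `Splits P f`: the leaves of P hold the restrictions of f along their paths, and
  -- no variable is queried again below its decision node.  The restrictions f₀, f₁
  -- are given up to pointwise equality.
  data Splits {n} : Partial n → (Vec Bool n → ℚᵘ) → Set where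
    rest   : ∀ {R f} → ReadOnce R → (∀ x → eval R x ≡ f x) → Splits (rest R) f
    decide : ∀ {i P₀ P₁ f} f₀ f₁ → FreshP i P₀ → FreshP i P₁ →
             (∀ x → f₀ x ≡ f (x [ i ]≔ false)) → (∀ x → f₁ x ≡ f (x [ i ]≔ true)) →
             Splits P₀ f₀ → Splits P₁ f₁ → Splits (decide i P₀ P₁) f

  Splits-cong : ∀ {n} {P : Partial n} {f g} → (∀ x → f x ≡ g x) → Splits P f → Splits P g
  Splits-cong h (rest r e) = rest r (λ x → ≡.trans (e x) (h x))
  Splits-cong h (decide f₀ f₁ h₀ h₁ e₀ e₁ s₀ s₁) =
    decide f₀ f₁ h₀ h₁ (λ x → ≡.trans (e₀ x) (h _)) (λ x → ≡.trans (e₁ x) (h _)) s₀ s₁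

  select-fresh : ∀ {n} (j : Fin n) (T R : RDT n) → Fresh j T → Fresh j R → FreshP j (proj₂ (select T R))
  select-fresh j (leaf p)     R _ r = r
  select-fresh j (flip T₀ T₁) R (t₀ , t₁) r with less (proj₁ (select T₀ R)) (proj₁ (select T₁ R))
  ... | false = select-fresh j T₀ R t₀ r
  ... | true  = select-fresh j T₁ R t₁ r
  select-fresh j (decide i T₀ T₁) R (j≢i , t₀ , t₁) r =
    j≢i , select-fresh j T₀ (fix i false R) t₀ (fix-keeps-fresh i j false R r) ,
          select-fresh j T₁ (fix i true R) t₁ (fix-keeps-fresh i j true R r)

  select-splits : ∀ {n} (T R : RDT n) → ReadOnce T → ReadOnce R → Splits (proj₂ (select T R)) (eval R)
  select-splits (leaf p)     R _ r = rest r (λ _ → refl)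
  select-splits (flip T₀ T₁) R (t₀ , t₁) r with less (proj₁ (select T₀ R)) (proj₁ (select T₁ R))
  ... | false = select-splits T₀ R t₀ r
  ... | true  = select-splits T₁ R t₁ r
  select-splits (decide i T₀ T₁) R ((h₀ , h₁) , t₀ , t₁) r = decide (eval (fix i false R)) (eval (fix i true R))
    (select-fresh i T₀ (fix i false R) h₀ (fix-fresh i false R))
      (select-fresh i T₁ (fix i true R) h₁ (fix-fresh i true R))
    (fix-eval i false R) (fix-eval i true R)
    (select-splits T₀ (fix i false R) t₀ (fix-readOnce i false R r))
      (select-splits T₁ (fix i true R) t₁ (fix-readOnce i true R r))

  refineAll-fresh : ∀ {n} (j : Fin n) (P : Partial n) → FreshP j P → FreshP j (refineAll P)
  refineAll-fresh j (rest R) h = select-fresh j R R h h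
  refineAll-fresh j (decide i P₀ P₁) (j≢i , h₀ , h₁) = j≢i , refineAll-fresh j P₀ h₀ , refineAll-fresh j P₁ h₁

  refineAll-splits : ∀ {n} {P : Partial n} {f} → Splits P f → Splits (refineAll P) f
  refineAll-splits (rest {R} r e) = Splits-cong e (select-splits R R r r)
  refineAll-splits (decide {P₀ = P₀} {P₁} f₀ f₁ h₀ h₁ e₀ e₁ s₀ s₁) =
    decide f₀ f₁ (refineAll-fresh _ P₀ h₀) (refineAll-fresh _ P₁ h₁) e₀ e₁ (refineAll-splits s₀)
      (refineAll-splits s₁)

  refineTimes-splits : ∀ {n} k {P : Partial n} {f} → Splits P f → Splits (refineTimes k P) f
  refineTimes-splits zero    s = s
  refineTimes-splits (suc k) s = refineAll-splits (refineTimes-splits k s)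

  refineAll-progress : ∀ {n} l {P : Partial n} {f} → Splits P f → spread (refineAll P) ≤ (1ℚᵘ - (l + l)) *
    spread P + l * l
  refineAll-progress l (rest {R} r _) = select-progress l R r
  refineAll-progress l (decide {P₀ = P₀} {P₁} _ _ _ _ _ _ s₀ s₁) =
    ≤-trans (mid-mono (refineAll-progress l s₀) (refineAll-progress l s₁))
      (≤-reflexive (≃-trans (mid-+ (A * spread P₀) (l * l) (A * spread P₁) (l * l))
        (+-cong (mid-* A (spread P₀) (spread P₁)) (mid-same (l * l)))))
    where A = 1ℚᵘ - (l + l)

  -- The rational 1 / (k + 1).
  reciprocal : ℕ → ℚᵘ
  reciprocal k = mkℚᵘ (+ 1) k

  -- 1 / (k + 1) - 1 / (k + 2) = 1 / ((k + 1) (k + 2)).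
  reciprocal-step : ∀ k → reciprocal k ≃ reciprocal (suc k) + reciprocal (suc k) * reciprocal k
  reciprocal-step k = begin
    v                        ≈⟨ ≃-sym (*-identityʳ v) ⟩
    v * 1ℚᵘ                  ≈⟨ *-congˡ {v} (≃-sym (inverse (suc k))) ⟩
    v * (l * whole (suc k))  ≈⟨ *-congˡ {v} (*-congˡ {l} whole-suc) ⟩
    v * (l * (1ℚᵘ + d))      ≈⟨ solve 3 (λ v l d → v :* (l :* (con 1ℚᵘ :+ d)) := l :* (v :* d) :+ l :* v) ≃-refl v l d ⟩
    l * (v * d) + l * v      ≈⟨ +-congˡ (l * v) (≃-trans (*-congˡ {l} (inverse k)) (*-identityʳ l)) ⟩
    l + l * v                ∎
    where
    open ≃-Reasoning
    whole : ℕ → ℚᵘ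
    whole m = mkℚᵘ (+ suc m) 0
    v l d : ℚᵘ
    v = reciprocal k
    l = reciprocal (suc k)
    d = whole k
    inverse : ∀ m → reciprocal m * whole m ≃ 1ℚᵘ
    inverse m = *≡* (cong +_ (e m))
      where
      e : ∀ m → (suc m ℕ.+ 0) ℕ.* 1 ≡ (suc m ℕ.* 1 ℕ.+ 0)
      e = solve-∀
    whole-suc : whole (suc k) ≃ 1ℚᵘ + d
    whole-suc = *≡* (cong +_ (e k))
      where
      e : ∀ k → suc (suc k) ℕ.* 1 ≡ suc (suc k ℕ.* 1) ℕ.* 1
      e = solve-∀

  -- With v = 1 / (k + 1) and l = 1 / (k + 2), the left side falls short of l by
  -- l * l * v.
  reciprocal-progress : ∀ k → (1ℚᵘ - (reciprocal (suc k) + reciprocal (suc k))) * reciprocal k + reciprocal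
    (suc k) * reciprocal (suc k) ≤ reciprocal (suc k)
  reciprocal-progress k = begin
    (1ℚᵘ - (l + l)) * v + l * l                         ≃⟨ ≃-sym (+-identityʳ _) ⟩
    ((1ℚᵘ - (l + l)) * v + l * l) + 0ℚᵘ
      ≤⟨ +-monoʳ-≤ ((1ℚᵘ - (l + l)) * v + l * l) (0≤-* (0≤square l) (nonNegative⁻¹ v)) ⟩
    ((1ℚᵘ - (l + l)) * v + l * l) + (l * l) * v
      ≃⟨ solve 2 (λ v l → ((con 1ℚᵘ :- (l :+ l)) :* v :+ l :* l) :+ (l :* l) :* v := (v :+ l :* (l :+ l :* v)) :- (l :* v :+ l :* v)) ≃-refl v l ⟩
    (v + l * (l + l * v)) - (l * v + l * v)
      ≃⟨ +-congˡ (- (l * v + l * v)) (+-cong (reciprocal-step k) (*-congˡ {l} (≃-sym (reciprocal-step k)))) ⟩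
    ((l + l * v) + l * v) - (l * v + l * v)
      ≃⟨ solve 2 (λ l w → ((l :+ w) :+ w) :- (w :+ w) := l) ≃-refl l (l * v) ⟩
    l                                                   ∎
    where
    open ≤-Reasoning
    v l : ℚᵘ
    v = reciprocal k
    l = reciprocal (suc k)

  -- The coefficient 1 - 2 l of the variance is nonnegative.
  two-reciprocals≤1 : ∀ k → reciprocal (suc k) + reciprocal (suc k) ≤ 1ℚᵘ
  two-reciprocals≤1 k = ≤-trans (+-mono-≤ l≤½ l≤½) (≤-reflexive (*≡* refl))
    where
    l≤½ : reciprocal (suc k) ≤ ½
    l≤½ = *≤* (ℤ.+≤+ (ℕ.s≤s (ℕ.s≤s ℕ.z≤n)))

  refineTimes-spread : ∀ {n} k (R : RDT n) → ReadOnce R → spread (refineTimes k (rest R)) ≤ reciprocal k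
  refineTimes-spread zero    R r = Var≤1 R
  refineTimes-spread (suc k) R r = begin
    spread (refineTimes (suc k) (rest R))                       ≤⟨ refineAll-progress l
      (refineTimes-splits k (rest r (λ _ → refl))) ⟩
    (1ℚᵘ - (l + l)) * spread (refineTimes k (rest R)) + l * l
      ≤⟨ +-monoˡ-≤ (l * l) (*-monoʳ-≤-nonNeg (1ℚᵘ - (l + l)) {{ℚᵘ.nonNegative (p≤q⇒0≤q-p (two-reciprocals≤1 k))}}
        (refineTimes-spread k R r)) ⟩
    (1ℚᵘ - (l + l)) * reciprocal k + l * l                      ≤⟨ reciprocal-progress k ⟩
    l                                                           ∎
    where
    open ≤-Reasoning
    l : ℚᵘ
    l = reciprocal (suc k)

  -- The completed tree

  completed : ∀ {n} → Partial n → DDT n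
  completed P = complete P , complete-deterministic P

  output : ∀ {n} → Partial n → Vec Bool n → ℚᵘ
  output P x = value (runᴰ (completed P) x)

  output-decide : ∀ {n} (i : Fin n) P₀ P₁ x → output (decide i P₀ P₁) x ≡
    (if lookup x i then output P₁ x else output P₀ x)
  output-decide i P₀ P₁ x with lookup x i
  ... | false = refl
  ... | true  = refl

  output-fresh : ∀ {n} (i : Fin n) b P x → FreshP i P → output P (x [ i ]≔ b) ≡ output P x
  output-fresh i b (rest R)         x _ = refl
  output-fresh i b (decide j P₀ P₁) x (i≢j , h₀ , h₁)
    rewrite lookup∘update′ {i = j} {j = i} (λ j≡i → i≢j (≡.sym j≡i)) x b with lookup x j
  ... | false = output-fresh i b P₀ x h₀
  ... | true  = output-fresh i b P₁ x h₁

  square-swap : ∀ a b → (a - b) * (a - b) ≃ (b - a) * (b - a)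
  square-swap = solve 2 (λ a b → (a :- b) :* (a :- b) := (b :- a) :* (b :- a)) ≃-refl

  -- Every leaf is labelled by its mean, so the squared error there is the variance.
  output-error : ∀ {n} {P : Partial n} {f} → Splits P f → E (λ x → (output P x - f x) ²) ≃ spread P
  output-error {P = rest R} {f} (rest r e) = E-cong λ x → ≃-trans (square-swap ⟦ average R ⟧ (f x))
    (*-cong (same x) (same x))
    where
    same : ∀ x → f x - ⟦ average R ⟧ ≃ eval R x - E (eval R)
    same x = +-cong (≃-reflexive (≡.sym (e x))) (-‿cong (≃-sym (average-eval R r)))
  output-error {P = decide i P₀ P₁} {f} (decide f₀ f₁ h₀ h₁ e₀ e₁ s₀ s₁) = ≃-trans
    (E-decide i (λ x → (output (decide i P₀ P₁) x - f x) ²) (λ x → (output P₀ x - f₀ x) ²)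
      (λ x → (output P₁ x - f₁ x) ²)
      (λ x → ≃-reflexive (cong₂ (λ u v → (u - v) ²)
        (≡.trans (output-decide i P₀ P₁ (x [ i ]≔ false))
          (≡.trans (if-update i false _ _ x) (output-fresh i false P₀ x h₀))) (≡.sym (e₀ x))))
      (λ x → ≃-reflexive (cong₂ (λ u v → (u - v) ²)
        (≡.trans (output-decide i P₀ P₁ (x [ i ]≔ true))
          (≡.trans (if-update i true _ _ x) (output-fresh i true P₁ x h₁))) (≡.sym (e₁ x)))))
    (mid-cong (output-error s₀) (output-error s₁))

  -- The number of random bits read may depend on the path; unread bits do not matter.
  error≃ : ∀ {n} (R : RDT n) (D : DDT n) →
           𝔼 (λ x → (value (runᴰ D x) - 𝔼 (λ r → value (run R x r))) ²) ≃ E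
             (λ x → (value (runᴰ D x) - eval R x) ²)
  error≃ {n} R D = ≃-trans (𝔼≃E {n} (λ x → (value (runᴰ D x) - 𝔼 (λ r → value (run R x r))) ²))
    (E-cong λ x → *-cong (same x) (same x))
    where
    same : ∀ x → value (runᴰ D x) - 𝔼 (λ r → value (run R x r)) ≃ value (runᴰ D x) - eval R x
    same x = +-congʳ (value (runᴰ D x))
      (-‿cong (≃-trans (𝔼≃E {randomness R} (λ r → value (run R x r))) (eval-run R x)))

  refined-error : ∀ {n} k (R : RDT n) →
    𝔼 (λ x → (output (refineTimes k (rest (readOnce R))) x - 𝔼 (λ r → value (run R x r))) ²) ≤ reciprocal k
  refined-error k R = ≤-trans (≤-reflexive (≃-trans (error≃ R (completed (refineTimes k (rest (readOnce R)))))
      (output-error (refineTimes-splits k (rest (readOnce-correct R) (readOnce-eval R))))))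
    (refineTimes-spread k (readOnce R) (readOnce-correct R))

  constant-error : ∀ {n} (R : RDT n) → queries? (readOnce R) ≡ false →
    𝔼 (λ x → (output (rest (readOnce R)) x - 𝔼 (λ r → value (run R x r))) ²) ≃ 0ℚᵘ
  constant-error {n} R q = ≃-trans (error≃ R (completed (rest (readOnce R))))
    (≃-trans (E-cong (λ x → ≃-trans (*-cong (zero-difference x) (zero-difference x)) (*-zeroˡ 0ℚᵘ)))
      (E-const {n} 0ℚᵘ))
    where
    zero-difference : ∀ x → output (rest (readOnce R)) x - eval R x ≃ 0ℚᵘ
    zero-difference x = ≃-trans (+-congˡ (- eval R x)
      (≃-sym (≃-trans (≃-reflexive (≡.sym (readOnce-eval R x))) (constant-eval (readOnce R) q x))))
      (+-inverseʳ (eval R x))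

-- Counting function calls

module Evaluation where

  open import Data.Fin.Base using (Fin; zero; suc)
  open import Data.Nat.Base using (ℕ; zero; suc; _+_; _*_; _≤_; _⊔_; z≤n; s≤s)
  open import Data.Nat.Properties
  open import Data.Vec.Base using (Vec; []; _∷_; lookup)
  open import Data.Nat.Tactic.RingSolver using (solve-∀)
  open import Relation.Binary.PropositionalEquality

  maximum : ∀ {k} → (Fin k → ℕ) → ℕ
  maximum {zero}  g = 0
  maximum {suc k} g = g zero ⊔ maximum (λ i → g (suc i))

  ≤-maximum : ∀ {k} (g : Fin k → ℕ) i → g i ≤ maximum g
  ≤-maximum g zero    = m≤m⊔n _ _
  ≤-maximum g (suc i) = ≤-trans (≤-maximum (λ j → g (suc j)) i) (m≤n⊔m (g zero) _)

  module Cost {k : ℕ} {arity : Fin k → ℕ} (body : (f : Fin k) → Exp arity (arity f)) where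

    open Semantics body public

    mutual
      -- The number of nodes of an expression, which bounds the number of steps outside
      -- of function calls, as each node is evaluated at most once per call.
      nodes : ∀ {n} → Exp arity n → ℕ
      nodes (var i)        = 1
      nodes nil            = 1
      nodes (e ∙ e₁)       = suc (nodes e + nodes e₁)
      nodes (let′ e e₁)    = suc (nodes e + nodes e₁)
      nodes (case e e₁ e₂) = suc (nodes e + (nodes e₁ + nodes e₂))
      nodes (call f es)    = suc (nodes* es)

      nodes* : ∀ {n m} → Vec (Exp arity n) m → ℕ
      nodes* []       = 0
      nodes* (e ∷ es) = nodes e + nodes* es

    mutual
      -- The number of function calls in a derivation.
      calls : ∀ {n} {ρ : Vec Data n} {e v t} → ρ ⊢ e ⇓ v ∣ t → ℕ
      calls (var i)         = 0
      calls nil             = 0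
      calls (d ∙ d₁)        = calls d + calls d₁
      calls (let′ d d₁)     = calls d + calls d₁
      calls (case-nil d d₁) = calls d + calls d₁
      calls (case-∙ d d₁)   = calls d + calls d₁
      calls (call ds d)     = suc (calls* ds + calls d)

      calls* : ∀ {n} {ρ : Vec Data n} {m} {es : Vec (Exp arity n) m} {vs t} → ρ ⊢ es ⇓* vs ∣ t → ℕ
      calls* []       = 0
      calls* (d ∷ ds) = calls d + calls* ds

    -- A bound on the number of steps in one call, calls made by it not included.
    bodySize : ℕ
    bodySize = maximum (λ f → nodes (body f))

    private
      add-up : ∀ {s t} x c y e → s ≤ x + c * bodySize → t ≤ y + e * bodySize →
               s + t ≤ (x + y) + (c + e) * bodySize
      add-up x c y e p q = ≤-trans (+-mono-≤ p q) (≤-reflexive (regroup x y c e bodySize))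
        where
        regroup : ∀ x y c e b → (x + c * b) + (y + e * b) ≡ (x + y) + (c + e) * b
        regroup = solve-∀

    mutual
      time-bound : ∀ {n} {ρ : Vec Data n} {e v t} (d : ρ ⊢ e ⇓ v ∣ t) → t ≤ nodes e + calls d * bodySize
      time-bound (var i)     = s≤s z≤n
      time-bound nil         = s≤s z≤n
      time-bound (d ∙ d₁)    = s≤s (add-up _ (calls d) _ (calls d₁) (time-bound d) (time-bound d₁))
      time-bound (let′ d d₁) = s≤s (add-up _ (calls d) _ (calls d₁) (time-bound d) (time-bound d₁))
      time-bound {e = case e e₁ e₂} (case-nil d d₁) =
        s≤s (add-up (nodes e) (calls d) _ (calls d₁) (time-bound d)
               (≤-trans (time-bound d₁) (+-monoˡ-≤ _ (m≤m+n (nodes e₁) (nodes e₂)))))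
      time-bound {e = case e e₁ e₂} (case-∙ d d₁) =
        s≤s (add-up (nodes e) (calls d) _ (calls d₁) (time-bound d)
               (≤-trans (time-bound d₁) (+-monoˡ-≤ _ (m≤n+m (nodes e₂) (nodes e₁)))))
      time-bound {e = call f es} (call ds d) =
        s≤s (≤-trans (add-up (nodes* es) (calls* ds) bodySize (calls d) (time-bound* ds)
                        (≤-trans (time-bound d) (+-monoˡ-≤ _ (≤-maximum _ f))))
                     (≤-reflexive (regroup (nodes* es) bodySize (calls* ds + calls d))))
        where
        regroup : ∀ x b c → (x + b) + c * b ≡ x + suc c * b
        regroup = solve-∀

      time-bound* : ∀ {n} {ρ : Vec Data n} {m} {es : Vec (Exp arity n) m} {vs t} (ds : ρ ⊢ es ⇓* vs ∣ t) →
                    t ≤ nodes* es + calls* ds * bodySize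
      time-bound* []       = z≤n
      time-bound* (d ∷ ds) = add-up _ (calls d) _ (calls* ds) (time-bound d) (time-bound* ds)

    -- Evaluation within C function calls.  The combinators below mirror the rules of
    -- the semantics.
    infix 4 _⊢_↓_∣_ _⊢_↓*_∣_

    record _⊢_↓_∣_ {n} (ρ : Vec Data n) (e : Exp arity n) (v : Data) (C : ℕ) : Set where
      constructor within
      field
        {time}     : ℕ
        derivation : ρ ⊢ e ⇓ v ∣ time
        bound      : calls derivation ≤ C

    record _⊢_↓*_∣_ {n m} (ρ : Vec Data n) (es : Vec (Exp arity n) m) (vs : Vec Data m) (C : ℕ) : Set where
      constructor within
      field
        {time}      : ℕ
        derivations : ρ ⊢ es ⇓* vs ∣ time
        bound       : calls* derivations ≤ C

    module _ {n} {ρ : Vec Data n} where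
      infixr 5 _∙ₑ_ _∷ₑ_

      varₑ : ∀ {i} → ρ ⊢ var i ↓ lookup ρ i ∣ 0
      varₑ = within (var _) z≤n

      nilₑ : ρ ⊢ nil ↓ nil ∣ 0
      nilₑ = within nil z≤n

      _∙ₑ_ : ∀ {e₁ e₂ v₁ v₂ C₁ C₂} → ρ ⊢ e₁ ↓ v₁ ∣ C₁ → ρ ⊢ e₂ ↓ v₂ ∣ C₂ → ρ ⊢ e₁ ∙ e₂ ↓ v₁ ∙ v₂ ∣ C₁ + C₂
      within d p ∙ₑ within e q = within (d ∙ e) (+-mono-≤ p q)

      letₑ : ∀ {e₁ e₂ v₁ v₂ C₁ C₂} → ρ ⊢ e₁ ↓ v₁ ∣ C₁ → (v₁ ∷ ρ) ⊢ e₂ ↓ v₂ ∣ C₂ → ρ ⊢ let′ e₁ e₂ ↓ v₂ ∣ C₁ + C₂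
      letₑ (within d p) (within e q) = within (let′ d e) (+-mono-≤ p q)

      nil?ₑ : ∀ {e e₁ e₂ w C₁ C₂} → ρ ⊢ e ↓ nil ∣ C₁ → ρ ⊢ e₁ ↓ w ∣ C₂ → ρ ⊢ case e e₁ e₂ ↓ w ∣ C₁ + C₂
      nil?ₑ (within d p) (within e q) = within (case-nil d e) (+-mono-≤ p q)

      pair?ₑ : ∀ {e e₁ e₂ u v w C₁ C₂} → ρ ⊢ e ↓ u ∙ v ∣ C₁ → (u ∷ v ∷ ρ) ⊢ e₂ ↓ w ∣ C₂ →
               ρ ⊢ case e e₁ e₂ ↓ w ∣ C₁ + C₂
      pair?ₑ (within d p) (within e q) = within (case-∙ d e) (+-mono-≤ p q)

      -- The last argument of a call; unlike `_∷ₑ_` it does not add 0 to the bound, which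
      -- keeps bounds in the form in which they are stated.
      [_]ₑ : ∀ {e v C} → ρ ⊢ e ↓ v ∣ C → ρ ⊢ e ∷ [] ↓* v ∷ [] ∣ C
      [ within d p ]ₑ = within (d ∷ []) (≤-trans (≤-reflexive (+-identityʳ _)) p)

      _∷ₑ_ : ∀ {m e v} {es : Vec (Exp arity n) m} {vs C₁ C₂} → ρ ⊢ e ↓ v ∣ C₁ → ρ ⊢ es ↓* vs ∣ C₂ →
             ρ ⊢ e ∷ es ↓* v ∷ vs ∣ C₁ + C₂
      within d p ∷ₑ within e q = within (d ∷ e) (+-mono-≤ p q)

      callₑ : ∀ {f es vs w C₁ C₂} → ρ ⊢ es ↓* vs ∣ C₁ → vs ⊢ body f ↓ w ∣ C₂ → ρ ⊢ call f es ↓ w ∣ suc (C₁ + C₂)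
      callₑ (within d p) (within e q) = within (call d e) (s≤s (+-mono-≤ p q))

      weaken : ∀ {e v C C′} → C ≤ C′ → ρ ⊢ e ↓ v ∣ C → ρ ⊢ e ↓ v ∣ C′
      weaken le (within d p) = within d (≤-trans p le)

      returning : ∀ {e v v′ C} → v ≡ v′ → ρ ⊢ e ↓ v ∣ C → ρ ⊢ e ↓ v′ ∣ C
      returning refl d = d

-- The program and its cost

module Algorithm where

  open Trees
  open Evaluation
  open import Data.Bool.Base using (Bool; true; false; if_then_else_)
  open import Data.Fin.Base using (Fin; zero; suc; toℕ)
  open import Data.Fin.Properties using (_≟_; toℕ-injective)
  open import Data.Integer.Base using (∣_∣)
  open import Data.Nat.Base using (ℕ; zero; suc; _+_; _*_; _^_; _≤_; _<_; _<ᵇ_; _⊔_; z≤n; s≤s; ⌊_/2⌋)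
  open import Data.Nat.Binary.Base as ℕᵇ using (ℕᵇ; zero; 2[1+_]; 1+[2_]; fromℕ)
  open import Data.Nat.Binary.Properties as ℕᵇ using (toℕ-suc; toℕ-double; toℕ-homo-+; toℕ-fromℕ; fromℕ-toℕ)
  open import Data.Nat.DivMod
  open import Data.Nat.Divisibility using (divides-refl)
  open import Data.Nat.Induction using (<-rec)
  open import Data.Nat.Logarithm using (⌊log₂_⌋; ⌊log₂⌋-mono-≤; ⌊log₂⌊n/2⌋⌋≡⌊log₂n⌋∸1)
  open import Data.Nat.Properties hiding (_≟_)
  open import Data.Nat.Tactic.RingSolver using (solve-∀)
  open import Data.Product.Base using (∃-syntax; _×_; _,_; proj₁; proj₂)
  open import Data.Rational.Unnormalised.Base using (ℚᵘ; mkℚᵘ; ↥_; ↧ₙ_)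
  open import Data.Vec.Base using (Vec; []; _∷_)
  open import Function.Base using (_∘_)
  open import Relation.Binary.PropositionalEquality
  open import Relation.Nullary.Decidable.Core using (does; yes; no)
  open import Relation.Nullary.Negation.Core using (contradiction)

  -- The functions of the program:
  --
  --   inc, dbl, add, mul, lt   binary arithmetic (lt c x y tests x < y + c)
  --   avg                      the average of two fractions
  --   mean                     the average label of a tree
  --   eq                       equality of data
  --   restrict                 `fix`
  --   better, join, sel        `select` and its cases at flip and decide
  --   push, conv               standard binary digits to numbers
  --   read                     converts the labels of a tree
  --   tidy, hasQuery           `readOnce` and `queries?`
  --   half, parity, out        numbers to standard binary digits
  --   export, refine           `complete` and `refineAll`
  --   loop                     rounds, as many as the digits of ε demand
  pattern inc      = zero
  pattern dbl      = suc inc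
  pattern add      = suc dbl
  pattern mul      = suc add
  pattern lt       = suc mul
  pattern avg      = suc lt
  pattern mean     = suc avg
  pattern eq       = suc mean
  pattern restrict = suc eq
  pattern better   = suc restrict
  pattern join     = suc better
  pattern sel      = suc join
  pattern push     = suc sel
  pattern conv     = suc push
  pattern read     = suc conv
  pattern tidy     = suc read
  pattern hasQuery = suc tidy
  pattern half     = suc hasQuery
  pattern parity   = suc half
  pattern out      = suc parity
  pattern export   = suc out
  pattern refine   = suc export
  pattern loop     = suc refine

  arity : Fin 23 → ℕ
  arity inc      = 1
  arity dbl      = 1
  arity add      = 2
  arity mul      = 2
  arity lt       = 3
  arity avg      = 2
  arity mean     = 1
  arity eq       = 2
  arity restrict = 3
  arity better   = 2
  arity join     = 4
  arity sel      = 2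
  arity push     = 2
  arity conv     = 3
  arity read     = 1
  arity tidy     = 1
  arity hasQuery = 1
  arity half     = 1
  arity parity   = 1
  arity out      = 3
  arity export   = 1
  arity refine   = 1
  arity loop     = 2

  -- De Bruijn variables; after `case` the indices 0 and 1 refer to the left and the
  -- right subtree.
  Ex : ℕ → Set
  Ex = Exp arity

  module _ {n : ℕ} where
    v0 : Ex (suc n)
    v0 = var zero
    v1 : Ex (2 + n)
    v1 = var (suc zero)
    v2 : Ex (3 + n)
    v2 = var (suc (suc zero))
    v3 : Ex (4 + n)
    v3 = var (suc (suc (suc zero)))
    v4 : Ex (5 + n)
    v4 = var (suc (suc (suc (suc zero))))
    v5 : Ex (6 + n)
    v5 = var (suc (suc (suc (suc (suc zero)))))
    v6 : Ex (7 + n)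
    v6 = var (suc (suc (suc (suc (suc (suc zero))))))
    v7 : Ex (8 + n)
    v7 = var (suc (suc (suc (suc (suc (suc (suc zero)))))))
    v8 : Ex (9 + n)
    v8 = var (suc (suc (suc (suc (suc (suc (suc (suc zero))))))))
    v10 : Ex (11 + n)
    v10 = var (suc (suc (suc (suc (suc (suc (suc (suc (suc (suc zero))))))))))
    v11 : Ex (12 + n)
    v11 = var (suc (suc (suc (suc (suc (suc (suc (suc (suc (suc (suc zero)))))))))))
    v12 : Ex (13 + n)
    v12 = var (suc (suc (suc (suc (suc (suc (suc (suc (suc (suc (suc (suc zero))))))))))))
    v13 : Ex (14 + n)
    v13 = var (suc (suc (suc (suc (suc (suc (suc (suc (suc (suc (suc (suc (suc zero)))))))))))))
    v14 : Ex (15 + n)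
    v14 = var (suc (suc (suc (suc (suc (suc (suc (suc (suc (suc (suc (suc (suc (suc zero))))))))))))))
    v15 : Ex (16 + n)
    v15 = var (suc (suc (suc (suc (suc (suc (suc (suc (suc (suc (suc (suc (suc (suc (suc zero)))))))))))))))

    -- The digit 1, and the truth value `true`.
    one : Ex n
    one = nil ∙ nil

  -- Booleans and digits are nil and nil ∙ nil.  Numbers are lists of digits in
  -- bijective base 2, least significant first, where nil stands for 2 and nil ∙ nil
  -- for 1; this is `ℕᵇ`.  A fraction is the pair of its numerator and denominator.
  -- Trees are described as in the input, apart from the labels.  Branches that no
  -- input reaches return nil.
  body : (f : Fin 23) → Ex (arity f)
  body inc =
    case v0 (one ∙ nil)
      (case v0 (one ∙ call inc (v1 ∷ [])) (nil ∙ v3))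
  body dbl =
    case v0 nil
      (case v0 (nil ∙ one ∙ v1) (nil ∙ call dbl (v3 ∷ [])))
  body add =
    case v0 v1 (case v3 v2
      (let′ (call add (v3 ∷ v1 ∷ []))
        (case v3 (v1 ∙ call inc (v0 ∷ []))
          (case v3 (one ∙ call inc (v2 ∷ [])) (nil ∙ v4)))))
  body mul =
    case v0 nil
      (let′ (call mul (v1 ∷ v3 ∷ []))
        (case v1 (call dbl (call add (v4 ∷ v0 ∷ []) ∷ []))
          (call add (v6 ∷ call dbl (v2 ∷ []) ∷ []))))
  body lt =
    case v1 (case v2 v0 one)
      (case v4 nil
        (case v2
          (case v0 (call lt (v4 ∷ v3 ∷ v1 ∷ [])) (call lt (nil ∷ v5 ∷ v3 ∷ [])))
          (case v2 (call lt (one ∷ v5 ∷ v3 ∷ [])) (call lt (v8 ∷ v7 ∷ v5 ∷ [])))))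
  body avg =
    case v0 nil (case v3 nil
      (call add (call mul (v2 ∷ v1 ∷ []) ∷ call mul (v0 ∷ v3 ∷ []) ∷ []) ∙
       call dbl (call mul (v3 ∷ v1 ∷ []) ∷ [])))
  body mean =
    case v0 nil (case v0 v1 (case v1
      (case v3 nil (call avg (call mean (v0 ∷ []) ∷ call mean (v1 ∷ []) ∷ [])))
      (case v5 nil (case v1 nil (call avg (call mean (v0 ∷ []) ∷ call mean (v1 ∷ []) ∷ []))))))
  body eq =
    case v0 (case v1 one nil) (case v3 nil
      (case (call eq (v2 ∷ v0 ∷ [])) nil (call eq (v5 ∷ v3 ∷ []))))
  body restrict =
    case v2 nil (case v0 v4 (case v1
      (case v3 nil (v4 ∙ call restrict (v6 ∷ v7 ∷ v0 ∷ []) ∙ call restrict (v6 ∷ v7 ∷ v1 ∷ [])))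
      (case v5 nil (case v1 nil
        (case (call eq (v10 ∷ v2 ∷ []))
          (v8 ∙ v2 ∙ call restrict (v10 ∷ v11 ∷ v0 ∷ []) ∙ call restrict (v10 ∷ v11 ∷ v1 ∷ []))
          (case v13 (call restrict (v12 ∷ v13 ∷ v2 ∷ [])) (call restrict (v14 ∷ v15 ∷ v5 ∷ []))))))))
  body better =
    case v0 nil (case v3 nil (case v2 nil (case v2 nil
      (case (call lt (nil ∷ call mul (v2 ∷ v1 ∷ []) ∷ call mul (v0 ∷ v3 ∷ []) ∷ [])) v8 v11))))
  body join =
    case v2 nil (case v5 nil
      (call avg (v2 ∷ v0 ∷ []) ∙ (v4 ∙ v5 ∙ v3 ∙ v1)))
  body sel =
    case v0 nil (case v0
      (let′ (call mean (v3 ∷ [])) (case v0 nil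
        ((call mul (v0 ∷ v0 ∷ []) ∙ call mul (v1 ∷ v1 ∷ [])) ∙ (nil ∙ v6))))
      (case v1
        (case v3 nil (call better (call sel (v0 ∷ v7 ∷ []) ∷ call sel (v1 ∷ v7 ∷ []) ∷ [])))
        (case v5 nil (case v1 nil
          (call join (v8 ∷ v2 ∷
            call sel (v0 ∷ call restrict (v2 ∷ nil ∷ v11 ∷ []) ∷ []) ∷
            call sel (v1 ∷ call restrict (v2 ∷ one ∷ v11 ∷ []) ∷ []) ∷ []))))))
  body push = case v0 (call dbl (v1 ∷ [])) (one ∙ v3)
  body conv =
    case v0 (v1 ∙ v2) (case v0 nil
      (call conv (v3 ∷ call push (v0 ∷ v5 ∷ []) ∷ call push (v1 ∷ v6 ∷ []) ∷ [])))
  body read =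
    case v0 nil (case v0 (nil ∙ call conv (v1 ∷ nil ∷ nil ∷ [])) (case v1
      (case v3 nil (v4 ∙ call read (v0 ∷ []) ∙ call read (v1 ∷ [])))
      (case v5 nil (case v1 nil (v8 ∙ v2 ∙ call read (v0 ∷ []) ∙ call read (v1 ∷ []))))))
  body tidy =
    case v0 nil (case v0 v2 (case v1
      (case v3 nil (v4 ∙ call tidy (v0 ∷ []) ∙ call tidy (v1 ∷ [])))
      (case v5 nil (case v1 nil
        (v8 ∙ v2 ∙ call restrict (v2 ∷ nil ∷ call tidy (v0 ∷ []) ∷ []) ∙
                   call restrict (v2 ∷ one ∷ call tidy (v1 ∷ []) ∷ []))))))
  body hasQuery =
    case v0 nil (case v0 nil (case v1
      (case v3 nil (case (call hasQuery (v0 ∷ [])) (call hasQuery (v1 ∷ [])) one))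
      one))
  body half = case v0 nil (case v0 (call inc (v1 ∷ [])) v3)
  body parity = case v0 nil v0
  body out =
    case v1 v2
      (call out (call half (v2 ∷ []) ∷ call half (v3 ∷ []) ∷
        ((call parity (v2 ∷ []) ∙ call parity (v3 ∷ [])) ∙ v4) ∷ []))
  body export =
    case v0 nil (case v0
      (case (call mean (v1 ∷ [])) nil (nil ∙ call out (v0 ∷ v1 ∷ nil ∷ [])))
      (case v3 nil (case v1 nil (v6 ∙ v2 ∙ call export (v0 ∷ []) ∙ call export (v1 ∷ [])))))
  body refine =
    case v0 nil (case v0
      (case (call sel (v1 ∷ v1 ∷ [])) nil v1)
      (case v3 nil (case v1 nil (v6 ∙ v2 ∙ call refine (v0 ∷ []) ∙ call refine (v1 ∷ [])))))
  body loop =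
    case v0 v1 (case v0 nil (case v0
      (call loop (v3 ∷ call loop (v3 ∷ v5 ∷ []) ∷ []))
      (call refine (call refine (v7 ∷ []) ∷ []))))

  -- The input is converted and tidied first.  A tree without queries is
  -- completed at once, without inspecting ε.
  main : Ex 2
  main =
    let′ (call tidy (call read (v0 ∷ []) ∷ []))
      (case (call hasQuery (v0 ∷ []))
        (call export ((nil ∙ v0) ∷ []))
        (call export (call loop (v4 ∷ (nil ∙ v2) ∷ []) ∷ [])))

  algorithm : Program 2
  algorithm = record { arity = arity ; body = body ; main = main }

  -- Binary arithmetic

  open Cost body public

  bool : Bool → Data
  bool false = nil
  bool true  = nil ∙ nil

  digitValue : Bool → ℕ
  digitValue false = 0
  digitValue true  = 1

  -- The description of a number in bijective base 2.
  enc : ℕᵇ → Data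
  enc zero     = nil
  enc 2[1+ x ] = nil ∙ enc x
  enc 1+[2 x ] = (nil ∙ nil) ∙ enc x

  halve-< : ∀ {a b} → 2 * a < 2 * b → a < b
  halve-< {a} {b} = *-cancelˡ-< 2 a b

  size≤ : ∀ L x → ℕᵇ.toℕ x < 2 ^ L → ℕᵇ.size x ≤ L
  size≤ L       zero     _ = z≤n
  size≤ zero    2[1+ x ] (s≤s ())
  size≤ zero    1+[2 x ] (s≤s ())
  size≤ (suc L) 2[1+ x ] p = s≤s (size≤ L x (<-trans (n<1+n _) (halve-< p)))
  size≤ (suc L) 1+[2 x ] p = s≤s (size≤ L x (halve-< (<-trans (n<1+n _) p)))

  size-enc : ∀ x → size (enc x) ≤ 1 + 4 * ℕᵇ.size x
  size-enc zero     = s≤s z≤n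
  size-enc 2[1+ x ] = s≤s (≤-trans (s≤s (size-enc x)) (≤-trans (m≤m+n _ 2) (≤-reflexive (e (ℕᵇ.size x)))))
    where
    e : ∀ s → suc (1 + 4 * s) + 2 ≡ 4 * suc s
    e = solve-∀
  size-enc 1+[2 x ] = s≤s (≤-trans (+-monoʳ-≤ 3 (size-enc x)) (≤-reflexive (e (ℕᵇ.size x))))
    where
    e : ∀ s → 3 + (1 + 4 * s) ≡ 4 * suc s
    e = solve-∀

  toℕ<2^size : ∀ x → ℕᵇ.toℕ x < 2 ^ size (enc x)
  toℕ<2^size zero     = s≤s z≤n
  toℕ<2^size 2[1+ x ] = ≤-trans (s≤s (*-monoʳ-≤ 2 (toℕ<2^size x)))
    (≤-trans (+-monoˡ-≤ (2 ^ suc s) (m^n>0 2 (suc s)))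
             (≤-reflexive (cong (2 ^ suc s +_) (sym (+-identityʳ (2 ^ suc s))))))
    where s = size (enc x)
  toℕ<2^size 1+[2 x ] = ≤-trans (≤-reflexive (sym (*-suc 2 (ℕᵇ.toℕ x))))
    (≤-trans (*-monoʳ-≤ 2 (toℕ<2^size x)) (^-monoʳ-≤ 2 {suc s} (+-monoʳ-≤ 1 (m≤n+m s 3))))
    where s = size (enc x)

  inc-runs : ∀ x → (enc x ∷ []) ⊢ body inc ↓ enc (ℕᵇ.suc x) ∣ ℕᵇ.size x
  inc-runs zero     = nil?ₑ varₑ ((nilₑ ∙ₑ nilₑ) ∙ₑ nilₑ)
  inc-runs 2[1+ x ] = (pair?ₑ varₑ (nil?ₑ varₑ ((nilₑ ∙ₑ nilₑ) ∙ₑ callₑ [ varₑ ]ₑ (inc-runs x))))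
  inc-runs 1+[2 x ] = weaken z≤n (pair?ₑ varₑ (pair?ₑ varₑ (nilₑ ∙ₑ varₑ)))

  dbl-runs : ∀ x → (enc x ∷ []) ⊢ body dbl ↓ enc (ℕᵇ.double x) ∣ ℕᵇ.size x
  dbl-runs zero     = nil?ₑ varₑ nilₑ
  dbl-runs 2[1+ x ] = weaken z≤n (pair?ₑ varₑ (nil?ₑ varₑ (nilₑ ∙ₑ (nilₑ ∙ₑ nilₑ) ∙ₑ varₑ)))
  dbl-runs 1+[2 x ] = pair?ₑ varₑ (pair?ₑ varₑ (nilₑ ∙ₑ callₑ [ varₑ ]ₑ (dbl-runs x)))

  ≤2*suc : ∀ a → a ≤ 2 * suc a
  ≤2*suc a = ≤-trans (n≤1+n a) (m≤n*m (suc a) 2)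

  ≤suc-2* : ∀ a → a ≤ suc (2 * a)
  ≤suc-2* a = ≤-trans (m≤n*m a 2) (n≤1+n _)

  -- Costs of addition, where L bounds the digits of the sum and s is the number of
  -- digits of the first summand.
  addCost : ℕ → ℕ → ℕ
  addCost L s = s * (2 + L)

  add-step : ∀ x y L → ℕᵇ.toℕ x + ℕᵇ.toℕ y < 2 ^ L →
             suc (addCost L (ℕᵇ.size x) + suc (ℕᵇ.size (x ℕᵇ.+ y))) ≤ addCost L (suc (ℕᵇ.size x))
  add-step x y L p = ≤-trans (s≤s
    (+-monoʳ-≤ A (s≤s (size≤ L (x ℕᵇ.+ y) (subst (_< 2 ^ L) (sym (toℕ-homo-+ x y)) p)))))
                             (≤-reflexive (cong suc (trans (+-suc A L) (cong suc (+-comm A L)))))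
    where A = addCost L (ℕᵇ.size x)

  add-runs : ∀ L x y → ℕᵇ.toℕ x + ℕᵇ.toℕ y < 2 ^ L →
             (enc x ∷ enc y ∷ []) ⊢ body add ↓ enc (x ℕᵇ.+ y) ∣ addCost L (ℕᵇ.size x)
  add-runs L zero y p = nil?ₑ varₑ varₑ
  add-runs L 2[1+ x ] zero p = weaken z≤n (pair?ₑ varₑ (nil?ₑ varₑ varₑ))
  add-runs L 1+[2 x ] zero p = weaken z≤n (pair?ₑ varₑ (nil?ₑ varₑ varₑ))
  add-runs L 2[1+ x ] 2[1+ y ] p =
    weaken (add-step x y L p′)
      (pair?ₑ varₑ (pair?ₑ varₑ (letₑ (callₑ (varₑ ∷ₑ [ varₑ ]ₑ) (add-runs L x y p′))
        (nil?ₑ varₑ (varₑ ∙ₑ callₑ [ varₑ ]ₑ (inc-runs (x ℕᵇ.+ y)))))))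
    where p′ = ≤-<-trans (+-mono-≤ (≤2*suc (ℕᵇ.toℕ x)) (≤2*suc (ℕᵇ.toℕ y))) p
  add-runs L 2[1+ x ] 1+[2 y ] p =
    weaken (add-step x y L p′)
      (pair?ₑ varₑ (pair?ₑ varₑ (letₑ (callₑ (varₑ ∷ₑ [ varₑ ]ₑ) (add-runs L x y p′))
        (nil?ₑ varₑ (varₑ ∙ₑ callₑ [ varₑ ]ₑ (inc-runs (x ℕᵇ.+ y)))))))
    where p′ = ≤-<-trans (+-mono-≤ (≤2*suc (ℕᵇ.toℕ x)) (≤suc-2* (ℕᵇ.toℕ y))) p
  add-runs L 1+[2 x ] 2[1+ y ] p =
    weaken (add-step x y L p′)
      (pair?ₑ varₑ (pair?ₑ varₑ (letₑ (callₑ (varₑ ∷ₑ [ varₑ ]ₑ) (add-runs L x y p′))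
        (pair?ₑ varₑ (nil?ₑ varₑ ((nilₑ ∙ₑ nilₑ) ∙ₑ callₑ [ varₑ ]ₑ (inc-runs (x ℕᵇ.+ y))))))))
    where p′ = ≤-<-trans (+-mono-≤ (≤suc-2* (ℕᵇ.toℕ x)) (≤2*suc (ℕᵇ.toℕ y))) p
  add-runs L 1+[2 x ] 1+[2 y ] p =
    weaken (≤-trans (+-monoʳ-≤ _ z≤n) (add-step x y L p′))
      (pair?ₑ varₑ (pair?ₑ varₑ (letₑ (callₑ (varₑ ∷ₑ [ varₑ ]ₑ) (add-runs L x y p′))
        (pair?ₑ varₑ (pair?ₑ varₑ (nilₑ ∙ₑ varₑ))))))
    where p′ = ≤-<-trans (+-mono-≤ (≤suc-2* (ℕᵇ.toℕ x)) (≤suc-2* (ℕᵇ.toℕ y))) p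

  -- The product, by recursion on the first factor only.
  infixl 7 _*ᵇ_
  _*ᵇ_ : ℕᵇ → ℕᵇ → ℕᵇ
  zero     *ᵇ y = zero
  2[1+ x ] *ᵇ y = ℕᵇ.double (y ℕᵇ.+ x *ᵇ y)
  1+[2 x ] *ᵇ y = y ℕᵇ.+ ℕᵇ.double (x *ᵇ y)

  toℕ-homo-*ᵇ : ∀ x y → ℕᵇ.toℕ (x *ᵇ y) ≡ ℕᵇ.toℕ x * ℕᵇ.toℕ y
  toℕ-homo-*ᵇ zero     y = refl
  toℕ-homo-*ᵇ 2[1+ x ] y
    rewrite toℕ-double (y ℕᵇ.+ x *ᵇ y) | toℕ-homo-+ y (x *ᵇ y) | toℕ-homo-*ᵇ x y
    = sym (*-assoc 2 (suc (ℕᵇ.toℕ x)) (ℕᵇ.toℕ y))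
  toℕ-homo-*ᵇ 1+[2 x ] y
    rewrite toℕ-homo-+ y (ℕᵇ.double (x *ᵇ y)) | toℕ-double (x *ᵇ y) | toℕ-homo-*ᵇ x y
    = cong (ℕᵇ.toℕ y +_) (sym (*-assoc 2 (ℕᵇ.toℕ x) (ℕᵇ.toℕ y)))

  -- The cost of a multiplication per digit of the first factor.  Below, names ending in
  -- `Unit` denote costs per unit of size of the argument of a recursion, names ending
  -- in `Cost` other costs.
  mulUnit : ℕ → ℕ
  mulUnit L = 3 + addCost L L + L

  mul-step : ∀ M a d {A L} → a ≤ A → d ≤ L → suc (M + suc (suc (a + d))) ≤ 3 + A + L + M
  mul-step M a d {A} {L} p q =
    ≤-trans (s≤s (+-monoʳ-≤ M (s≤s (s≤s (+-mono-≤ p q))))) (≤-reflexive (e M A L))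
    where
    e : ∀ M A L → suc (M + suc (suc (A + L))) ≡ 3 + A + L + M
    e = solve-∀

  mul-runs : ∀ L x y → ℕᵇ.toℕ x * ℕᵇ.toℕ y < 2 ^ L →
             (enc x ∷ enc y ∷ []) ⊢ body mul ↓ enc (x *ᵇ y) ∣ ℕᵇ.size x * mulUnit L
  mul-runs L zero     y p = nil?ₑ varₑ nilₑ
  mul-runs L 2[1+ x ] y p =
    weaken (mul-step (ℕᵇ.size x * mulUnit L) (addCost L (ℕᵇ.size y)) (ℕᵇ.size (y ℕᵇ.+ x *ᵇ y))
             (*-monoˡ-≤ (2 + L) (size≤ L y (≤-<-trans (m≤m+n (ℕᵇ.toℕ y) _) q)))
             (size≤ L (y ℕᵇ.+ x *ᵇ y) (subst (_< 2 ^ L) (sym (toℕ-homo-+ y (x *ᵇ y))) r)))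
      (pair?ₑ varₑ (letₑ (callₑ (varₑ ∷ₑ [ varₑ ]ₑ) (mul-runs L x y (≤-<-trans (m≤n+m _ (ℕᵇ.toℕ y)) q)))
        (nil?ₑ varₑ (callₑ [ callₑ (varₑ ∷ₑ [ varₑ ]ₑ) (add-runs L y (x *ᵇ y) r) ]ₑ
                           (dbl-runs (y ℕᵇ.+ x *ᵇ y))))))
    where
    q : ℕᵇ.toℕ y + ℕᵇ.toℕ x * ℕᵇ.toℕ y < 2 ^ L
    q = ≤-<-trans (*-monoˡ-≤ (ℕᵇ.toℕ y) (m≤n*m (suc (ℕᵇ.toℕ x)) 2)) p
    r : ℕᵇ.toℕ y + ℕᵇ.toℕ (x *ᵇ y) < 2 ^ L
    r = subst (λ z → ℕᵇ.toℕ y + z < 2 ^ L) (sym (toℕ-homo-*ᵇ x y)) q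
  mul-runs L 1+[2 x ] y p =
    weaken (≤-trans (≤-reflexive (cong (λ z → suc (M + suc (suc z))) (+-comm D _)))
             (mul-step M (addCost L (ℕᵇ.size y)) D
             (*-monoˡ-≤ (2 + L) (size≤ L y (≤-<-trans (m≤m+n (ℕᵇ.toℕ y) _) p)))
             (size≤ L (x *ᵇ y) (subst (_< 2 ^ L) (sym (toℕ-homo-*ᵇ x y)) xy<))))
      (pair?ₑ varₑ (letₑ (callₑ (varₑ ∷ₑ [ varₑ ]ₑ) (mul-runs L x y xy<))
        (pair?ₑ varₑ (callₑ (varₑ ∷ₑ [ callₑ [ varₑ ]ₑ (dbl-runs (x *ᵇ y)) ]ₑ)
                            (add-runs L y (ℕᵇ.double (x *ᵇ y)) r)))))
    where
    M = ℕᵇ.size x * mulUnit L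
    D = ℕᵇ.size (x *ᵇ y)
    2xy : ℕᵇ.toℕ x * ℕᵇ.toℕ y ≤ (2 * ℕᵇ.toℕ x) * ℕᵇ.toℕ y
    2xy = *-monoˡ-≤ (ℕᵇ.toℕ y) (m≤n*m (ℕᵇ.toℕ x) 2)
    xy< : ℕᵇ.toℕ x * ℕᵇ.toℕ y < 2 ^ L
    xy< = ≤-<-trans (≤-trans 2xy (m≤n+m _ (ℕᵇ.toℕ y))) p
    r : ℕᵇ.toℕ y + ℕᵇ.toℕ (ℕᵇ.double (x *ᵇ y)) < 2 ^ L
    r = subst (λ z → ℕᵇ.toℕ y + z < 2 ^ L)
          (sym (trans (toℕ-double (x *ᵇ y))
            (trans (cong (2 *_) (toℕ-homo-*ᵇ x y)) (sym (*-assoc 2 (ℕᵇ.toℕ x) (ℕᵇ.toℕ y)))))) p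

  even-<ᵇ-even : ∀ a b → (2 * a <ᵇ 2 * b) ≡ (a <ᵇ b)
  even-<ᵇ-even zero    zero    = refl
  even-<ᵇ-even zero    (suc b) = refl
  even-<ᵇ-even (suc a) zero    = refl
  even-<ᵇ-even (suc a) (suc b) rewrite +-suc a (a + 0) | +-suc b (b + 0) = even-<ᵇ-even a b

  even-<ᵇ-suc-even : ∀ a b → (2 * a <ᵇ suc (2 * b)) ≡ (a <ᵇ suc b)
  even-<ᵇ-suc-even zero    b       = refl
  even-<ᵇ-suc-even (suc a) zero    = refl
  even-<ᵇ-suc-even (suc a) (suc b) rewrite +-suc a (a + 0) | +-suc b (b + 0) = even-<ᵇ-suc-even a b

  odd-<ᵇ-even : ∀ a b → (suc (2 * a) <ᵇ 2 * suc b) ≡ (a <ᵇ suc b)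
  odd-<ᵇ-even a b rewrite +-suc b (b + 0) = even-<ᵇ-suc-even a b

  even-<ᵇ-odd : ∀ a b → (2 * suc a <ᵇ suc (2 * b)) ≡ (a <ᵇ b)
  even-<ᵇ-odd a b rewrite +-suc a (a + 0) = lemma a b
    where
    lemma : ∀ a b → (suc (2 * a) <ᵇ 2 * b) ≡ (a <ᵇ b)
    lemma a       zero    = refl
    lemma zero    (suc b) rewrite +-suc b (b + 0) = refl
    lemma (suc a) (suc b) rewrite +-suc a (a + 0) | +-suc b (b + 0) = lemma a b

  -- Comparing digit by digit from the least significant end, the digits read so far
  -- decide whether x < y or x ≤ y has to be tested on the remaining ones; this is the
  -- role of c.
  lt-runs : ∀ c x y → (bool c ∷ enc x ∷ enc y ∷ []) ⊢ body lt ↓ bool (ℕᵇ.toℕ x <ᵇ digitValue c + ℕᵇ.toℕ y) ∣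
    ℕᵇ.size x
  lt-runs false zero zero     = nil?ₑ varₑ (nil?ₑ varₑ varₑ)
  lt-runs true  zero zero     = nil?ₑ varₑ (nil?ₑ varₑ varₑ)
  lt-runs false zero 2[1+ y ] = nil?ₑ varₑ (pair?ₑ varₑ (nilₑ ∙ₑ nilₑ))
  lt-runs true  zero 2[1+ y ] = nil?ₑ varₑ (pair?ₑ varₑ (nilₑ ∙ₑ nilₑ))
  lt-runs false zero 1+[2 y ] = nil?ₑ varₑ (pair?ₑ varₑ (nilₑ ∙ₑ nilₑ))
  lt-runs true  zero 1+[2 y ] = nil?ₑ varₑ (pair?ₑ varₑ (nilₑ ∙ₑ nilₑ))
  lt-runs false 2[1+ x ] zero = weaken z≤n (pair?ₑ varₑ (nil?ₑ varₑ nilₑ))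
  lt-runs true  2[1+ x ] zero = weaken z≤n (pair?ₑ varₑ (nil?ₑ varₑ nilₑ))
  lt-runs false 1+[2 x ] zero = weaken z≤n (pair?ₑ varₑ (nil?ₑ varₑ nilₑ))
  lt-runs true  1+[2 x ] zero = weaken z≤n (pair?ₑ varₑ (nil?ₑ varₑ nilₑ))
  lt-runs c 2[1+ x ] 2[1+ y ] = returning (cong bool (e c))
    (pair?ₑ varₑ (pair?ₑ varₑ (nil?ₑ varₑ (nil?ₑ varₑ (callₑ (varₑ ∷ₑ varₑ ∷ₑ [ varₑ ]ₑ) (lt-runs c x y))))))
    where
    e : ∀ c → (ℕᵇ.toℕ x <ᵇ digitValue c + ℕᵇ.toℕ y) ≡ (2 * suc (ℕᵇ.toℕ x) <ᵇ digitValue c + 2 * suc (ℕᵇ.toℕ y))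
    e false = sym (even-<ᵇ-even (suc (ℕᵇ.toℕ x)) (suc (ℕᵇ.toℕ y)))
    e true  = sym (even-<ᵇ-suc-even (suc (ℕᵇ.toℕ x)) (suc (ℕᵇ.toℕ y)))
  lt-runs c 1+[2 x ] 1+[2 y ] = returning (cong bool (e c))
    (pair?ₑ varₑ (pair?ₑ varₑ (pair?ₑ varₑ (pair?ₑ varₑ (callₑ (varₑ ∷ₑ varₑ ∷ₑ [ varₑ ]ₑ) (lt-runs c x y))))))
    where
    e : ∀ c → (ℕᵇ.toℕ x <ᵇ digitValue c + ℕᵇ.toℕ y) ≡ (suc (2 * ℕᵇ.toℕ x) <ᵇ digitValue c + suc (2 * ℕᵇ.toℕ y))
    e false = sym (even-<ᵇ-even (ℕᵇ.toℕ x) (ℕᵇ.toℕ y))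
    e true  = sym (even-<ᵇ-suc-even (ℕᵇ.toℕ x) (ℕᵇ.toℕ y))
  lt-runs c 2[1+ x ] 1+[2 y ] = returning (cong bool (e c))
    (pair?ₑ varₑ (pair?ₑ varₑ (nil?ₑ varₑ (pair?ₑ varₑ
      (callₑ (nilₑ ∷ₑ varₑ ∷ₑ [ varₑ ]ₑ) (lt-runs false x y))))))
    where
    e : ∀ c → (ℕᵇ.toℕ x <ᵇ ℕᵇ.toℕ y) ≡ (2 * suc (ℕᵇ.toℕ x) <ᵇ digitValue c + suc (2 * ℕᵇ.toℕ y))
    e false = sym (even-<ᵇ-odd (ℕᵇ.toℕ x) (ℕᵇ.toℕ y))
    e true  = sym (trans (cong (2 * suc (ℕᵇ.toℕ x) <ᵇ_) (sym (*-suc 2 (ℕᵇ.toℕ y))))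
      (even-<ᵇ-even (suc (ℕᵇ.toℕ x)) (suc (ℕᵇ.toℕ y))))
  lt-runs c 1+[2 x ] 2[1+ y ] = returning (cong bool (e c))
    (pair?ₑ varₑ (pair?ₑ varₑ (pair?ₑ varₑ (nil?ₑ varₑ
      (callₑ ((nilₑ ∙ₑ nilₑ) ∷ₑ varₑ ∷ₑ [ varₑ ]ₑ) (lt-runs true x y))))))
    where
    e : ∀ c → (ℕᵇ.toℕ x <ᵇ suc (ℕᵇ.toℕ y)) ≡ (suc (2 * ℕᵇ.toℕ x) <ᵇ digitValue c + 2 * suc (ℕᵇ.toℕ y))
    e false = sym (odd-<ᵇ-even (ℕᵇ.toℕ x) (ℕᵇ.toℕ y))
    e true  = sym (even-<ᵇ-even (ℕᵇ.toℕ x) (suc (ℕᵇ.toℕ y)))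

  opaque
    -- The description of a natural number.  It is opaque, because the definition of
    -- `fromℕ` should never be unfolded.
    bin : ℕ → Data
    bin a = enc (fromℕ a)

    bin≡enc : ∀ {a} x → ℕᵇ.toℕ x ≡ a → enc x ≡ bin a
    bin≡enc {a} x refl = cong enc (sym (fromℕ-toℕ x))

    bin-size : ∀ L {a} → a < 2 ^ L → size (bin a) ≤ 1 + 4 * L
    bin-size L {a} p = ≤-trans (size-enc (fromℕ a)) (+-monoʳ-≤ 1 (*-monoʳ-≤ 4
      (size≤ L (fromℕ a) (subst (_< 2 ^ L) (sym (toℕ-fromℕ a)) p))))

    <2^bin-size : ∀ a → a < 2 ^ size (bin a)
    <2^bin-size a = subst (_< 2 ^ size (bin a)) (toℕ-fromℕ a) (toℕ<2^size (fromℕ a))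

    bin-zero : bin 0 ≡ nil
    bin-zero = refl

    private
      sz : ∀ L {a} → a < 2 ^ L → ℕᵇ.size (fromℕ a) ≤ L
      sz L {a} p = size≤ L (fromℕ a) (subst (_< 2 ^ L) (sym (toℕ-fromℕ a)) p)

    bin-add : ∀ L a b → a + b < 2 ^ L → (bin a ∷ bin b ∷ []) ⊢ body add ↓ bin (a + b) ∣ addCost L L
    bin-add L a b p = returning (bin≡enc (x ℕᵇ.+ y)
      (trans (toℕ-homo-+ x y) (cong₂ _+_ (toℕ-fromℕ a) (toℕ-fromℕ b))))
      (weaken (*-monoˡ-≤ (2 + L) (sz L (≤-<-trans (m≤m+n a b) p)))
        (add-runs L x y (subst₂ (λ u v → u + v < 2 ^ L) (sym (toℕ-fromℕ a)) (sym (toℕ-fromℕ b)) p)))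
      where
      x y : ℕᵇ
      x = fromℕ a
      y = fromℕ b

    bin-mul : ∀ L a b → a < 2 ^ L → a * b < 2 ^ L → (bin a ∷ bin b ∷ []) ⊢ body mul ↓ bin (a * b) ∣ L * mulUnit
      L
    bin-mul L a b q p = returning (bin≡enc (x *ᵇ y)
      (trans (toℕ-homo-*ᵇ x y) (cong₂ _*_ {x = ℕᵇ.toℕ x} {y = a} {u = ℕᵇ.toℕ y} {v = b} (toℕ-fromℕ a)
      (toℕ-fromℕ b))))
      (weaken (*-monoˡ-≤ (mulUnit L) (sz L q))
        (mul-runs L x y (subst₂ (λ u v → u * v < 2 ^ L) (sym (toℕ-fromℕ a)) (sym (toℕ-fromℕ b)) p)))
      where
      x y : ℕᵇ
      x = fromℕ a
      y = fromℕ b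

    bin-lt : ∀ L a b → a < 2 ^ L → (nil ∷ bin a ∷ bin b ∷ []) ⊢ body lt ↓ bool (a <ᵇ b) ∣ L
    bin-lt L a b p = returning (cong bool (cong₂ _<ᵇ_ (toℕ-fromℕ a) (toℕ-fromℕ b)))
      (weaken (sz L p) (lt-runs false (fromℕ a) (fromℕ b)))

    bin-dbl : ∀ L a → a < 2 ^ L → (bin a ∷ []) ⊢ body dbl ↓ bin (2 * a) ∣ L
    bin-dbl L a p = returning (bin≡enc (ℕᵇ.double x) (trans (toℕ-double x) (cong (2 *_) (toℕ-fromℕ a))))
      (weaken (sz L p) (dbl-runs x))
      where
      x : ℕᵇ
      x = fromℕ a

    -- A new least significant digit in standard binary notation.
    bin-push : ∀ L d a → d < 2 → a < 2 ^ L → (bit d ∷ bin a ∷ []) ⊢ body push ↓ bin (d + 2 * a) ∣ suc L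
    bin-push L 0 a _ p = nil?ₑ varₑ (callₑ [ varₑ ]ₑ (bin-dbl L a p))
    bin-push L 1 a _ p = weaken z≤n (returning (bin≡enc 1+[2 fromℕ a ] (cong (λ z → suc (2 * z)) (toℕ-fromℕ a)))
      (pair?ₑ varₑ ((nilₑ ∙ₑ nilₑ) ∙ₑ varₑ)))
    bin-push L (suc (suc d)) a (s≤s (s≤s ())) p

    enc-half : ∀ x → (enc x ∷ []) ⊢ body half ↓ bin (ℕᵇ.toℕ x / 2) ∣ suc (ℕᵇ.size x)
    enc-half zero     = weaken z≤n (nil?ₑ varₑ nilₑ)
    enc-half 2[1+ x ] = weaken (s≤s (n≤1+n _)) (returning (bin≡enc (ℕᵇ.suc x)
        (trans (toℕ-suc x) (sym (trans (cong (_/ 2) (*-comm 2 (suc (ℕᵇ.toℕ x))))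
          (m*n/n≡m (suc (ℕᵇ.toℕ x)) 2)))))
      (pair?ₑ varₑ (nil?ₑ varₑ (callₑ [ varₑ ]ₑ (inc-runs x)))))
    enc-half 1+[2 x ] = weaken z≤n (returning (bin≡enc x
        (sym (trans (cong (λ z → suc z / 2) (*-comm 2 (ℕᵇ.toℕ x)))
          (trans (+-distrib-/-∣ʳ 1 {ℕᵇ.toℕ x * 2} {2} (divides-refl (ℕᵇ.toℕ x))) (m*n/n≡m (ℕᵇ.toℕ x) 2)))))
      (pair?ₑ varₑ (pair?ₑ varₑ varₑ)))

    bin-half : ∀ L a → a < 2 ^ L → (bin a ∷ []) ⊢ body half ↓ bin (a / 2) ∣ suc L
    bin-half L a p = returning (cong (λ z → bin (z / 2)) (toℕ-fromℕ a))
      (weaken (s≤s (sz L p)) (enc-half (fromℕ a)))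

    enc-parity : ∀ x → (enc x ∷ []) ⊢ body parity ↓ bit (ℕᵇ.toℕ x % 2) ∣ 0
    enc-parity zero     = nil?ₑ varₑ nilₑ
    enc-parity 2[1+ x ] = returning
      (sym (cong bit (trans (cong (_% 2) (*-comm 2 (suc (ℕᵇ.toℕ x)))) (m*n%n≡0 (suc (ℕᵇ.toℕ x)) 2))))
      (pair?ₑ varₑ varₑ)
    enc-parity 1+[2 x ] = returning
      (sym (cong bit (trans (cong (λ z → suc z % 2) (*-comm 2 (ℕᵇ.toℕ x))) ([m+kn]%n≡m%n 1 (ℕᵇ.toℕ x) 2))))
      (pair?ₑ varₑ varₑ)

    bin-parity : ∀ a → (bin a ∷ []) ⊢ body parity ↓ bit (a % 2) ∣ 0
    bin-parity a = returning (cong (λ z → bit (z % 2)) (toℕ-fromℕ a)) (enc-parity (fromℕ a))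

    bin-positive : ∀ a → 0 < a → ∃[ c ] ∃[ d ] bin a ≡ c ∙ d
    bin-positive a p with fromℕ a | toℕ-fromℕ a
    ... | zero     | refl with () ← p
    ... | 2[1+ x ] | _ = _ , _ , refl
    ... | 1+[2 x ] | _ = _ , _ , refl

  -- Standard binary digits

  -- The number a without its k low-order standard digits.
  shift : ℕ → ℕ → ℕ
  shift k a = (a / (2 ^ k)) {{m^n≢0 2 k}}

  shift-suc : ∀ k a → shift (suc k) a ≡ shift k a / 2
  shift-suc k a = trans (/-congʳ {m = a} {{m^n≢0 2 (suc k)}} {{m*n≢0 (2 ^ k) 2 {{m^n≢0 2 k}}}}
    (*-comm 2 (2 ^ k)))
    (sym (m/n/o≡m/[n*o] a (2 ^ k) 2 {{m^n≢0 2 k}} {{_}} {{m*n≢0 (2 ^ k) 2 {{m^n≢0 2 k}}}}))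

  shift-half : ∀ k a → shift (suc k) a ≡ shift k (a / 2)
  shift-half k a = sym (m/n/o≡m/[n*o] a 2 (2 ^ k) {{_}} {{m^n≢0 2 k}} {{m^n≢0 2 (suc k)}})

  shift-push : ∀ k a → shift k a % 2 + 2 * shift (suc k) a ≡ shift k a
  shift-push k a = sym (trans (m≡m%n+[m/n]*n (shift k a) 2)
    (cong (shift k a % 2 +_) (trans (*-comm (shift k a / 2) 2) (cong (2 *_) (sym (shift-suc k a))))))

  shift≤ : ∀ k a → shift k a ≤ a
  shift≤ k a = m/n≤m a (2 ^ k) {{m^n≢0 2 k}}

  convUnit : ℕ → ℕ
  convUnit L = 5 + 2 * L

  -- The accumulators hold the values of the digits read so far.
  conv-runs : ∀ L k a b → a < 2 ^ L → b < 2 ^ L →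
              (digits² k a b ∷ bin (shift k a) ∷ bin (shift k b) ∷ []) ⊢ body conv ↓ bin a ∙ bin b ∣ k *
                convUnit L
  conv-runs L zero    a b p q = returning (cong₂ (λ u v → bin u ∙ bin v) (n/1≡n a) (n/1≡n b))
    (nil?ₑ varₑ (varₑ ∙ₑ varₑ))
  conv-runs L (suc k) a b p q = weaken (≤-reflexive (e L (k * convUnit L)))
    (pair?ₑ varₑ (pair?ₑ varₑ (callₑ
      (varₑ ∷ₑ callₑ (varₑ ∷ₑ [ varₑ ]ₑ) (pushed a p) ∷ₑ [ callₑ (varₑ ∷ₑ [ varₑ ]ₑ) (pushed b q) ]ₑ)
      (conv-runs L k a b p q))))
    where
    e : ∀ L r → suc (suc (suc L) + suc (suc L) + r) ≡ 5 + 2 * L + r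
    e = solve-∀
    pushed : ∀ c → c < 2 ^ L → (digit k c ∷ bin (shift (suc k) c) ∷ []) ⊢ body push ↓ bin (shift k c) ∣ suc L
    pushed c r = returning (cong bin (shift-push k c))
      (bin-push L (shift k c % 2) (shift (suc k) c) (m%n<n (shift k c) 2) (≤-<-trans (shift≤ (suc k) c) r))

  -- Concatenation of lists.
  append : Data → Data → Data
  append nil     e = e
  append (u ∙ d) e = u ∙ append d e

  append-nil : ∀ k a b → append (digits² k a b) nil ≡ digits² k a b
  append-nil zero    a b = refl
  append-nil (suc k) a b = cong ((digit k a ∙ digit k b) ∙_) (append-nil k a b)

  digit-zero : ∀ a → digit 0 a ≡ bit (a % 2)
  digit-zero a = cong (λ z → bit (z % 2)) (n/1≡n a)

  -- Digits are produced from the least significant one and end up in front of d.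
  append-digits : ∀ k a b d → append (digits² (suc k) a b) d ≡
                  append (digits² k (a / 2) (b / 2)) ((bit (a % 2) ∙ bit (b % 2)) ∙ d)
  append-digits zero    a b d = cong₂ (λ u v → (u ∙ v) ∙ d) (digit-zero a) (digit-zero b)
  append-digits (suc k) a b d = cong₂ _∙_
    (cong₂ _∙_ (cong (λ z → bit (z % 2)) (shift-half k a)) (cong (λ z → bit (z % 2)) (shift-half k b)))
    (append-digits k a b d)

  outUnit : ℕ → ℕ
  outUnit L = 7 + 2 * L

  module _ (L : ℕ) where
    out-step : ∀ {a b d v C} → a < 2 ^ L → b < 2 ^ L → 0 < b →
               (bin (a / 2) ∷ bin (b / 2) ∷ ((bit (a % 2) ∙ bit (b % 2)) ∙ d) ∷ []) ⊢ body out ↓ v ∣ C →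
               (bin a ∷ bin b ∷ d ∷ []) ⊢ body out ↓ v ∣ outUnit L + C
    out-step {a} {b} {d} {v} {C} p q r D with bin-positive b r
    ... | c , c′ , nonnil = weaken (≤-reflexive (e L C))
      (pair?ₑ (returning nonnil varₑ)
        (callₑ (callₑ [ varₑ ]ₑ (bin-half L a p) ∷ₑ callₑ [ varₑ ]ₑ (bin-half L b q) ∷ₑ
        [ (callₑ [ varₑ ]ₑ (bin-parity a) ∙ₑ callₑ [ varₑ ]ₑ (bin-parity b)) ∙ₑ varₑ ]ₑ) D))
      where
      e : ∀ L C → suc (suc (suc L) + (suc (suc L) + 2) + C) ≡ 7 + 2 * L + C
      e = solve-∀

    -- The number of digits is determined by the denominator b alone; missing digits
    -- of the numerator a come out as 0.
    out-runs : ∀ k a b d → a < 2 ^ L → b < 2 ^ L → 2 ^ k ≤ b → b < 2 ^ suc k →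
               (bin a ∷ bin b ∷ d ∷ []) ⊢ body out ↓ append (digits² (suc k) a b) d ∣ suc k * outUnit L
    out-runs zero a 0 d p q () s
    out-runs zero a 1 d p q r s = returning (sym (append-digits 0 a 1 d))
      (out-step p q (s≤s z≤n) (nil?ₑ (returning bin-zero varₑ) varₑ))
    out-runs zero a (suc (suc b)) d p q r (s≤s (s≤s ()))
    out-runs (suc k) a b d p q r s = returning (sym (append-digits (suc k) a b d))
      (out-step p q (≤-trans (m^n>0 2 (suc k)) r)
        (out-runs k (a / 2) (b / 2) _ (≤-<-trans (m/n≤m a 2) p) (≤-<-trans (m/n≤m b 2) q)
          (≤-trans (≤-reflexive (sym (m*n/n≡m (2 ^ k) 2)))
            (/-monoˡ-≤ 2 (≤-trans (≤-reflexive (*-comm (2 ^ k) 2)) r)))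
          (m<n*o⇒m/o<n (<-≤-trans s (≤-reflexive (*-comm 2 (2 ^ suc k)))))))

  ⌊log₂⌋-spec : ∀ a → 0 < a → 2 ^ ⌊log₂ a ⌋ ≤ a × a < 2 ^ suc ⌊log₂ a ⌋
  ⌊log₂⌋-spec = <-rec _ spec
    where
    spec : ∀ a → (∀ {b} → b < a → 0 < b → 2 ^ ⌊log₂ b ⌋ ≤ b × b < 2 ^ suc ⌊log₂ b ⌋) →
           0 < a → 2 ^ ⌊log₂ a ⌋ ≤ a × a < 2 ^ suc ⌊log₂ a ⌋
    spec 1 rec _ = s≤s z≤n , s≤s (s≤s z≤n)
    spec a@(suc (suc a′)) rec _ = low , high
      where
      h = ⌊ a /2⌋
      l = ⌊log₂ h ⌋
      log≡ : ⌊log₂ a ⌋ ≡ suc l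
      log≡ = trans (sym (m+[n∸m]≡n {1} (⌊log₂⌋-mono-≤ {2} {a} (s≤s (s≤s z≤n)))))
                   (cong suc (sym (⌊log₂⌊n/2⌋⌋≡⌊log₂n⌋∸1 a)))
      ih = rec {h} (⌊n/2⌋<n (suc a′)) (s≤s z≤n)
      low : 2 ^ ⌊log₂ a ⌋ ≤ a
      low = subst (λ z → 2 ^ z ≤ a) (sym log≡) (≤-trans (*-monoʳ-≤ 2 (proj₁ ih))
        (≤-trans (≤-reflexive (cong (h +_) (+-identityʳ h)))
          (≤-trans (+-monoʳ-≤ h (⌊n/2⌋≤⌈n/2⌉ a)) (≤-reflexive (⌊n/2⌋+⌈n/2⌉≡n a)))))
      high : a < 2 ^ suc ⌊log₂ a ⌋
      high = subst (λ z → a < 2 ^ suc z) (sym log≡)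
        (≤-trans (s≤s (≤-trans (≤-reflexive (sym (⌊n/2⌋+⌈n/2⌉≡n a)))
        (+-monoʳ-≤ h (⌊n/2⌋-mono {suc a} {2 + a} (n≤1+n _)))))
        (≤-trans (≤-reflexive (e h)) (*-monoʳ-≤ 2 (proj₂ ih))))
        where
        e : ∀ h → suc (h + suc h) ≡ 2 * suc h
        e = solve-∀

  -- Equality of data

  same : Data → Data → Bool
  same nil     nil       = true
  same nil     (_ ∙ _)   = false
  same (_ ∙ _) nil       = false
  same (u ∙ v) (u′ ∙ v′) = if same u u′ then same v v′ else false

  same-refl : ∀ d → same d d ≡ true
  same-refl nil = refl
  same-refl (u ∙ v) rewrite same-refl u = same-refl v

  same⇒≡ : ∀ d e → same d e ≡ true → d ≡ e
  same⇒≡ nil nil p = refl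
  same⇒≡ (u ∙ v) (u′ ∙ v′) p with same u u′ in q
  ... | true = cong₂ _∙_ (same⇒≡ u u′ q) (same⇒≡ v v′ p)

  eq-runs : ∀ d e → (d ∷ e ∷ []) ⊢ body eq ↓ bool (same d e) ∣ 2 * size d
  eq-runs nil     nil       = weaken z≤n (nil?ₑ varₑ (nil?ₑ varₑ (nilₑ ∙ₑ nilₑ)))
  eq-runs nil     (_ ∙ _)   = weaken z≤n (nil?ₑ varₑ (pair?ₑ varₑ nilₑ))
  eq-runs (_ ∙ _) nil       = weaken z≤n (pair?ₑ varₑ (nil?ₑ varₑ nilₑ))
  eq-runs (u ∙ v) (u′ ∙ v′) = weaken (≤-reflexive (e (size u) (size v)))
      (pair?ₑ varₑ (pair?ₑ varₑ (branch (same u u′) refl)))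
    where
    e : ∀ a b → suc (2 * a) + suc (2 * b) ≡ 2 * suc (a + b)
    e = solve-∀
    first : (u′ ∷ v′ ∷ u ∷ v ∷ (u ∙ v) ∷ (u′ ∙ v′) ∷ []) ⊢ call eq (v2 ∷ v0 ∷ []) ↓ bool (same u u′) ∣ suc
      (2 * size u)
    first = callₑ (varₑ ∷ₑ [ varₑ ]ₑ) (eq-runs u u′)
    branch : ∀ b → same u u′ ≡ b → (u′ ∷ v′ ∷ u ∷ v ∷ (u ∙ v) ∷ (u′ ∙ v′) ∷ []) ⊢
             case (call eq (v2 ∷ v0 ∷ [])) nil (call eq (v5 ∷ v3 ∷ [])) ↓
             bool (if b then same v v′ else false) ∣ suc (2 * size u) + suc (2 * size v)
    branch false q = nil?ₑ (returning (cong bool q) first) (weaken z≤n nilₑ)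
    branch true  q = pair?ₑ (returning (cong bool q) first) (callₑ (varₑ ∷ₑ [ varₑ ]ₑ) (eq-runs v v′))

  bit-injective : ∀ {a b} → a < 2 → b < 2 → bit a ≡ bit b → a ≡ b
  bit-injective {0} {0} _ _ _ = refl
  bit-injective {1} {1} _ _ _ = refl
  bit-injective {suc (suc a)} (s≤s (s≤s ())) _ _
  bit-injective {_} {suc (suc b)} _ (s≤s (s≤s ())) _

  ∙-injective : ∀ {a b c d : Data} → a ∙ b ≡ c ∙ d → a ≡ c × b ≡ d
  ∙-injective refl = refl , refl

  digits-length : ∀ k l {a b} → digits k a ≡ digits l b → k ≡ l
  digits-length zero    zero    _ = refl
  digits-length (suc k) (suc l) p = cong suc (digits-length k l (proj₂ (∙-injective p)))

  digits-injective : ∀ k a b → shift k a ≡ shift k b → digits k a ≡ digits k b → a ≡ b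
  digits-injective zero    a b p _ = trans (sym (n/1≡n a)) (trans p (n/1≡n b))
  digits-injective (suc k) a b p q = digits-injective k a b
    (trans (sym (shift-push k a))
      (trans (cong₂ (λ x y → x + 2 * y) (bit-injective (m%n<n (shift k a) 2) (m%n<n (shift k b) 2)
        (proj₁ (∙-injective q))) p)
             (shift-push k b)))
    (proj₂ (∙-injective q))

  shift-zero : ∀ k {a} → a < 2 ^ k → shift k a ≡ 0
  shift-zero k p = m<n⇒m/n≡0 {{m^n≢0 2 k}} p

  length₂-spec : ∀ a → a < 2 ^ length₂ a
  length₂-spec zero    = m^n>0 2 (length₂ 0)
  length₂-spec (suc a) = proj₂ (⌊log₂⌋-spec (suc a) (s≤s z≤n))

  ⌜⌝ᴺ-injective : ∀ {a b} → ⌜ a ⌝ᴺ ≡ ⌜ b ⌝ᴺ → a ≡ b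
  ⌜⌝ᴺ-injective {a} {b} p = digits-injective k a b
    (trans (shift-zero k (length₂-spec a))
      (sym (shift-zero k (subst (λ l → b < 2 ^ l) (sym k≡l) (length₂-spec b)))))
    (trans p (cong (λ l → digits l b) (sym k≡l)))
    where
    k = length₂ a
    k≡l : length₂ a ≡ length₂ b
    k≡l = digits-length (length₂ a) (length₂ b) p

  idx : ∀ {n} → Fin n → Data
  idx i = ⌜ toℕ i ⌝ᴺ

  same-idx : ∀ {n} (i j : Fin n) → same (idx i) (idx j) ≡ does (i ≟ j)
  same-idx i j with i ≟ j
  ... | yes refl = same-refl (idx i)
  ... | no i≢j with same (idx i) (idx j) in q
  ...   | false = refl
  ...   | true  = contradiction (toℕ-injective (⌜⌝ᴺ-injective (same⇒≡ _ _ q))) i≢j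

  -- Arithmetic on fractions

  codeF : Fraction → Data
  codeF (a /suc b) = bin a ∙ bin (suc b)

  -- A proper fraction whose denominator is at most 2 ^ k.
  record Fits (k : ℕ) (f : Fraction) : Set where
    constructor fits
    field
      proper : Proper f
      den≤   : suc (den-1 f) ≤ 2 ^ k

  open Fits

  num≤ : ∀ {k f} → Fits k f → num f ≤ 2 ^ k
  num≤ (fits p q) = ≤-trans p q

  Fits-mono : ∀ {j k f} → j ≤ k → Fits j f → Fits k f
  Fits-mono le (fits p q) = fits p (≤-trans q (^-monoʳ-≤ 2 le))

  midpoint-fits : ∀ {j k f g} → Fits j f → Fits k g → Fits (suc (j + k)) (midpoint f g)
  midpoint-fits {j} {k} {f} {g} (fits p q) (fits p′ q′) = fits (midpoint-proper {f} {g} p p′)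
    (*-monoʳ-≤ 2 (≤-trans (*-mono-≤ q q′) (≤-reflexive (sym (^-distribˡ-+-* 2 j k)))))

  square-fits : ∀ {k f} → Fits k f → Fits (2 * k) (square f)
  square-fits {k} {f} (fits p q) = fits (square-proper {f} p)
    (≤-trans (*-mono-≤ q q) (≤-reflexive
      (trans (sym (^-distribˡ-+-* 2 k k)) (cong (λ z → 2 ^ (k + z)) (sym (+-identityʳ k))))))

  -- With numerators and denominators at most 2 ^ k, products and sums of two products
  -- are below 2 ^ precision k.
  precision : ℕ → ℕ
  precision k = 2 + (k + k)

  module _ (k : ℕ) where
    private
      L = precision k
      p = 2 ^ (k + k)
      p>0 : 0 < p
      p>0 = m^n>0 2 (k + k)

    ≤p⇒<2^L : ∀ {a} → a ≤ p → a < 2 ^ L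
    ≤p⇒<2^L q = ≤-<-trans q (^-monoʳ-< 2 (s≤s (s≤s z≤n)) (s≤s (n≤1+n (k + k))))

    ≤2^k⇒<2^L : ∀ {a} → a ≤ 2 ^ k → a < 2 ^ L
    ≤2^k⇒<2^L q = ≤p⇒<2^L (≤-trans q (^-monoʳ-≤ 2 (m≤m+n k k)))

    product≤p : ∀ {a b} → a ≤ 2 ^ k → b ≤ 2 ^ k → a * b ≤ p
    product≤p q r = ≤-trans (*-mono-≤ q r) (≤-reflexive (sym (^-distribˡ-+-* 2 k k)))

    sum<2^L : ∀ {a b} → a ≤ p → b ≤ p → a + b < 2 ^ L
    sum<2^L q r = ≤-<-trans (+-mono-≤ q r) (≤-<-trans (≤-reflexive (cong (p +_) (sym (+-identityʳ p))))
      (^-monoʳ-< 2 (s≤s (s≤s z≤n)) (n<1+n (suc (k + k)))))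

    mulCost : ℕ
    mulCost = L * mulUnit L

    times : ∀ {a b} → a ≤ 2 ^ k → b ≤ 2 ^ k → (bin a ∷ bin b ∷ []) ⊢ body mul ↓ bin (a * b) ∣ mulCost
    times {a} {b} q r = bin-mul L a b (≤2^k⇒<2^L q) (≤p⇒<2^L (product≤p q r))

    opaque
      -- The costs of composite operations are opaque, to keep bounds short.
      avgCost : ℕ
      avgCost = suc (suc mulCost + suc mulCost + addCost L L) + suc (suc mulCost + L)

      avg-runs : ∀ {f g} → Fits k f → Fits k g → (codeF f ∷ codeF g ∷ []) ⊢ body avg ↓ codeF (midpoint f g) ∣
        avgCost
      avg-runs {f} {g} F@(fits _ q) G@(fits _ q′) = pair?ₑ varₑ (pair?ₑ varₑ
        (callₑ (callₑ (varₑ ∷ₑ [ varₑ ]ₑ) (times (num≤ F) q′) ∷ₑ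
          [ callₑ (varₑ ∷ₑ [ varₑ ]ₑ) (times (num≤ G) q) ]ₑ)
           (bin-add L _ _ (sum<2^L (product≤p (num≤ F) q′) (product≤p (num≤ G) q))) ∙ₑ
         callₑ [ callₑ (varₑ ∷ₑ [ varₑ ]ₑ) (times q q′) ]ₑ (bin-dbl L _ (≤p⇒<2^L (product≤p q q′)))))

  -- Trees

  -- The internal description of a tree.  Its labels are pairs of binary numbers.
  code : ∀ {n} → RDT n → Data
  code (leaf p)         = nil ∙ codeF (fraction p)
  code (flip T₀ T₁)     = (nil ∙ nil) ∙ code T₀ ∙ code T₁
  code (decide i T₀ T₁) = (nil ∙ nil ∙ nil) ∙ idx i ∙ code T₀ ∙ code T₁

  codeSize : ∀ {n} → RDT n → ℕ
  codeSize T = size (code T)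

  -- Sizes of nodes.  The constants are the sizes of the tags and of the pairing nodes
  -- of the description.
  flip-size : ∀ s₀ s₁ → suc (s₀ + s₁) ≤ suc (3 + suc (s₀ + s₁))
  flip-size s₀ s₁ = m≤n+m _ 4

  decide-size : ∀ i s₀ s₁ → suc (s₀ + s₁) ≤ suc (5 + suc (i + suc (s₀ + s₁)))
  decide-size i s₀ s₁ = ≤-trans (m≤n+m _ i) (m≤n+m _ 7)

  left : ∀ {s₀ s₁ s} → suc (s₀ + s₁) ≤ s → s₀ ≤ s
  left le = ≤-trans (≤-trans (m≤m+n _ _) (n≤1+n _)) le

  right : ∀ {s₀ s₁ s} → suc (s₀ + s₁) ≤ s → s₁ ≤ s
  right {s₀} le = ≤-trans (≤-trans (m≤n+m _ s₀) (n≤1+n _)) le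

  index≤ : ∀ i {s} → i ≤ suc (5 + suc (i + s))
  index≤ i {s} = ≤-trans (m≤m+n i s) (m≤n+m _ 7)

  -- The cost of a recursion over a tree: if each node costs at most U apart from the
  -- recursive calls, the total is at most U times the size.
  node-cost : ∀ {s} s₀ s₁ {w U} → suc (s₀ + s₁) ≤ s → w ≤ U → w + (s₀ * U + s₁ * U) ≤ s * U
  node-cost s₀ s₁ {U = U} le p = ≤-trans (+-mono-≤ p (≤-reflexive (sym (*-distribʳ-+ U s₀ s₁))))
    (*-monoˡ-≤ U le)

  -- The denominator of an average is twice the product of the denominators, so its
  -- length grows additively.
  average-fits : ∀ {n} (T : RDT n) → Fits (codeSize T) (average T)
  average-fits T@(leaf p) = fits (average-proper T)
    (≤-trans (<⇒≤ (<2^bin-size (suc (den-1 (fraction p)))))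
      (^-monoʳ-≤ 2 (≤-trans (m≤n+m _ (size (bin (num (fraction p))))) (m≤n+m _ 3))))
  average-fits (flip T₀ T₁) =
    Fits-mono (flip-size (codeSize T₀) (codeSize T₁)) (midpoint-fits (average-fits T₀) (average-fits T₁))
  average-fits (decide i T₀ T₁) =
    Fits-mono (decide-size (size (idx i)) (codeSize T₀) (codeSize T₁))
      (midpoint-fits (average-fits T₀) (average-fits T₁))

  meanUnit : ℕ → ℕ
  meanUnit W = 3 + avgCost W

  mean-runs : ∀ {n} W (T : RDT n) → codeSize T ≤ W → (code T ∷ []) ⊢ body mean ↓ codeF (average T) ∣ codeSize T
    * meanUnit W
  mean-runs W (leaf p) le = weaken z≤n (pair?ₑ varₑ (nil?ₑ varₑ varₑ))
  mean-runs W (flip T₀ T₁) le =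
    weaken (≤-trans (≤-reflexive (e (codeSize T₀ * meanUnit W) (codeSize T₁ * meanUnit W) (avgCost W)))
             (node-cost (codeSize T₀) (codeSize T₁) (flip-size (codeSize T₀) (codeSize T₁)) ≤-refl))
      (pair?ₑ varₑ (pair?ₑ varₑ (nil?ₑ varₑ (pair?ₑ varₑ
        (callₑ (callₑ [ varₑ ]ₑ (mean-runs W T₀ l) ∷ₑ [ callₑ [ varₑ ]ₑ (mean-runs W T₁ r) ]ₑ)
          (avg-runs W (Fits-mono l (average-fits T₀)) (Fits-mono r (average-fits T₁))))))))
    where
    e : ∀ a b c → suc (suc a + suc b + c) ≡ 3 + c + (a + b)
    e = solve-∀
    l = ≤-trans (left (flip-size (codeSize T₀) (codeSize T₁))) le
    r = ≤-trans (right (flip-size (codeSize T₀) (codeSize T₁))) le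
  mean-runs W (decide i T₀ T₁) le =
    weaken (≤-trans (≤-reflexive (e (codeSize T₀ * meanUnit W) (codeSize T₁ * meanUnit W) (avgCost W)))
             (node-cost (codeSize T₀) (codeSize T₁) (decide-size (size (idx i)) (codeSize T₀) (codeSize T₁))
               ≤-refl))
      (pair?ₑ varₑ (pair?ₑ varₑ (pair?ₑ varₑ (pair?ₑ varₑ (pair?ₑ varₑ
        (callₑ (callₑ [ varₑ ]ₑ (mean-runs W T₀ l) ∷ₑ [ callₑ [ varₑ ]ₑ (mean-runs W T₁ r) ]ₑ)
          (avg-runs W (Fits-mono l (average-fits T₀)) (Fits-mono r (average-fits T₁)))))))))
    where
    e : ∀ a b c → suc (suc a + suc b + c) ≡ 3 + c + (a + b)
    e = solve-∀
    l = ≤-trans (left (decide-size (size (idx i)) (codeSize T₀) (codeSize T₁))) le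
    r = ≤-trans (right (decide-size (size (idx i)) (codeSize T₀) (codeSize T₁))) le

  fix-size : ∀ {n} (i : Fin n) b T → codeSize (fix i b T) ≤ codeSize T
  fix-size i b (leaf p)     = ≤-refl
  fix-size i b (flip T₀ T₁) = +-monoʳ-≤ 5 (+-mono-≤ (fix-size i b T₀) (fix-size i b T₁))
  fix-size i b (decide j T₀ T₁) with does (i ≟ j)
  fix-size i b     (decide j T₀ T₁) | false = +-monoʳ-≤ 7
    (+-monoʳ-≤ (size (idx j)) (s≤s (+-mono-≤ (fix-size i b T₀) (fix-size i b T₁))))
  fix-size i false (decide j T₀ T₁) | true  = ≤-trans (fix-size i false T₀)
    (left (decide-size (size (idx j)) (codeSize T₀) (codeSize T₁)))
  fix-size i true  (decide j T₀ T₁) | true  = ≤-trans (fix-size i true T₁)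
    (right (decide-size (size (idx j)) (codeSize T₀) (codeSize T₁)))

  -- The cost per node of restricting; W bounds the length of a variable index.
  fixUnit : ℕ → ℕ
  fixUnit W = 4 + 2 * W

  fix-runs : ∀ {n} W (i : Fin n) b T → size (idx i) ≤ W →
             (idx i ∷ bool b ∷ code T ∷ []) ⊢ body restrict ↓ code (fix i b T) ∣ codeSize T * fixUnit W
  fix-runs W i b (leaf p) le = weaken z≤n (pair?ₑ varₑ (nil?ₑ varₑ varₑ))
  fix-runs W i b (flip T₀ T₁) le =
    weaken (≤-trans (≤-reflexive (e (codeSize T₀ * fixUnit W) (codeSize T₁ * fixUnit W)))
             (node-cost (codeSize T₀) (codeSize T₁) {w = 2} (flip-size (codeSize T₀) (codeSize T₁))
               (s≤s (s≤s z≤n))))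
      (pair?ₑ varₑ (pair?ₑ varₑ (nil?ₑ varₑ (pair?ₑ varₑ (varₑ ∙ₑ
        callₑ (varₑ ∷ₑ varₑ ∷ₑ [ varₑ ]ₑ) (fix-runs W i b T₀ le) ∙ₑ
        callₑ (varₑ ∷ₑ varₑ ∷ₑ [ varₑ ]ₑ) (fix-runs W i b T₁ le))))))
    where
    e : ∀ a b → suc a + suc b ≡ 2 + (a + b)
    e = solve-∀
  fix-runs W i b (decide j T₀ T₁) le =
    weaken (≤-trans (+-monoˡ-≤ _ (s≤s (*-monoʳ-≤ 2 le))) (≤-trans (≤-reflexive (e W c₀ c₁))
             (node-cost (codeSize T₀) (codeSize T₁) {w = 3 + 2 * W}
               (decide-size (size (idx j)) (codeSize T₀) (codeSize T₁)) (n≤1+n _))))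
      (pair?ₑ varₑ (pair?ₑ varₑ (pair?ₑ varₑ (pair?ₑ varₑ (pair?ₑ varₑ (branch (does (i ≟ j)) b refl refl))))))
    where
    c₀ = codeSize T₀ * fixUnit W
    c₁ = codeSize T₁ * fixUnit W
    e : ∀ W a b → suc (2 * W) + (suc a + suc b) ≡ (3 + 2 * W) + (a + b)
    e = solve-∀
    ρ : Vec Data 13
    ρ = code T₀ ∷ code T₁ ∷ idx j ∷ (code T₀ ∙ code T₁) ∷ nil ∷ nil ∷ nil ∷ (nil ∙ nil) ∷ (nil ∙ nil ∙ nil) ∷
        (idx j ∙ code T₀ ∙ code T₁) ∷ idx i ∷ bool b ∷ code (decide j T₀ T₁) ∷ []
    test : ρ ⊢ call eq (v10 ∷ v2 ∷ []) ↓ bool (does (i ≟ j)) ∣ suc (2 * size (idx i))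
    test = returning (cong bool (same-idx i j)) (callₑ (varₑ ∷ₑ [ varₑ ]ₑ) (eq-runs (idx i) (idx j)))
    branch : ∀ c b′ → does (i ≟ j) ≡ c → b ≡ b′ → ρ ⊢
      case (call eq (v10 ∷ v2 ∷ []))
          (v8 ∙ v2 ∙ call restrict (v10 ∷ v11 ∷ v0 ∷ []) ∙ call restrict (v10 ∷ v11 ∷ v1 ∷ []))
          (case v13 (call restrict (v12 ∷ v13 ∷ v2 ∷ [])) (call restrict (v14 ∷ v15 ∷ v5 ∷ [])))
      ↓ code (if c then (if b′ then fix i b T₁ else fix i b T₀) else decide j (fix i b T₀) (fix i b T₁))
      ∣ suc (2 * size (idx i)) + (suc c₀ + suc c₁)
    branch false b′ q _ = nil?ₑ (returning (cong bool q) test) (varₑ ∙ₑ varₑ ∙ₑ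
        callₑ (varₑ ∷ₑ varₑ ∷ₑ [ varₑ ]ₑ) (fix-runs W i b T₀ le) ∙ₑ
        callₑ (varₑ ∷ₑ varₑ ∷ₑ [ varₑ ]ₑ) (fix-runs W i b T₁ le))
    branch true false q r = weaken (+-monoʳ-≤ (suc (2 * size (idx i))) (m≤m+n (suc c₀) (suc c₁)))
      (pair?ₑ (returning (cong bool q) test)
      (nil?ₑ (returning (cong bool r) varₑ) (callₑ (varₑ ∷ₑ varₑ ∷ₑ [ varₑ ]ₑ) (fix-runs W i b T₀ le))))
    branch true true  q r = weaken (+-monoʳ-≤ (suc (2 * size (idx i))) (m≤n+m (suc c₁) (suc c₀)))
      (pair?ₑ (returning (cong bool q) test)
      (pair?ₑ (returning (cong bool r) varₑ) (callₑ (varₑ ∷ₑ varₑ ∷ₑ [ varₑ ]ₑ) (fix-runs W i b T₁ le))))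

  -- Both accumulators start at nil, the description of 0.
  rational-read : ∀ p → (⌜ value p ⌝ℚ ∷ nil ∷ nil ∷ []) ⊢ body conv ↓ codeF (fraction p) ∣
                  length₂ (↧ₙ (value p)) * convUnit (length₂ (↧ₙ (value p)))
  rational-read p@(label (mkℚᵘ a d) _ _) =
    subst₂ (λ u v → (digits² L ∣ a ∣ (suc d) ∷ u ∷ v ∷ []) ⊢ body conv ↓ codeF (fraction p) ∣ L * convUnit L)
      (trans (cong bin (shift-zero L a<)) bin-zero) (trans (cong bin (shift-zero L d<)) bin-zero)
      (conv-runs L L ∣ a ∣ (suc d) a< d<)
    where
    L = length₂ (suc d)
    d< : suc d < 2 ^ L
    d< = length₂-spec (suc d)
    a< : ∣ a ∣ < 2 ^ L
    a< = ≤-<-trans (fraction-proper p) d<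

  bit-size : ∀ a → size (bit a) ≤ 3
  bit-size zero    = s≤s z≤n
  bit-size (suc a) = ≤-refl

  1≤size : ∀ d → 1 ≤ size d
  1≤size nil     = s≤s z≤n
  1≤size (d ∙ e) = s≤s z≤n

  digits²-size : ∀ k a b → 1 + 4 * k ≤ size (digits² k a b)
  digits²-size zero    a b = s≤s z≤n
  digits²-size (suc k) a b = s≤s (≤-trans (≤-reflexive (*-suc 4 k)) (≤-trans (≤-reflexive (+-suc 3 (4 * k)))
    (+-mono-≤ (s≤s (+-mono-≤ (1≤size (digit k a)) (1≤size (digit k b)))) (digits²-size k a b))))

  digits²-size≤ : ∀ k a b → size (digits² k a b) ≤ 1 + 8 * k
  digits²-size≤ zero    a b = s≤s z≤n
  digits²-size≤ (suc k) a b = s≤s (≤-trans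
    (+-mono-≤ (s≤s (+-mono-≤ (bit-size (shift k a % 2)) (bit-size (shift k b % 2)))) (digits²-size≤ k a b))
    (≤-reflexive (e k)))
    where
    e : ∀ k → 7 + (1 + 8 * k) ≡ 8 * suc k
    e = solve-∀

  length₂≤size : ∀ (p : ℚᵘ) → length₂ (↧ₙ p) ≤ size ⌜ p ⌝ℚ
  length₂≤size p = ≤-trans (≤-trans (m≤n*m (length₂ (↧ₙ p)) 4) (n≤1+n _))
    (digits²-size (length₂ (↧ₙ p)) ∣ ↥ p ∣ (↧ₙ p))

  -- Converting labels makes a description at most three times as long.
  code-size : ∀ {n} (T : RDT n) → codeSize T ≤ 3 * descriptionLength T
  code-size (leaf p@(label (mkℚᵘ a d) _ _)) =
    ≤-trans (+-monoʳ-≤ 3 (+-mono-≤ (bin-size L (≤-<-trans (fraction-proper p) (length₂-spec (suc d))))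
      (bin-size L (length₂-spec (suc d)))))
      (≤-trans (m≤m+n _ (4 + 4 * L)) (≤-trans (≤-reflexive (e L))
        (*-monoʳ-≤ 3 (+-monoʳ-≤ 2 (digits²-size L ∣ a ∣ (suc d))))))
    where
    L = length₂ (suc d)
    e : ∀ L → 3 + (1 + 4 * L + (1 + 4 * L)) + (4 + 4 * L) ≡ 3 * (2 + (1 + 4 * L))
    e = solve-∀
  code-size (flip T₀ T₁) = ≤-trans (+-monoʳ-≤ 5 (+-mono-≤ (code-size T₀) (code-size T₁)))
    (≤-trans (m≤m+n _ 10) (≤-reflexive (e (descriptionLength T₀) (descriptionLength T₁))))
    where
    e : ∀ a b → 5 + (3 * a + 3 * b) + 10 ≡ 3 * (5 + (a + b))
    e = solve-∀
  code-size (decide i T₀ T₁) = ≤-trans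
    (+-monoʳ-≤ 7 (+-monoʳ-≤ (size (idx i)) (s≤s (+-mono-≤ (code-size T₀) (code-size T₁)))))
    (≤-trans (m≤m+n _ (16 + 2 * size (idx i)))
      (≤-reflexive (e (size (idx i)) (descriptionLength T₀) (descriptionLength T₁))))
    where
    e : ∀ i a b → 7 + (i + suc (3 * a + 3 * b)) + (16 + 2 * i) ≡ 3 * (7 + (i + suc (a + b)))
    e = solve-∀

  convUnit-mono : ∀ {k l} → k ≤ l → k * convUnit k ≤ l * convUnit l
  convUnit-mono p = *-mono-≤ p (+-monoʳ-≤ 5 (*-monoʳ-≤ 2 p))

  readUnit : ℕ → ℕ
  readUnit W = 2 + W * convUnit W

  read-runs : ∀ {n} W (T : RDT n) → descriptionLength T ≤ W →
              (⌜ T ⌝ ∷ []) ⊢ body read ↓ code T ∣ descriptionLength T * readUnit W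
  read-runs W (leaf p) le =
    weaken (≤-trans (s≤s (≤-trans (convUnit-mono (≤-trans (length₂≤size (value p)) (≤-trans (m≤n+m _ 2) le)))
      (n≤1+n _)))
                    (m≤m*n (readUnit W) (suc (suc (size ⌜ value p ⌝ℚ))) ⟨≤⟩ ≤-reflexive
                      (*-comm (readUnit W) _)))
      (pair?ₑ varₑ (nil?ₑ varₑ (nilₑ ∙ₑ callₑ (varₑ ∷ₑ nilₑ ∷ₑ [ nilₑ ]ₑ) (rational-read p))))
    where
    infixr 2 _⟨≤⟩_
    _⟨≤⟩_ : ∀ {a b c} → a ≤ b → b ≤ c → a ≤ c
    _⟨≤⟩_ = ≤-trans
  read-runs W (flip T₀ T₁) le =
    weaken (≤-trans (≤-reflexive (e (descriptionLength T₀ * readUnit W) (descriptionLength T₁ * readUnit W)))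
             (node-cost (descriptionLength T₀) (descriptionLength T₁) {w = 2}
               (flip-size (descriptionLength T₀) (descriptionLength T₁)) (s≤s (s≤s z≤n))))
      (pair?ₑ varₑ (pair?ₑ varₑ (nil?ₑ varₑ (pair?ₑ varₑ (varₑ ∙ₑ
        callₑ [ varₑ ]ₑ (read-runs W T₀
          (≤-trans (left (flip-size (descriptionLength T₀) (descriptionLength T₁))) le)) ∙ₑ
        callₑ [ varₑ ]ₑ (read-runs W T₁
          (≤-trans (right (flip-size (descriptionLength T₀) (descriptionLength T₁))) le)))))))
    where
    e : ∀ a b → suc a + suc b ≡ 2 + (a + b)
    e = solve-∀
  read-runs W (decide i T₀ T₁) le =
    weaken (≤-trans (≤-reflexive (e (descriptionLength T₀ * readUnit W) (descriptionLength T₁ * readUnit W)))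
             (node-cost (descriptionLength T₀) (descriptionLength T₁) {w = 2} small (s≤s (s≤s z≤n))))
      (pair?ₑ varₑ (pair?ₑ varₑ (pair?ₑ varₑ (pair?ₑ varₑ (pair?ₑ varₑ (varₑ ∙ₑ varₑ ∙ₑ
        callₑ [ varₑ ]ₑ (read-runs W T₀ (≤-trans (left small) le)) ∙ₑ
        callₑ [ varₑ ]ₑ (read-runs W T₁ (≤-trans (right small) le))))))))
    where
    small = decide-size (size (idx i)) (descriptionLength T₀) (descriptionLength T₁)
    e : ∀ a b → suc a + suc b ≡ 2 + (a + b)
    e = solve-∀

  readOnce-size : ∀ {n} (T : RDT n) → codeSize (readOnce T) ≤ codeSize T
  readOnce-size (leaf p)         = ≤-refl
  readOnce-size (flip T₀ T₁)     = +-monoʳ-≤ 5 (+-mono-≤ (readOnce-size T₀) (readOnce-size T₁))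
  readOnce-size (decide i T₀ T₁) = +-monoʳ-≤ 7 (+-monoʳ-≤ (size (idx i)) (s≤s (+-mono-≤
    (≤-trans (fix-size i false (readOnce T₀)) (readOnce-size T₀))
      (≤-trans (fix-size i true (readOnce T₁)) (readOnce-size T₁)))))

  tidyUnit : ℕ → ℕ
  tidyUnit W = 4 + 2 * (W * fixUnit W)

  tidy-runs : ∀ {n} W (T : RDT n) → codeSize T ≤ W →
              (code T ∷ []) ⊢ body tidy ↓ code (readOnce T) ∣ codeSize T * tidyUnit W
  tidy-runs W (leaf p) le = weaken z≤n (pair?ₑ varₑ (nil?ₑ varₑ varₑ))
  tidy-runs W (flip T₀ T₁) le =
    weaken (≤-trans (≤-reflexive (e (codeSize T₀ * tidyUnit W) (codeSize T₁ * tidyUnit W)))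
             (node-cost (codeSize T₀) (codeSize T₁) {w = 2} (flip-size (codeSize T₀) (codeSize T₁))
               (s≤s (s≤s z≤n))))
      (pair?ₑ varₑ (pair?ₑ varₑ (nil?ₑ varₑ (pair?ₑ varₑ (varₑ ∙ₑ
        callₑ [ varₑ ]ₑ (tidy-runs W T₀ (≤-trans (left (flip-size (codeSize T₀) (codeSize T₁))) le)) ∙ₑ
        callₑ [ varₑ ]ₑ (tidy-runs W T₁ (≤-trans (right (flip-size (codeSize T₀) (codeSize T₁))) le)))))))
    where
    e : ∀ a b → suc a + suc b ≡ 2 + (a + b)
    e = solve-∀
  tidy-runs W (decide i T₀ T₁) le =
    weaken (≤-trans (≤-reflexive (e (codeSize T₀ * tidyUnit W) (codeSize T₁ * tidyUnit W) (W * fixUnit W)))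
             (node-cost (codeSize T₀) (codeSize T₁) small ≤-refl))
      (pair?ₑ varₑ (pair?ₑ varₑ (pair?ₑ varₑ (pair?ₑ varₑ (pair?ₑ varₑ (varₑ ∙ₑ varₑ ∙ₑ
        callₑ (varₑ ∷ₑ nilₑ ∷ₑ [ callₑ [ varₑ ]ₑ (tidy-runs W T₀ (≤-trans (left small) le)) ]ₑ)
          (fixed false T₀ (≤-trans (left small) le)) ∙ₑ
        callₑ (varₑ ∷ₑ (nilₑ ∙ₑ nilₑ) ∷ₑ [ callₑ [ varₑ ]ₑ (tidy-runs W T₁ (≤-trans (right small) le)) ]ₑ)
          (fixed true T₁ (≤-trans (right small) le))))))))
    where
    small = decide-size (size (idx i)) (codeSize T₀) (codeSize T₁)
    e : ∀ a b f → suc (suc a + f) + suc (suc b + f) ≡ 4 + 2 * f + (a + b)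
    e = solve-∀
    fixed : ∀ b T → codeSize T ≤ W →
            (idx i ∷ bool b ∷ code (readOnce T) ∷ []) ⊢ body restrict ↓ code (fix i b (readOnce T)) ∣ W *
              fixUnit W
    fixed b T l = weaken (*-monoˡ-≤ (fixUnit W) (≤-trans (readOnce-size T) l))
      (fix-runs W i b (readOnce T) (≤-trans (index≤ (size (idx i))) le))

  hasQuery-runs : ∀ {n} (T : RDT n) → (code T ∷ []) ⊢ body hasQuery ↓ bool (queries? T) ∣ codeSize T
  hasQuery-runs (leaf p) = weaken z≤n (pair?ₑ varₑ (nil?ₑ varₑ nilₑ))
  hasQuery-runs (decide i T₀ T₁) =
    weaken z≤n (pair?ₑ varₑ (pair?ₑ varₑ (pair?ₑ varₑ (nilₑ ∙ₑ nilₑ))))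
  hasQuery-runs (flip T₀ T₁) =
    weaken (≤-trans (≤-reflexive (cong suc (+-suc (codeSize T₀) (codeSize T₁)))) (m≤n+m _ 3))
    (pair?ₑ varₑ (pair?ₑ varₑ (nil?ₑ varₑ (pair?ₑ varₑ (branch (queries? T₀) refl)))))
    where
    ρ : Vec Data 7
    ρ = code T₀ ∷ code T₁ ∷ nil ∷ nil ∷ (nil ∙ nil) ∷ (code T₀ ∙ code T₁) ∷ code (flip T₀ T₁) ∷ []
    test : ρ ⊢ call hasQuery (v0 ∷ []) ↓ bool (queries? T₀) ∣ suc (codeSize T₀)
    test = callₑ [ varₑ ]ₑ (hasQuery-runs T₀)
    branch : ∀ c → queries? T₀ ≡ c → ρ ⊢ case (call hasQuery (v0 ∷ [])) (call hasQuery (v1 ∷ [])) one ↓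
             bool (if c then true else queries? T₁) ∣ suc (codeSize T₀) + suc (codeSize T₁)
    branch false q = nil?ₑ (returning (cong bool q) test) (callₑ [ varₑ ]ₑ (hasQuery-runs T₁))
    branch true  q = weaken (+-monoʳ-≤ (suc (codeSize T₀)) z≤n)
      (pair?ₑ (returning (cong bool q) test) (nilₑ ∙ₑ nilₑ))

  -- Selecting outcomes

  -- The tag of a leaf is that of a label, the tag of an inner node that of a decision
  -- node, hence `refine` and `export` dispatch like the functions on trees.
  codeP : ∀ {n} → Partial n → Data
  codeP (rest R)         = nil ∙ code R
  codeP (decide i P₀ P₁) = (nil ∙ nil ∙ nil) ∙ idx i ∙ codeP P₀ ∙ codeP P₁

  codeScored : ∀ {n} → Fraction × Partial n → Data
  codeScored (s , P) = codeF s ∙ codeP P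

  module _ (k : ℕ) where
    opaque
      unfolding avgCost
      betterCost : ℕ
      betterCost = suc (suc (mulCost k) + suc (mulCost k) + precision k)

      better-runs : ∀ {n} {x y : Fraction × Partial n} → Fits k (proj₁ x) → Fits k (proj₁ y) →
                    (codeScored x ∷ codeScored y ∷ []) ⊢ body better ↓ codeScored (prefer x y) ∣ betterCost
      better-runs {n} {x} {y} F G = pair?ₑ varₑ (pair?ₑ varₑ (pair?ₑ varₑ (pair?ₑ varₑ (branch _ refl))))
        where
        f g : Fraction
        f = proj₁ x
        g = proj₁ y
        ρ : Vec Data 10
        ρ = bin (num g) ∷ bin (suc (den-1 g)) ∷ bin (num f) ∷ bin (suc (den-1 f)) ∷ codeF g ∷ codeP (proj₂ y) ∷
            codeF f ∷ codeP (proj₂ x) ∷ codeScored x ∷ codeScored y ∷ []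
        test : ρ ⊢ call lt (nil ∷ call mul (v2 ∷ v1 ∷ []) ∷ call mul (v0 ∷ v3 ∷ []) ∷ []) ↓ bool (less f g) ∣
          betterCost
        test = callₑ (nilₑ ∷ₑ callₑ (varₑ ∷ₑ [ varₑ ]ₑ) (times k (num≤ F) (Fits.den≤ G)) ∷ₑ
                       [ callₑ (varₑ ∷ₑ [ varₑ ]ₑ) (times k (num≤ G) (Fits.den≤ F)) ]ₑ)
                     (bin-lt (precision k) _ _ (≤p⇒<2^L k (product≤p k (num≤ F) (Fits.den≤ G))))
        branch : ∀ c → less f g ≡ c → ρ ⊢
          case (call lt (nil ∷ call mul (v2 ∷ v1 ∷ []) ∷ call mul (v0 ∷ v3 ∷ []) ∷ [])) v8 v11 ↓
          codeScored (if c then y else x) ∣ betterCost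
        branch false p = weaken (≤-reflexive (+-identityʳ _)) (nil?ₑ (returning (cong bool p) test) varₑ)
        branch true  p = weaken (≤-reflexive (+-identityʳ _)) (pair?ₑ (returning (cong bool p) test) varₑ)

  -- Scores at leaves are squares, which doubles the number of digits; each level
  -- adds one more.
  scoreBits : ℕ → ℕ
  scoreBits W = suc (2 * W)

  -- A property of both candidates holds for the chosen one.
  prefer-elim : ∀ {n} (Q : Fraction × Partial n → Set) x y → Q x → Q y → Q (prefer x y)
  prefer-elim Q x y p q with less (proj₁ x) (proj₁ y)
  ... | false = p
  ... | true  = q

  select-fits : ∀ {n} W (T R : RDT n) → codeSize R ≤ W → Fits (codeSize T * scoreBits W) (proj₁ (select T R))
  select-fits W (leaf p) R le =
    Fits-mono (≤-trans (≤-trans (*-monoʳ-≤ 2 le) (n≤1+n _)) (m≤m+n (scoreBits W) _))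
      (square-fits (average-fits R))
  select-fits W (flip T₀ T₁) R le = prefer-elim (λ x → Fits (codeSize (flip T₀ T₁) * scoreBits W) (proj₁ x))
    (select T₀ R) (select T₁ R)
    (Fits-mono (*-monoˡ-≤ (scoreBits W)
      (left {codeSize T₀} {codeSize T₁} (flip-size (codeSize T₀) (codeSize T₁)))) (select-fits W T₀ R le))
    (Fits-mono (*-monoˡ-≤ (scoreBits W)
      (right {codeSize T₀} {codeSize T₁} (flip-size (codeSize T₀) (codeSize T₁)))) (select-fits W T₁ R le))
  select-fits W (decide i T₀ T₁) R le =
    Fits-mono (node-cost (codeSize T₀) (codeSize T₁) (decide-size (size (idx i)) (codeSize T₀) (codeSize T₁))
      (s≤s z≤n))
      (midpoint-fits (select-fits W T₀ (fix i false R) (≤-trans (fix-size i false R) le))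
                     (select-fits W T₁ (fix i true R) (≤-trans (fix-size i true R) le)))

  module _ (W : ℕ) where
    private
      K = W * scoreBits W

    leafCost flipCost decideCost selUnit : ℕ
    leafCost   = suc (W * meanUnit W) + (suc (mulCost W) + suc (mulCost W))
    flipCost   = 3 + betterCost K
    decideCost = 6 + 2 * (W * fixUnit W) + avgCost K
    selUnit    = leafCost + (flipCost + decideCost)

    select-fits′ : ∀ {n} (T R : RDT n) → codeSize T ≤ W → codeSize R ≤ W → Fits K (proj₁ (select T R))
    select-fits′ T R p q = Fits-mono (*-monoˡ-≤ (scoreBits W) p) (select-fits W T R q)

    sel-runs : ∀ {n} (T R : RDT n) → codeSize T ≤ W → codeSize R ≤ W →
               (code T ∷ code R ∷ []) ⊢ body sel ↓ codeScored (select T R) ∣ codeSize T * selUnit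
    sel-runs T@(leaf p) R le le′ =
      weaken (≤-trans (+-mono-≤ (s≤s (*-monoˡ-≤ (meanUnit W) le′)) (≤-reflexive (+-identityʳ _)))
               (≤-trans (m≤m+n leafCost (flipCost + decideCost)) (m≤m+n selUnit _)))
        (pair?ₑ varₑ (nil?ₑ varₑ (letₑ (callₑ [ varₑ ]ₑ (mean-runs W R le′)) (pair?ₑ varₑ
          ((callₑ (varₑ ∷ₑ [ varₑ ]ₑ) (times W (num≤ F) (num≤ F)) ∙ₑ callₑ (varₑ ∷ₑ [ varₑ ]ₑ)
            (times W (Fits.den≤ F) (Fits.den≤ F))) ∙ₑ
            (nilₑ ∙ₑ varₑ))))))
      where
      F : Fits W (average R)
      F = Fits-mono le′ (average-fits R)
    sel-runs (flip T₀ T₁) R le le′ =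
      weaken (≤-trans (≤-reflexive (e (codeSize T₀ * selUnit) (codeSize T₁ * selUnit) (betterCost K)))
               (node-cost (codeSize T₀) (codeSize T₁) small
                 (≤-trans (m≤m+n flipCost decideCost) (m≤n+m _ leafCost))))
        (pair?ₑ varₑ (pair?ₑ varₑ (nil?ₑ varₑ (pair?ₑ varₑ
          (callₑ (callₑ (varₑ ∷ₑ [ varₑ ]ₑ) (sel-runs T₀ R l le′) ∷ₑ
            [ callₑ (varₑ ∷ₑ [ varₑ ]ₑ) (sel-runs T₁ R r le′) ]ₑ)
            (better-runs K (select-fits′ T₀ R l le′) (select-fits′ T₁ R r le′)))))))
      where
      small = flip-size (codeSize T₀) (codeSize T₁)
      l = ≤-trans (left small) le
      r = ≤-trans (right small) le
      e : ∀ a b c → suc (suc a + suc b + c) ≡ 3 + c + (a + b)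
      e = solve-∀
    sel-runs (decide i T₀ T₁) R le le′ =
      weaken (≤-trans (≤-reflexive (e (codeSize T₀ * selUnit) (codeSize T₁ * selUnit) (W * fixUnit W)
        (avgCost K)))
               (node-cost (codeSize T₀) (codeSize T₁) small
                 (≤-trans (m≤n+m decideCost flipCost) (m≤n+m _ leafCost))))
        (pair?ₑ varₑ (pair?ₑ varₑ (pair?ₑ varₑ (pair?ₑ varₑ (pair?ₑ varₑ
          (callₑ (varₑ ∷ₑ varₑ ∷ₑ
              callₑ (varₑ ∷ₑ [ callₑ (varₑ ∷ₑ nilₑ ∷ₑ [ varₑ ]ₑ) (fixed false) ]ₑ)
                (sel-runs T₀ (fix i false R) l (fix≤ false)) ∷ₑ
              [ callₑ (varₑ ∷ₑ [ callₑ (varₑ ∷ₑ (nilₑ ∙ₑ nilₑ) ∷ₑ [ varₑ ]ₑ) (fixed true) ]ₑ)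
                (sel-runs T₁ (fix i true R) r (fix≤ true)) ]ₑ)
            (pair?ₑ varₑ (pair?ₑ varₑ
              (callₑ (varₑ ∷ₑ [ varₑ ]ₑ) (avg-runs K (select-fits′ T₀ (fix i false R) l (fix≤ false))
                (select-fits′ T₁ (fix i true R) r (fix≤ true)))
                ∙ₑ (varₑ ∙ₑ varₑ ∙ₑ varₑ ∙ₑ varₑ))))))))))
      where
      small = decide-size (size (idx i)) (codeSize T₀) (codeSize T₁)
      l = ≤-trans (left small) le
      r = ≤-trans (right small) le
      fix≤ : ∀ b → codeSize (fix i b R) ≤ W
      fix≤ b = ≤-trans (fix-size i b R) le′
      fixed : ∀ b → (idx i ∷ bool b ∷ code R ∷ []) ⊢ body restrict ↓ code (fix i b R) ∣ W * fixUnit W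
      fixed b = weaken (*-monoˡ-≤ (fixUnit W) le′) (fix-runs W i b R (≤-trans (index≤ (size (idx i))) le))
      e : ∀ a b f c → suc (suc (suc f + a) + suc (suc f + b) + (suc c + 0)) ≡ 6 + 2 * f + c + (a + b)
      e = solve-∀

  -- Size and depth under refinement

  -- All trees at leaves have size at most W and query complexity at most q, and all
  -- indices have size at most W.
  data Bounded {n} (W q : ℕ) : Partial n → Set where
    rest   : ∀ {R} → codeSize R ≤ W → queries R ≤ q → Bounded W q (rest R)
    decide : ∀ {i P₀ P₁} → size (idx i) ≤ W → Bounded W q P₀ → Bounded W q P₁ → Bounded W q (decide i P₀ P₁)

  depth : ∀ {n} → Partial n → ℕ
  depth (rest R)         = 0
  depth (decide i P₀ P₁) = suc (depth P₀ ⊔ depth P₁)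

  fix-queries : ∀ {n} (i : Fin n) b T → queries (fix i b T) ≤ queries T
  fix-queries i b (leaf p)     = z≤n
  fix-queries i b (flip T₀ T₁) = ⊔-mono-≤ (fix-queries i b T₀) (fix-queries i b T₁)
  fix-queries i b (decide j T₀ T₁) with does (i ≟ j)
  fix-queries i b     (decide j T₀ T₁) | false = s≤s (⊔-mono-≤ (fix-queries i b T₀) (fix-queries i b T₁))
  fix-queries i false (decide j T₀ T₁) | true  = ≤-trans (fix-queries i false T₀)
    (≤-trans (m≤m⊔n _ (queries T₁)) (n≤1+n _))
  fix-queries i true  (decide j T₀ T₁) | true  = ≤-trans (fix-queries i true T₁)
    (≤-trans (m≤n⊔m (queries T₀) _) (n≤1+n _))

  readOnce-queries : ∀ {n} (T : RDT n) → queries (readOnce T) ≤ queries T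
  readOnce-queries (leaf p)         = z≤n
  readOnce-queries (flip T₀ T₁)     = ⊔-mono-≤ (readOnce-queries T₀) (readOnce-queries T₁)
  readOnce-queries (decide i T₀ T₁) = s≤s
    (⊔-mono-≤ (≤-trans (fix-queries i false (readOnce T₀)) (readOnce-queries T₀))
                                                    (≤-trans (fix-queries i true (readOnce T₁))
                                                      (readOnce-queries T₁)))

  select-bounded : ∀ {n W q} (T R : RDT n) → codeSize T ≤ W → codeSize R ≤ W → queries R ≤ q → Bounded W q
    (proj₂ (select T R))
  select-bounded (leaf p)     R t r s = rest r s
  select-bounded {W = W} {q} (flip T₀ T₁) R t r s = prefer-elim (Bounded W q ∘ proj₂) (select T₀ R)
    (select T₁ R)
    (select-bounded T₀ R (≤-trans (left small) t) r s) (select-bounded T₁ R (≤-trans (right small) t) r s)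
    where small = flip-size (codeSize T₀) (codeSize T₁)
  select-bounded (decide i T₀ T₁) R t r s = decide (≤-trans (index≤ (size (idx i))) t)
    (select-bounded T₀ (fix i false R) (≤-trans (left small) t) (≤-trans (fix-size i false R) r)
      (≤-trans (fix-queries i false R) s))
    (select-bounded T₁ (fix i true R) (≤-trans (right small) t) (≤-trans (fix-size i true R) r)
      (≤-trans (fix-queries i true R) s))
    where small = decide-size (size (idx i)) (codeSize T₀) (codeSize T₁)

  select-depth : ∀ {n} (T R : RDT n) → depth (proj₂ (select T R)) ≤ queries T
  select-depth (leaf p)     R = z≤n
  select-depth (flip T₀ T₁) R = prefer-elim (λ x → depth (proj₂ x) ≤ queries T₀ ⊔ queries T₁) (select T₀ R)
    (select T₁ R)
    (≤-trans (select-depth T₀ R) (m≤m⊔n (queries T₀) _)) (≤-trans (select-depth T₁ R) (m≤n⊔m (queries T₀) _))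
  select-depth (decide i T₀ T₁) R = s≤s
    (⊔-mono-≤ (select-depth T₀ (fix i false R)) (select-depth T₁ (fix i true R)))

  refine-bounded : ∀ {n W q} {P : Partial n} → Bounded W q P → Bounded W q (refineAll P)
  refine-bounded (rest {R} r s)   = select-bounded R R r r s
  refine-bounded (decide i p₀ p₁) = decide i (refine-bounded p₀) (refine-bounded p₁)

  refine-depth : ∀ {n W q} {P : Partial n} → Bounded W q P → depth (refineAll P) ≤ q + depth P
  refine-depth {q = q} (rest {R} r s) = ≤-trans (select-depth R R) (≤-trans s (m≤m+n q 0))
  refine-depth {q = q} {P} (decide {P₀ = P₀} {P₁} i p₀ p₁) =
    ≤-trans (s≤s (⊔-mono-≤ (refine-depth p₀) (refine-depth p₁)))
      (≤-reflexive (trans (cong suc (sym (+-distribˡ-⊔ q (depth P₀) (depth P₁))))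
        (sym (+-suc q (depth P₀ ⊔ depth P₁)))))

  refineTimes-bounded : ∀ {n W q} k {P : Partial n} → Bounded W q P → Bounded W q (refineTimes k P)
  refineTimes-bounded zero    p = p
  refineTimes-bounded (suc k) p = refine-bounded (refineTimes-bounded k p)

  refineTimes-depth : ∀ {n W q} k {P : Partial n} → Bounded W q P → depth (refineTimes k P) ≤ k * q + depth P
  refineTimes-depth zero    p = ≤-refl
  refineTimes-depth {q = q} (suc k) {P} p = ≤-trans (refine-depth (refineTimes-bounded k p))
    (≤-trans (+-monoʳ-≤ q (refineTimes-depth k p)) (≤-reflexive (sym (+-assoc q (k * q) (depth P)))))

  -- The summand 8 + W makes the bound propagate: it covers the tag, the pairing nodes
  -- and the index of a decision node.
  codeP-size : ∀ {n W q} {P : Partial n} → Bounded W q P → size (codeP P) ≤ 2 ^ depth P * (2 * (8 + W))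
  codeP-size {W = W} {q} b = ≤-trans (m≤m+n _ (8 + W)) (go b)
    where
    go : ∀ {n} {P : Partial n} → Bounded W q P → size (codeP P) + (8 + W) ≤ 2 ^ depth P * (2 * (8 + W))
    go (rest {R} r s) = ≤-trans (+-monoˡ-≤ (8 + W)
      (≤-trans (+-monoʳ-≤ 2 r) (+-monoˡ-≤ W {2} {8} (s≤s (s≤s z≤n)))))
      (≤-trans (≤-reflexive (cong (8 + W +_) (sym (+-identityʳ (8 + W))))) (≤-reflexive (sym (+-identityʳ _))))
    go (decide {i} {P₀} {P₁} j p₀ p₁) = begin
      size (codeP (decide i P₀ P₁)) + V                ≡⟨ e (size (idx i)) (size (codeP P₀)) (size (codeP P₁))
        V ⟩
      (8 + size (idx i)) + (size (codeP P₀) + size (codeP P₁)) + V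
        ≤⟨ +-monoˡ-≤ V (+-monoˡ-≤ (size (codeP P₀) + size (codeP P₁)) (+-monoʳ-≤ 8 j)) ⟩
      V + (size (codeP P₀) + size (codeP P₁)) + V      ≡⟨ e′ V (size (codeP P₀)) (size (codeP P₁)) ⟩
      (size (codeP P₀) + V) + (size (codeP P₁) + V)    ≤⟨ +-mono-≤ (go p₀) (go p₁) ⟩
      2 ^ depth P₀ * (2 * V) + 2 ^ depth P₁ * (2 * V)
        ≤⟨ +-mono-≤ (*-monoˡ-≤ (2 * V) (^-monoʳ-≤ 2 (m≤m⊔n (depth P₀) (depth P₁))))
                    (*-monoˡ-≤ (2 * V) (^-monoʳ-≤ 2 (m≤n⊔m (depth P₀) (depth P₁)))) ⟩
      x * (2 * V) + x * (2 * V)                        ≡⟨ e″ x (2 * V) ⟩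
      (2 * x) * (2 * V)                                ∎
      where
      open ≤-Reasoning
      V = 8 + W
      x = 2 ^ (depth P₀ ⊔ depth P₁)
      e : ∀ i a b V → 7 + (i + suc (a + b)) + V ≡ 8 + i + (a + b) + V
      e = solve-∀
      e′ : ∀ V a b → V + (a + b) + V ≡ (a + V) + (b + V)
      e′ = solve-∀
      e″ : ∀ x y → x * y + x * y ≡ (2 * x) * y
      e″ = solve-∀

  complete-queries : ∀ {n} (P : Partial n) → queries (complete P) ≡ depth P
  complete-queries (rest R)         = refl
  complete-queries (decide i P₀ P₁) = cong suc (cong₂ _⊔_ (complete-queries P₀) (complete-queries P₁))

  -- Writing the result

  length₂≤ : ∀ b W → suc b ≤ 2 ^ W → length₂ (suc b) ≤ suc W
  length₂≤ b W p = s≤s (≮⇒≥ λ W<l → <-irrefl refl (<-≤-trans (^-monoʳ-< 2 (s≤s (s≤s z≤n)) W<l)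
    (≤-trans (proj₁ (⌊log₂⌋-spec (suc b) (s≤s z≤n))) p)))

  outCost : ℕ → ℕ
  outCost W = suc W * outUnit (suc W)

  label-runs : ∀ W f (p : Proper f) → Fits W f →
               (bin (num f) ∷ bin (suc (den-1 f)) ∷ nil ∷ []) ⊢ body out ↓ ⌜ value (toLabel f p) ⌝ℚ ∣ outCost W
  label-runs W f p F = returning (append-nil (suc k) (num f) (suc (den-1 f)))
    (weaken (*-monoˡ-≤ (outUnit (suc W)) (length₂≤ (den-1 f) W (Fits.den≤ F)))
      (out-runs (suc W) k (num f) (suc (den-1 f)) nil
        (≤-<-trans (num≤ F) (^-monoʳ-< 2 (s≤s (s≤s z≤n)) (n<1+n W)))
        (≤-<-trans (Fits.den≤ F) (^-monoʳ-< 2 (s≤s (s≤s z≤n)) (n<1+n W)))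
        (proj₁ spec) (proj₂ spec)))
    where
    k : ℕ
    k = ⌊log₂ suc (den-1 f) ⌋
    spec : 2 ^ k ≤ suc (den-1 f) × suc (den-1 f) < 2 ^ suc k
    spec = ⌊log₂⌋-spec (suc (den-1 f)) (s≤s z≤n)

  label-size : ∀ W f (p : Proper f) → Fits W f → size ⌜ value (toLabel f p) ⌝ℚ ≤ 9 + 8 * W
  label-size W f p F = ≤-trans (digits²-size≤ (length₂ (suc (den-1 f))) (num f) (suc (den-1 f)))
    (≤-trans (+-monoʳ-≤ 1 (*-monoʳ-≤ 8 (length₂≤ (den-1 f) W (Fits.den≤ F))))
      (≤-reflexive (cong suc (*-suc 8 W))))

  -- Costs and output size per unit of size of a partial tree.
  refineUnit exportUnit outputUnit : ℕ → ℕ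
  refineUnit W = 2 + W * selUnit W
  exportUnit W = 2 + W * meanUnit W + outCost W
  outputUnit W = 11 + 8 * W

  module _ (W : ℕ) {n q : ℕ} where

    private
      node-size : ∀ (i : Fin n) (P₀ P₁ : Partial n) → suc (size (codeP P₀) + size (codeP P₁)) ≤ size
        (codeP (decide i P₀ P₁))
      node-size i P₀ P₁ = decide-size (size (idx i)) (size (codeP P₀)) (size (codeP P₁))

      two-calls : ∀ a b → suc a + suc b ≡ 2 + (a + b)
      two-calls = solve-∀

    refine-runs : ∀ {P : Partial n} → Bounded W q P →
                  (codeP P ∷ []) ⊢ body refine ↓ codeP (refineAll P) ∣ size (codeP P) * (refineUnit W)
    refine-runs (rest {R} r s) =
      weaken (≤-trans (≤-reflexive (+-identityʳ _)) (≤-trans (s≤s (≤-trans (*-monoˡ-≤ (selUnit W) r) (n≤1+n _)))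
        (m≤m+n (refineUnit W) _)))
        (pair?ₑ varₑ (nil?ₑ varₑ (pair?ₑ (callₑ (varₑ ∷ₑ [ varₑ ]ₑ) (sel-runs W R R r r)) varₑ)))
    refine-runs (decide {i} {P₀} {P₁} j p₀ p₁) =
      weaken (≤-trans (≤-reflexive (two-calls (size (codeP P₀) * (refineUnit W))
        (size (codeP P₁) * (refineUnit W))))
               (node-cost (size (codeP P₀)) (size (codeP P₁)) {w = 2} (node-size i P₀ P₁) (m≤m+n 2 _)))
        (pair?ₑ varₑ (pair?ₑ varₑ (pair?ₑ varₑ (pair?ₑ varₑ (varₑ ∙ₑ varₑ ∙ₑ
          callₑ [ varₑ ]ₑ (refine-runs p₀) ∙ₑ callₑ [ varₑ ]ₑ (refine-runs p₁))))))

    export-runs : ∀ {P : Partial n} → Bounded W q P →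
                  (codeP P ∷ []) ⊢ body export ↓ ⌜ complete P ⌝ ∣ size (codeP P) * (exportUnit W)
    export-runs (rest {R} r s) =
      weaken (≤-trans (≤-reflexive (+-suc (suc (codeSize R * meanUnit W)) (outCost W)))
               (≤-trans (+-monoˡ-≤ (outCost W) (+-monoʳ-≤ 2 (*-monoˡ-≤ (meanUnit W) r)))
                 (m≤m+n (exportUnit W) _)))
        (pair?ₑ varₑ (nil?ₑ varₑ (pair?ₑ (callₑ [ varₑ ]ₑ (mean-runs W R r))
          (nilₑ ∙ₑ callₑ (varₑ ∷ₑ varₑ ∷ₑ [ nilₑ ]ₑ)
            (label-runs W (average R) (average-proper R) (Fits-mono r (average-fits R)))))))
    export-runs (decide {i} {P₀} {P₁} j p₀ p₁) =
      weaken (≤-trans (≤-reflexive (two-calls (size (codeP P₀) * (exportUnit W))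
        (size (codeP P₁) * (exportUnit W))))
               (node-cost (size (codeP P₀)) (size (codeP P₁)) {w = 2} (node-size i P₀ P₁)
                 (m≤m+n 2 (W * meanUnit W + outCost W))))
        (pair?ₑ varₑ (pair?ₑ varₑ (pair?ₑ varₑ (pair?ₑ varₑ (varₑ ∙ₑ varₑ ∙ₑ
          callₑ [ varₑ ]ₑ (export-runs p₀) ∙ₑ callₑ [ varₑ ]ₑ (export-runs p₁))))))

    output-size : ∀ {P : Partial n} → Bounded W q P → descriptionLength (complete P) ≤ size (codeP P) *
      (outputUnit W)
    output-size (rest {R} r s) =
      ≤-trans (+-monoʳ-≤ 2 (label-size W (average R) (average-proper R) (Fits-mono r (average-fits R))))
        (m≤m+n (outputUnit W) _)
    output-size (decide {i} {P₀} {P₁} j p₀ p₁) = begin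
      7 + (x + suc (descriptionLength (complete P₀) + descriptionLength (complete P₁)))
        ≤⟨ +-monoʳ-≤ 7 (+-monoʳ-≤ x (s≤s (+-mono-≤ (output-size p₀) (output-size p₁)))) ⟩
      7 + (x + suc (size (codeP P₀) * U + size (codeP P₁) * U))
        ≤⟨ m≤m+n _ _ ⟩
      7 + (x + suc (size (codeP P₀) * U + size (codeP P₁) * U)) + (8 + x) * (10 + 8 * W)
        ≡⟨ e x (size (codeP P₀)) (size (codeP P₁)) W ⟩
      size (codeP (decide i P₀ P₁)) * U ∎
      where
      open ≤-Reasoning
      U = outputUnit W
      x = size (idx i)
      e : ∀ x a b W → 7 + (x + suc (a * (11 + 8 * W) + b * (11 + 8 * W))) + (8 + x) * (10 + 8 * W) ≡
                      (7 + (x + suc (a + b))) * (11 + 8 * W)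
      e = solve-∀

  -- The number of rounds

  -- A leading zero of the numerator of ε doubles the number of rounds; at the first
  -- digit 1 there are two rounds.
  roundsAt : ℕ → ℕ → ℕ
  roundsAt zero    r = r + r
  roundsAt (suc _) r = 2

  rounds : ℕ → ℕ → ℕ
  rounds zero    a = 0
  rounds (suc k) a = roundsAt (shift k a % 2) (rounds k a)

  -- All digits above position k vanish, so no reduction modulo 2 is needed.
  top-digit : ∀ k {a} → a < 2 ^ suc k → shift k a % 2 ≡ shift k a
  top-digit k p = m<n⇒m%n≡m (m<n*o⇒m/o<n {n = 2} {o = 2 ^ k} {{m^n≢0 2 k}} p)

  top-zero : ∀ k {a} → a < 2 ^ suc k → shift k a % 2 ≡ 0 → a < 2 ^ k
  top-zero k p q = m/n≡0⇒m<n {{m^n≢0 2 k}} (trans (sym (top-digit k p)) q)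

  top-one : ∀ k {a d} → shift k a % 2 ≡ suc d → 2 ^ k ≤ a
  top-one k {a} {d} q = ≮⇒≥ λ a< → 0≢1+n (trans (sym (cong (_% 2) (shift-zero k a<))) q)

  -- If b has k digits, then b < 2 ^ k ≤ 2 b, so that rounds * (a / b) lies between 1
  -- and 4.
  rounds-spec : ∀ k a → 0 < a → a < 2 ^ k → 2 ^ k ≤ rounds k a * a × rounds k a * a < 2 ^ suc k
  rounds-spec zero    .0 () (s≤s z≤n)
  rounds-spec (suc k) a p q with shift k a % 2 in eq
  ... | suc _ = *-monoʳ-≤ 2 (top-one k eq) , *-monoʳ-< 2 q
  ... | zero  with rounds-spec k a p (top-zero k q eq)
  ...   | lo , hi = ≤-trans (*-monoʳ-≤ 2 lo) (≤-reflexive (e (rounds k a) a)) ,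
                    ≤-<-trans (≤-reflexive (sym (e (rounds k a) a))) (*-monoʳ-< 2 hi)
    where
    e : ∀ r a → 2 * (r * a) ≡ (r + r) * a
    e = solve-∀

  module _ {n} (P : Partial n) (B J : ℕ)
    (step : ∀ j → j < J → (codeP (refineTimes j P) ∷ []) ⊢ body refine ↓ codeP (refineTimes (suc j) P) ∣ B) where

    -- The summand 2 absorbs the overhead of the two recursive calls.
    loop-runs : ∀ k a b j → 0 < a → a < 2 ^ k → rounds k a + j ≤ J →
                ∃[ C ] C + 2 ≤ rounds k a * (2 + B) ×
                       (digits² k a b ∷ codeP (refineTimes j P) ∷ []) ⊢ body loop ↓ codeP
                         (refineTimes (rounds k a + j) P) ∣ C
    loop-runs zero    .0 b j () (s≤s z≤n)
    loop-runs (suc k) a b j p q le with shift k a % 2 in eq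
    ... | suc d = _ , ≤-reflexive (e B) ,
      pair?ₑ varₑ (pair?ₑ varₑ (pair?ₑ varₑ
        (callₑ [ callₑ [ varₑ ]ₑ (step j (<-trans (n<1+n j) le)) ]ₑ (step (suc j) le))))
      where
      e : ∀ B → suc (suc B + B) + 2 ≡ 2 * (2 + B)
      e = solve-∀
    ... | zero with loop-runs k a b j p (top-zero k q eq)
      (≤-trans (+-monoˡ-≤ j (m≤m+n (rounds k a) (rounds k a))) le)
                 | loop-runs k a b (rounds k a + j) p (top-zero k q eq)
                   (≤-trans (≤-reflexive (sym (+-assoc (rounds k a) (rounds k a) j))) le)
    ...   | C₁ , c₁ , D₁ | C₂ , c₂ , D₂ =
      suc (suc C₁ + C₂) , ≤-trans (≤-reflexive (e C₁ C₂))
        (≤-trans (+-mono-≤ c₁ c₂) (≤-reflexive (sym (*-distribʳ-+ (2 + B) r r)))) ,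
      returning (cong (λ m → codeP (refineTimes m P)) (sym (+-assoc r r j)))
        (pair?ₑ varₑ (pair?ₑ varₑ (nil?ₑ varₑ (callₑ (varₑ ∷ₑ [ callₑ (varₑ ∷ₑ [ varₑ ]ₑ) D₁ ]ₑ) D₂))))
      where
      r = rounds k a
      e : ∀ x y → suc (suc x + y) + 2 ≡ (x + 2) + (y + 2)
      e = solve-∀

  -- W bounds the sizes of the trees read, Z those of the partial trees, and K is the
  -- number of rounds.
  mainCost : ℕ → ℕ → ℕ → ℕ
  mainCost W Z K = 5 + (W * readUnit W + W * tidyUnit W + W + Z * exportUnit W + K * (2 + Z * refineUnit W))

  module _ {n} (R : RDT n) (W : ℕ) (N≤W : 3 * descriptionLength R ≤ W) where

    private
      T : RDT n
      T = readOnce R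

      R≤W : codeSize R ≤ W
      R≤W = ≤-trans (code-size R) N≤W

      T≤W : codeSize T ≤ W
      T≤W = ≤-trans (readOnce-size R) R≤W

      N≤W′ : descriptionLength R ≤ W
      N≤W′ = ≤-trans (m≤n*m (descriptionLength R) 3) N≤W

      prepare : ∀ {d} → (⌜ R ⌝ ∷ d ∷ []) ⊢ call tidy (call read (v0 ∷ []) ∷ []) ↓ code T ∣ 2 +
        (W * readUnit W + W * tidyUnit W)
      prepare = weaken (s≤s (s≤s (+-mono-≤ (*-monoˡ-≤ (readUnit W) N≤W′) (*-monoˡ-≤ (tidyUnit W) R≤W))))
        (callₑ [ callₑ [ varₑ ]ₑ (read-runs W R N≤W′) ]ₑ (tidy-runs W R R≤W))

      test : ∀ {d} → (code T ∷ ⌜ R ⌝ ∷ d ∷ []) ⊢ call hasQuery (v0 ∷ []) ↓ bool (queries? T) ∣ suc W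
      test = weaken (s≤s T≤W) (callₑ [ varₑ ]ₑ (hasQuery-runs T))

    start-bounded : Bounded W (queries T) (rest T)
    start-bounded = rest T≤W ≤-refl

    main-runs-constant : ∀ Z d → queries? T ≡ false → size (codeP (rest T)) ≤ Z →
                         (⌜ R ⌝ ∷ d ∷ []) ⊢ main ↓ ⌜ complete (rest T) ⌝ ∣ mainCost W Z 0
    main-runs-constant Z d p z = weaken
      (≤-trans (≤-reflexive (e (W * readUnit W) (W * tidyUnit W) W (Z * exportUnit W))) (n≤1+n _))
      (letₑ prepare (nil?ₑ (returning (cong bool p) test)
        (callₑ [ nilₑ ∙ₑ varₑ ]ₑ (weaken (*-monoˡ-≤ (exportUnit W) z) (export-runs W start-bounded)))))
      where
      e : ∀ a b w z → 2 + (a + b) + (suc w + suc z) ≡ 4 + (a + b + w + z + 0)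
      e = solve-∀

    main-runs : ∀ Z k a b → queries? T ≡ true → 0 < a → a < 2 ^ k →
                (∀ j → j ≤ rounds k a → size (codeP (refineTimes j (rest T))) ≤ Z) →
                (⌜ R ⌝ ∷ digits² k a b ∷ []) ⊢ main ↓ ⌜ complete (refineTimes (rounds k a) (rest T)) ⌝ ∣
                  mainCost W Z (rounds k a)
    main-runs Z k a b p a>0 a< z
      with loop-runs (rest T) (Z * refineUnit W) (rounds k a)
             (λ j j<K → weaken (*-monoˡ-≤ (refineUnit W) (z j (<⇒≤ j<K)))
               (refine-runs W (refineTimes-bounded j start-bounded)))
             k a b 0 a>0 a< (≤-reflexive (+-identityʳ _))
    ... | C , c , D = weaken (≤-trans (≤-reflexive (e (W * readUnit W) (W * tidyUnit W) W (Z * exportUnit W) C))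
                                  (+-monoʳ-≤ 5 (+-monoʳ-≤ (W * readUnit W + W * tidyUnit W + W + Z * exportUnit
                                    W) (≤-trans (m≤m+n C 2) c))))
      (letₑ prepare (pair?ₑ (returning (cong bool p) test)
        (callₑ [ callₑ (varₑ ∷ₑ [ nilₑ ∙ₑ varₑ ]ₑ)
          (returning (cong (λ m → codeP (refineTimes m (rest T))) (+-identityʳ K)) D) ]ₑ
          (weaken (*-monoˡ-≤ (exportUnit W) (z K ≤-refl))
            (export-runs W (refineTimes-bounded K start-bounded))))))
      where
      K = rounds k a
      e : ∀ a b w z c → 2 + (a + b) + (suc w + suc (suc c + z)) ≡ 5 + (a + b + w + z + c)
      e = solve-∀

  -- Polynomial bounds

  -- Functions bounded by a polynomial; the argument is increased by 1 so that a
  -- monomial suffices.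
  record Polynomial (f : ℕ → ℕ) : Set where
    constructor poly
    field
      {coefficient degree} : ℕ
      bound                : ∀ M → f M ≤ coefficient * suc M ^ degree

  pattern degreeOf a k b = poly {coefficient = a} {degree = k} b

  const-poly : ∀ c → Polynomial (λ _ → c)
  const-poly c = degreeOf c 0 λ M → ≤-reflexive (sym (*-identityʳ c))

  id-poly : Polynomial (λ M → M)
  id-poly = degreeOf 1 1 λ M → ≤-trans (n≤1+n M)
    (≤-reflexive (sym (trans (+-identityʳ _) (*-identityʳ (suc M)))))

  infixl 6 _⊕_
  infixl 7 _⊗_

  _⊕_ : ∀ {f g} → Polynomial f → Polynomial g → Polynomial (λ M → f M + g M)
  _⊕_ {f} {g} (degreeOf a j p) (degreeOf b k q) = degreeOf (a + b) (j + k) λ M → begin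
    f M + g M                                       ≤⟨ +-mono-≤ (p M) (q M) ⟩
    a * suc M ^ j + b * suc M ^ k
      ≤⟨ +-mono-≤ (*-monoʳ-≤ a (^-monoʳ-≤ (suc M) (m≤m+n j k))) (*-monoʳ-≤ b (^-monoʳ-≤ (suc M) (m≤n+m k j))) ⟩
    a * suc M ^ (j + k) + b * suc M ^ (j + k)       ≡⟨ *-distribʳ-+ (suc M ^ (j + k)) a b ⟨
    (a + b) * suc M ^ (j + k)                       ∎
    where open ≤-Reasoning

  _⊗_ : ∀ {f g} → Polynomial f → Polynomial g → Polynomial (λ M → f M * g M)
  _⊗_ {f} {g} (degreeOf a j p) (degreeOf b k q) = degreeOf (a * b) (j + k) λ M → begin
    f M * g M                                       ≤⟨ *-mono-≤ (p M) (q M) ⟩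
    (a * suc M ^ j) * (b * suc M ^ k)               ≡⟨ e a b (suc M ^ j) (suc M ^ k) ⟩
    (a * b) * (suc M ^ j * suc M ^ k)               ≡⟨ cong (a * b *_) (^-distribˡ-+-* (suc M) j k) ⟨
    (a * b) * suc M ^ (j + k)                       ∎
    where
    open ≤-Reasoning
    e : ∀ a b x y → (a * x) * (b * y) ≡ (a * b) * (x * y)
    e = solve-∀

  ^-distrib-* : ∀ a b j → (a * b) ^ j ≡ a ^ j * b ^ j
  ^-distrib-* a b zero    = refl
  ^-distrib-* a b (suc j) = trans (cong (a * b *_) (^-distrib-* a b j)) (e a b (a ^ j) (b ^ j))
    where
    e : ∀ a b x y → (a * b) * (x * y) ≡ (a * x) * (b * y)
    e = solve-∀

  compose-poly : ∀ {f g} → Polynomial f → Polynomial g → Polynomial (λ M → f (g M))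
  compose-poly {f} {g} (degreeOf a j p) (degreeOf b k q) = degreeOf (a * suc b ^ j) (k * j) λ M → begin
    f (g M)                                    ≤⟨ p (g M) ⟩
    a * suc (g M) ^ j                          ≤⟨ *-monoʳ-≤ a (^-monoˡ-≤ j (s≤s (q M))) ⟩
    a * suc (b * suc M ^ k) ^ j                ≤⟨ *-monoʳ-≤ a
      (^-monoˡ-≤ j (+-monoˡ-≤ (b * suc M ^ k) (m^n>0 (suc M) k))) ⟩
    a * (suc b * suc M ^ k) ^ j                ≡⟨ cong (a *_) (^-distrib-* (suc b) (suc M ^ k) j) ⟩
    a * (suc b ^ j * (suc M ^ k) ^ j)          ≡⟨ *-assoc a (suc b ^ j) _ ⟨
    a * suc b ^ j * (suc M ^ k) ^ j            ≡⟨ cong (a * suc b ^ j *_) (^-*-assoc (suc M) k j) ⟩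
    a * suc b ^ j * suc M ^ (k * j)            ∎
    where open ≤-Reasoning

  private
    c : ∀ n → Polynomial (λ _ → n)
    c = const-poly
    X : Polynomial (λ M → M)
    X = id-poly

  addCost-poly : Polynomial (λ L → addCost L L)
  addCost-poly = X ⊗ (c 2 ⊕ X)

  mulUnit-poly : Polynomial mulUnit
  mulUnit-poly = c 3 ⊕ addCost-poly ⊕ X

  precision-poly : Polynomial precision
  precision-poly = c 2 ⊕ (X ⊕ X)

  mulCost-poly : Polynomial mulCost
  mulCost-poly = precision-poly ⊗ compose-poly mulUnit-poly precision-poly

  opaque
    unfolding avgCost betterCost

    avgCost-poly : Polynomial avgCost
    avgCost-poly = c 1 ⊕ (c 1 ⊕ mulCost-poly ⊕ (c 1 ⊕ mulCost-poly) ⊕ compose-poly addCost-poly precision-poly)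
      ⊕
                   (c 1 ⊕ (c 1 ⊕ mulCost-poly ⊕ precision-poly))

    betterCost-poly : Polynomial betterCost
    betterCost-poly = c 1 ⊕ (c 1 ⊕ mulCost-poly ⊕ (c 1 ⊕ mulCost-poly) ⊕ precision-poly)

  meanUnit-poly : Polynomial meanUnit
  meanUnit-poly = c 3 ⊕ avgCost-poly

  fixUnit-poly : Polynomial fixUnit
  fixUnit-poly = c 4 ⊕ c 2 ⊗ X

  convUnit-poly : Polynomial convUnit
  convUnit-poly = c 5 ⊕ c 2 ⊗ X

  readUnit-poly : Polynomial readUnit
  readUnit-poly = c 2 ⊕ X ⊗ convUnit-poly

  tidyUnit-poly : Polynomial tidyUnit
  tidyUnit-poly = c 4 ⊕ c 2 ⊗ (X ⊗ fixUnit-poly)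

  outCost-poly : Polynomial outCost
  outCost-poly = (c 1 ⊕ X) ⊗ (c 7 ⊕ c 2 ⊗ (c 1 ⊕ X))

  scores-poly : Polynomial (λ W → W * scoreBits W)
  scores-poly = X ⊗ (c 1 ⊕ c 2 ⊗ X)

  selUnit-poly : Polynomial selUnit
  selUnit-poly =
    (c 1 ⊕ X ⊗ meanUnit-poly ⊕ (c 1 ⊕ mulCost-poly ⊕ (c 1 ⊕ mulCost-poly))) ⊕
    ((c 3 ⊕ compose-poly betterCost-poly scores-poly) ⊕
     (c 6 ⊕ c 2 ⊗ (X ⊗ fixUnit-poly) ⊕ compose-poly avgCost-poly scores-poly))

  refineUnit-poly : Polynomial (λ W → 2 + W * selUnit W)
  refineUnit-poly = c 2 ⊕ X ⊗ selUnit-poly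

  exportUnit-poly : Polynomial (λ W → 2 + W * meanUnit W + outCost W)
  exportUnit-poly = c 2 ⊕ X ⊗ meanUnit-poly ⊕ outCost-poly

  -- Everything in terms of a bound M on the description length, on 2 to the depth of
  -- the partial trees, and on the number of rounds: `width` bounds the sizes of trees
  -- and `states` those of partial trees.
  width states : ℕ → ℕ
  width M = 3 * M
  states M = M * (2 * (8 + width M))

  width-poly : Polynomial width
  width-poly = c 3 ⊗ X

  states-poly : Polynomial states
  states-poly = X ⊗ (c 2 ⊗ (c 8 ⊕ width-poly))

  -- The number of steps plus the size of the output.
  totalTime : ℕ → ℕ
  totalTime M = nodes main + mainCost (width M) (states M) M * bodySize + states M * (11 + 8 * width M)

  totalTime-poly : Polynomial totalTime
  totalTime-poly =
    c (nodes main) ⊕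
    (c 5 ⊕ (width-poly ⊗ compose-poly readUnit-poly width-poly ⊕ width-poly ⊗ compose-poly tidyUnit-poly
      width-poly ⊕ width-poly ⊕
            states-poly ⊗ compose-poly exportUnit-poly width-poly ⊕
            X ⊗ (c 2 ⊕ states-poly ⊗ compose-poly refineUnit-poly width-poly))) ⊗ c bodySize ⊕
    states-poly ⊗ (c 11 ⊕ c 8 ⊗ width-poly)

-- Time, queries and error together

module Derandomization where

  open Trees
  open Evaluation
  open Algorithm
  open Analysis using (completed; refined-error; constant-error; reciprocal)
  open import Data.Bool.Base using (true; false)
  open import Data.Integer.Base as ℤ using (+_)
  import Data.Integer.Properties as ℤ
  open import Data.Nat.Base using (ℕ; zero; suc; _+_; _*_; _^_; _≤_; _<_; z≤n; s≤s)
  open import Data.Nat.Logarithm using (⌊log₂_⌋)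
  open import Data.Nat.Properties
  open import Data.Nat.Tactic.RingSolver using (solve-∀)
  open import Data.Product.Base using (Σ; ∃-syntax; _×_; _,_; proj₁; proj₂)
  open import Data.Rational.Unnormalised.Base as ℚᵘ using (ℚᵘ; mkℚᵘ; 0ℚᵘ; ½; *≤*; *<*)
  import Data.Rational.Unnormalised.Properties as ℚᵘ
  open import Data.Vec.Base using ([]; _∷_)
  open import Relation.Binary.PropositionalEquality

  module _ {n} (R : RDT n) (M : ℕ) (N≤M : descriptionLength R ≤ M) where

    N≤width : 3 * descriptionLength R ≤ width M
    N≤width = *-monoʳ-≤ 3 N≤M

    initial : Bounded (width M) (queries (readOnce R)) (rest (readOnce R))
    initial = start-bounded R (width M) N≤width

    within-total : ∀ {d K} (P : Partial n) → Bounded (width M) (queries (readOnce R)) P → size (codeP P) ≤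
      states M → K ≤ M →
                   (⌜ R ⌝ ∷ d ∷ []) ⊢ main ↓ ⌜ complete P ⌝ ∣ mainCost (width M) (states M) K →
                   ∃[ t ] (algorithm on (⌜ R ⌝ ∷ d ∷ []) returns ⌜ complete P ⌝ inTime t) × t ≤ totalTime M
    within-total {K = K} P bounded size≤Z K≤M (within {t} D calls≤) = t + size ⌜ complete P ⌝ , halts D ,
      +-mono-≤ (≤-trans (time-bound D) (+-monoʳ-≤ (nodes main) (*-monoˡ-≤ bodySize (≤-trans calls≤
                 (+-monoʳ-≤ 5 (+-monoʳ-≤ _ (*-monoˡ-≤ (2 + states M * refineUnit (width M)) K≤M)))))))
               (≤-trans (output-size (width M) bounded) (*-monoˡ-≤ (outputUnit (width M)) size≤Z))

  opaque
    -- Only the existence of the bound matters; its large coefficient is never computed.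
    timePolynomial : Polynomial totalTime
    timePolynomial = totalTime-poly

  -- The constants of the time bound.  The factor 2 ^ degree comes from 1 + M ≤ 2 M.
  coeff deg : ℕ
  coeff = Polynomial.coefficient timePolynomial * 2 ^ Polynomial.degree timePolynomial
  deg   = Polynomial.degree timePolynomial

  totalTime≤ : ∀ N e → 1 ≤ N → totalTime (N * 2 ^ e) ≤ (coeff * N ^ deg) * 2 ^ (e * deg)
  totalTime≤ N e N≥1 = begin
    totalTime M                       ≤⟨ Polynomial.bound timePolynomial M ⟩
    c * suc M ^ deg                   ≤⟨ *-monoʳ-≤ c
      (^-monoˡ-≤ deg (≤-trans (+-monoˡ-≤ M M≥1) (≤-reflexive (cong (λ z → M + z) (sym (+-identityʳ M)))))) ⟩
    c * (2 * M) ^ deg                 ≡⟨ cong (c *_) (^-distrib-* 2 M deg) ⟩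
    c * (2 ^ deg * M ^ deg)           ≡⟨ cong (λ z → c * (2 ^ deg * z))
      (trans (^-distrib-* N (2 ^ e) deg) (cong (N ^ deg *_) (^-*-assoc 2 e deg))) ⟩
    c * (2 ^ deg * (N ^ deg * 2 ^ (e * deg)))   ≡⟨ assoc c (2 ^ deg) (N ^ deg) (2 ^ (e * deg)) ⟩
    (coeff * N ^ deg) * 2 ^ (e * deg) ∎
    where
    open ≤-Reasoning
    M = N * 2 ^ e
    c = Polynomial.coefficient timePolynomial
    M≥1 : 1 ≤ M
    M≥1 = *-mono-≤ N≥1 (m^n>0 2 e)
    assoc : ∀ w x y z → w * (x * (y * z)) ≡ ((w * x) * y) * z
    assoc = solve-∀

  queries?-true : ∀ {n} (T : RDT n) → queries? T ≡ true → 1 ≤ queries T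
  queries?-true (decide i T₀ T₁) _ = s≤s z≤n
  queries?-true (flip T₀ T₁) p with queries? T₀ in q
  ... | true  = ≤-trans (queries?-true T₀ q) (m≤m⊔n _ _)
  ... | false = ≤-trans (queries?-true T₁ p) (m≤n⊔m (queries T₀) _)

  m<2^m : ∀ m → m < 2 ^ m
  m<2^m zero    = s≤s z≤n
  m<2^m (suc m) = ≤-trans (+-mono-≤ (m^n>0 2 m) (m<2^m m))
    (≤-reflexive (cong (λ z → 2 ^ m + z) (sym (+-identityʳ (2 ^ m)))))

  -- The precision parameter ε = a / b, of which `rounds` reads the numerator.
  module Precision (a′ d : ℕ) (ε<½ : mkℚᵘ (+ suc a′) d ℚᵘ.< ½) where
    a b L K : ℕ
    a = suc a′
    b = suc d
    L = length₂ b
    K = rounds L a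

    ε : ℚᵘ
    ε = mkℚᵘ (+ a) d

    a<b : a < b
    a<b = ≤-<-trans (m≤m*n a 2) (ℤ.drop‿+<+ (subst₂ ℤ._<_ (sym (ℤ.pos-* a 2)) (ℤ.*-identityˡ (+ b))
      (ℚᵘ.drop-*<* ε<½)))

    a<2^L : a < 2 ^ L
    a<2^L = <-trans a<b (length₂-spec b)

    b≤Ka : b ≤ K * a
    b≤Ka = ≤-trans (<⇒≤ (length₂-spec b)) (proj₁ (rounds-spec L a (s≤s z≤n) a<2^L))

    Ka≤4b : K * a ≤ 4 * b
    Ka≤4b = ≤-trans (<⇒≤ (proj₂ (rounds-spec L a (s≤s z≤n) a<2^L)))
      (≤-trans (≤-reflexive (sym (*-assoc 2 2 (2 ^ ⌊log₂ b ⌋))))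
        (*-monoʳ-≤ 4 (proj₁ (⌊log₂⌋-spec b (s≤s z≤n)))))

    reciprocal≤ε : reciprocal K ℚᵘ.≤ ε
    reciprocal≤ε = *≤* (subst₂ ℤ._≤_ (ℤ.pos-* 1 b) (ℤ.pos-* a (suc K)) (ℤ.+≤+
      (≤-trans (≤-reflexive (*-identityˡ b))
        (≤-trans b≤Ka (≤-trans (*-monoˡ-≤ a (n≤1+n K)) (≤-reflexive (*-comm (suc K) a)))))))

    -- From K a ≤ 4 b, that is, K ≤ 4 / ε.
    ≤q/ε : ∀ {m q′ q} c → m ≤ K * q′ * c → q′ ≤ q → m ≤[ 4 * c · q / ε ]
    ≤q/ε {m} {q′} {q} c m≤ q′≤q = *≤* (subst₂ ℤ._≤_
      (trans (ℤ.pos-* (m * a) 1) (cong (ℤ._* + 1) (ℤ.pos-* m a))) (ℤ.pos-* (4 * c * q) (1 * b))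
      (ℤ.+≤+ (begin
        m * a * 1              ≡⟨ *-identityʳ (m * a) ⟩
        m * a                  ≤⟨ *-monoˡ-≤ a m≤ ⟩
        K * q′ * c * a         ≡⟨ e₁ K q′ c a ⟩
        K * a * (q′ * c)       ≤⟨ *-mono-≤ Ka≤4b (*-monoˡ-≤ c q′≤q) ⟩
        4 * b * (q * c)        ≡⟨ e₂ b q c ⟩
        4 * c * q * (1 * b)    ∎)))
      where
      open ≤-Reasoning
      e₁ : ∀ K q c a → K * q * c * a ≡ K * a * (q * c)
      e₁ = solve-∀
      e₂ : ∀ b q c → 4 * b * (q * c) ≡ 4 * c * q * (1 * b)
      e₂ = solve-∀

  -- The guarantee for a single input.
  Derandomized : ∀ {n} → RDT n → ℕ → ℚᵘ → Set
  Derandomized {n} R q ε =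
    Σ (DDT n) λ D → ∃[ t ] ∃[ e ]
      ( algorithm on (⌜ R ⌝ ∷ ⌜ ε ⌝ℚ ∷ []) returns ⌜ proj₁ D ⌝ inTime t
      × t ≤ (coeff * descriptionLength R ^ deg) * 2 ^ e
      × e ≤[ 4 * suc deg · q / ε ]
      × queries (proj₁ D) ≤[ 4 * suc deg · q / ε ]
      × 𝔼 (λ x → (value (runᴰ D x) ℚᵘ.- 𝔼 (λ r → value (run R x r))) ²) ℚᵘ.≤ ε )

  derandomize : ∀ {n} (R : RDT n) (q : ℕ) → queries R ≤ q → (ε : ℚᵘ) → 0ℚᵘ ℚᵘ.< ε → ε ℚᵘ.< ½ → Derandomized R q
    ε
  derandomize R q R≤q (mkℚᵘ (+ 0) d) (*<* (ℤ.+<+ ())) _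
  derandomize R q R≤q (mkℚᵘ (ℤ.-[1+ _ ]) d) (*<* ()) _
  derandomize {n} R q R≤q (mkℚᵘ (+ suc a′) d) 0<ε ε<½ = by-cases (queries? T) refl
    where
    open Precision a′ d ε<½
    T : RDT n
    T = readOnce R
    N q′ : ℕ
    N = descriptionLength R
    q′ = queries T
    q′≤q : q′ ≤ q
    q′≤q = ≤-trans (readOnce-queries R) R≤q
    N≥1 : 1 ≤ N
    N≥1 = 1≤size ⌜ R ⌝

    -- For e = 0 the bound M is kept in the form N * 2 ^ e.
    N≤N1 : N ≤ N * 2 ^ 0
    N≤N1 = m≤m*n N 1

    M : ℕ
    M = N * 2 ^ (K * q′)

    N≤M : N ≤ M
    N≤M = m≤m*n N (2 ^ (K * q′)) {{m^n≢0 2 (K * q′)}}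

    2^≤M : 2 ^ (K * q′) ≤ M
    2^≤M = ≤-trans (≤-reflexive (sym (*-identityˡ (2 ^ (K * q′))))) (*-monoˡ-≤ (2 ^ (K * q′)) N≥1)

    K≤M : queries? T ≡ true → K ≤ M
    K≤M p = ≤-trans (≤-trans (≤-reflexive (sym (*-identityʳ K))) (*-monoʳ-≤ K (queries?-true T p)))
                    (≤-trans (<⇒≤ (m<2^m (K * q′))) 2^≤M)

    start : Bounded (width M) q′ (rest T)
    start = initial R M N≤M

    depth≤ : ∀ j → depth (refineTimes j (rest T)) ≤ j * q′
    depth≤ j = ≤-trans (refineTimes-depth j start) (≤-reflexive (+-identityʳ (j * q′)))

    small : ∀ j → j ≤ K → size (codeP (refineTimes j (rest T))) ≤ states M
    small j j≤K = ≤-trans (codeP-size (refineTimes-bounded j start)) (*-monoˡ-≤ (2 * (8 + width M))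
      (≤-trans (^-monoʳ-≤ 2 (≤-trans (depth≤ j) (*-monoˡ-≤ q′ j≤K))) 2^≤M))

    constant-small : size (codeP (rest T)) ≤ states (N * 2 ^ 0)
    constant-small = ≤-trans (codeP-size (initial R (N * 2 ^ 0) N≤N1))
      (*-monoˡ-≤ (2 * (8 + width (N * 2 ^ 0))) (≤-trans N≥1 N≤N1))

    Halts : Partial n → ℕ → Set
    Halts P e = ∃[ t ] (algorithm on (⌜ R ⌝ ∷ ⌜ ε ⌝ℚ ∷ []) returns ⌜ complete P ⌝ inTime t) × t ≤ totalTime
      (N * 2 ^ e)

    Error≤ε : Partial n → Set
    Error≤ε P = 𝔼 (λ x → (value (runᴰ (completed P) x) ℚᵘ.- 𝔼 (λ r → value (run R x r))) ²) ℚᵘ.≤ ε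

    -- With M = N * 2 ^ e, the bound of degree `deg` in M contributes the exponent
    -- e * deg.  The factor suc deg in the constant covers this exponent as well as the
    -- depth.
    conclude : ∀ P e → Halts P e → e ≤ K * q′ → depth P ≤ K * q′ → Error≤ε P → Derandomized R q ε
    conclude P e (t , halting , t≤) e≤ depth≤ error = completed P , t , e * deg , halting ,
      ≤-trans t≤ (totalTime≤ N e N≥1) ,
      ≤q/ε {e * deg} {q′} {q} (suc deg) (*-mono-≤ e≤ (n≤1+n deg)) q′≤q ,
      ≤q/ε {queries (complete P)} {q′} {q} (suc deg)
        (≤-trans (≤-reflexive (complete-queries P)) (≤-trans depth≤ (m≤m*n (K * q′) (suc deg)))) q′≤q ,
      error

    constant-halts : queries? T ≡ false → Halts (rest T) 0
    constant-halts p = within-total R (N * 2 ^ 0) N≤N1 (rest T) (initial R (N * 2 ^ 0) N≤N1) constant-small z≤n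
      (main-runs-constant R (width (N * 2 ^ 0)) (N≤width R (N * 2 ^ 0) N≤N1) (states (N * 2 ^ 0)) ⌜ ε ⌝ℚ p
        constant-small)

    refined-halts : queries? T ≡ true → Halts (refineTimes K (rest T)) (K * q′)
    refined-halts p = within-total R M N≤M (refineTimes K (rest T)) (refineTimes-bounded K start)
      (small K ≤-refl) (K≤M p)
      (main-runs R (width M) (N≤width R M N≤M) (states M) L a b p (s≤s z≤n) a<2^L small)

    -- A tree without queries is answered exactly, with e = 0.  Otherwise q′ is at least
    -- 1, so that K ≤ K q′ is covered by 2 ^ (K q′).
    by-cases : ∀ c → queries? T ≡ c → Derandomized R q ε
    by-cases false p = conclude (rest T) 0 (constant-halts p) z≤n z≤n
      (ℚᵘ.≤-trans (ℚᵘ.≤-reflexive (constant-error R p)) (ℚᵘ.<⇒≤ 0<ε))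
    by-cases true  p = conclude (refineTimes K (rest T)) (K * q′) (refined-halts p) ≤-refl (depth≤ K)
      (ℚᵘ.≤-trans (refined-error K R) reciprocal≤ε)

open Derandomization using (derandomize; coeff; deg)
open Algorithm using (algorithm)
open import Data.Nat.Base using (ℕ; suc; _*_; _^_; _≤_)
open import Data.Product.Base using (Σ; ∃-syntax; _×_; _,_; proj₁)
open import Data.Rational.Unnormalised.Base as ℚᵘ using (ℚᵘ; 0ℚᵘ; ½)
open import Data.Vec.Base using ([]; _∷_)

theorem1 : Σ (Program 2) λ 𝓐 → ∃[ a ] ∃[ k ] ∃[ C ]
    (∀ {n} (R : RDT n) (q : ℕ) → queries R ≤ q →
    (ε : ℚᵘ) → 0ℚᵘ ℚᵘ.< ε → ε ℚᵘ.< ½ →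
    Σ (DDT n) λ D → ∃[ t ] ∃[ e ]
    ( 𝓐 on (⌜ R ⌝ ∷ ⌜ ε ⌝ℚ ∷ []) returns ⌜ proj₁ D ⌝ inTime t
    × t ≤ (a * descriptionLength R ^ k) * 2 ^ e
    × e ≤[ C · q / ε ]
    × queries (proj₁ D) ≤[ C · q / ε ]
    × 𝔼 (λ x → (value (runᴰ D x) ℚᵘ.- 𝔼 (λ r → value (run R x r))) ²) ℚᵘ.≤ ε ))
theorem1 = algorithm , coeff , deg , 4 * suc deg , derandomize
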